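{- There is an algorithm which, given any trim $\epsilon$-cycle free finite automaton $A$, decides in time $O(|A|_E^2)$ whether $A$ is exponentially ambiguous.
   Context: A finite automaton is a tuple $A=(\Sigma,Q,E,I,F)$ with $\Sigma$ a finite alphabet, $Q$ a finite set of states, $I\subseteq Q$ initial states, $F\subseteq Q$ final states, and $E\subseteq Q\times(\Sigma\cup\{\epsilon\})\times Q$ a finite set of transitions, where $\epsilon$ is the empty string. $|A|_E$ is the number of transitions. A successful path is a path from an initial state to a final state; its label is the concatenation of the labels of its transitions (an element of $\Sigma^*$). $A$ is trim if every state lies on a successful path. $A$ is $\epsilon$-cycle free if it has no cycle (of positive length) all of whose transitions are labeled $\epsilon$. For $x\in\Sigma^*$, $\mathrm{da}(A,x)$ is the number of successful paths of $A$ labeled $x$, and $\mathrm{da}(A)=\sup_{x\in\Sigma^*}\mathrm{da}(A,x)$. $A$ is finitely ambiguous if $\mathrm{da}(A)<\infty$ and infinitely ambiguous otherwise. $A$ is polynomially ambiguous if there is a polynomial $h\in\mathbb{N}[X]$ with $\mathrm{da}(A,x)\le h(|x|)$ for all $x\in\Sigma^*$. $A$ is exponentially ambiguous if it is infinitely ambiguous but not polynomially ambiguous. Running times are worst-case times in the usual RAM model. -}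

module Defs where

open import Data.Bool using (Bool; if_then_else_)
open import Data.Fin using (Fin; toℕ)
open import Data.Fin.Subset using (Subset) renaming (_∈_ to _∈ₛ_)
open import Data.List using (List; []; _∷_; _++_; length; map; foldr; concatMap; catMaybes; head; drop)
open import Data.List.Membership.Propositional using (_∈_)
open import Data.List.Relation.Unary.All using (All)
open import Data.List.Relation.Unary.Unique.Propositional using (Unique)
open import Data.Maybe using (Maybe; just; nothing; maybe′; fromMaybe)
open import Data.Nat using (ℕ; zero; suc; _+_; _*_; _∸_; _≤_; _≡ᵇ_)
open import Data.Product using (∃; _×_; _,_)
open import Data.Sum using (_⊎_; inj₁; inj₂)
open import Data.Vec using (toList)
open import Function.Bundles using (_⇔_)
open import Relation.Binary.PropositionalEquality using (_≡_; _≢_)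
open import Relation.Nullary using (¬_)

-- A label is `nothing` for ε and `just a` for a letter a.
record Transition (k n : ℕ) : Set where
  constructor _—[_]→_
  field
    source : Fin n
    label  : Maybe (Fin k)
    target : Fin n

open Transition public

-- The set E is represented by a duplicate-free list, in arbitrary order.
record Automaton : Set where
  field
    alphabetSize : ℕ
    stateCount   : ℕ
    transitions  : List (Transition alphabetSize stateCount)
    distinct     : Unique transitions
    initial      : Subset stateCount
    final        : Subset stateCount

  Letter : Set
  Letter = Fin alphabetSize

  State : Set
  State = Fin stateCount

  Edge : Set
  Edge = Transition alphabetSize stateCount

open Automaton public

∣_∣ᴱ : Automaton → ℕ
∣ A ∣ᴱ = length (transitions A)

data IsPath (A : Automaton) : State A → List (Edge A) → State A → Set where
  []  : ∀ {q} → IsPath A q [] q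
  _∷_ : ∀ {p a r es q} → (p —[ a ]→ r) ∈ transitions A →
        IsPath A r es q → IsPath A p ((p —[ a ]→ r) ∷ es) q

word : ∀ {k n} → List (Transition k n) → List (Fin k)
word es = catMaybes (map label es)

-- A path is recorded by its origin together with its transitions; the origin
-- is needed to tell apart the empty paths at different states.
Successful : (A : Automaton) → List (Letter A) → State A × List (Edge A) → Set
Successful A x (i , es) =
  i ∈ₛ initial A × (∃ λ f → f ∈ₛ final A × IsPath A i es f) × word es ≡ x

Trim : Automaton → Set
Trim A = ∀ (q : State A) →
  ∃ λ i → ∃ λ es → ∃ λ es′ → ∃ λ f →
    i ∈ₛ initial A × f ∈ₛ final A × IsPath A i es q × IsPath A q es′ f

εCycleFree : Automaton → Set
εCycleFree A = ∀ (q : State A) (es : List (Edge A)) → es ≢ [] →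
  IsPath A q es q → ¬ All (λ e → label e ≡ nothing) es

record Count {X : Set} (P : X → Set) (m : ℕ) : Set where
  field
    elements : List X
    unique   : Unique elements
    exact    : ∀ x → x ∈ elements ⇔ P x
    size     : length elements ≡ m

-- da(A,x) as a relation, since in general da(A,x) may be infinite; it then
-- has no value and lies below no natural number.
da[_,_]≈_ : (A : Automaton) → List (Letter A) → ℕ → Set
da[ A , x ]≈ m = Count (Successful A x) m

da[_,_]≤_ : (A : Automaton) → List (Letter A) → ℕ → Set
da[ A , x ]≤ N = ∃ λ m → da[ A , x ]≈ m × m ≤ N

FinitelyAmbiguous : Automaton → Set
FinitelyAmbiguous A = ∃ λ N → ∀ x → da[ A , x ]≤ N

InfinitelyAmbiguous : Automaton → Set
InfinitelyAmbiguous A = ¬ FinitelyAmbiguous A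

-- Polynomials in ℕ[X] as coefficient lists, constant term first.
eval : List ℕ → ℕ → ℕ
eval h n = foldr (λ c v → c + n * v) 0 h

PolynomiallyAmbiguous : Automaton → Set
PolynomiallyAmbiguous A = ∃ λ h → ∀ x → da[ A , x ]≤ eval h (length x)

ExponentiallyAmbiguous : Automaton → Set
ExponentiallyAmbiguous A = InfinitelyAmbiguous A × ¬ PolynomiallyAmbiguous A

-- Unit-cost RAM with addition and (truncated) subtraction as its only
-- arithmetic. Multiplication is left out, because at unit cost on unbounded
-- numbers it would make the model unreasonably strong.

Reg : Set
Reg = ℕ

data Instr : Set where
  const : Reg → ℕ → Instr
  add   : Reg → Reg → Reg → Instr
  sub   : Reg → Reg → Reg → Instr
  load  : Reg → Reg → Instr
  store : Reg → Reg → Instr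
  jump  : ℕ → Instr
  jzero : Reg → ℕ → Instr
  halt  : Bool → Instr

Program : Set
Program = List Instr

record Config : Set where
  constructor config
  field
    pc  : ℕ
    reg : ℕ → ℕ
    mem : ℕ → ℕ

open Config public

_[_↦_] : (ℕ → ℕ) → ℕ → ℕ → (ℕ → ℕ)
(f [ k ↦ v ]) j = if j ≡ᵇ k then v else f j

exec : Instr → Config → Config ⊎ Bool
exec (const d c) (config p R M) = inj₁ (config (suc p) (R [ d ↦ c ]) M)
exec (add d s t) (config p R M) = inj₁ (config (suc p) (R [ d ↦ R s + R t ]) M)
exec (sub d s t) (config p R M) = inj₁ (config (suc p) (R [ d ↦ R s ∸ R t ]) M)
exec (load d s)  (config p R M) = inj₁ (config (suc p) (R [ d ↦ M (R s) ]) M)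
exec (store d s) (config p R M) = inj₁ (config (suc p) R (M [ R d ↦ R s ]))
exec (jump l)    (config p R M) = inj₁ (config l R M)
exec (jzero r l) (config p R M) = inj₁ (config (if R r ≡ᵇ 0 then l else suc p) R M)
exec (halt b)    _              = inj₂ b

-- `run P t c ≡ just b` iff P, started in c, halts with verdict b after
-- executing at most t instructions (the final `halt` included). A program
-- counter outside the program is a crash, not a halt.
mutual
  run : Program → ℕ → Config → Maybe Bool
  run P zero    c = nothing
  run P (suc t) c = maybe′ (λ i → continue P t (exec i c)) nothing (head (drop (pc c) P))

  continue : Program → ℕ → Config ⊎ Bool → Maybe Bool
  continue P t (inj₁ c) = run P t c
  continue P t (inj₂ b) = just b

-- The input occupies memory from address 0 on; everything else is zero.
start : List ℕ → Config
start input = config 0 (λ _ → 0) (λ a → fromMaybe 0 (head (drop a input)))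

-- Automata as machine input:
--   |Q|, |Σ|, |E|, the transitions as triples (source, label, target) with
--   ε coded as 0 and the letter a as 1 + a, then the characteristic
--   vectors of I and F.

encodeTransition : ∀ {k n} → Transition k n → List ℕ
encodeTransition (p —[ a ]→ q) =
  toℕ p ∷ maybe′ (λ l → suc (toℕ l)) 0 a ∷ toℕ q ∷ []

encodeSubset : ∀ {n} → Subset n → List ℕ
encodeSubset S = map (λ b → if b then 1 else 0) (toList S)

encode : Automaton → List ℕ
encode A =
  stateCount A ∷ alphabetSize A ∷ ∣ A ∣ᴱ ∷
  concatMap encodeTransition (transitions A) ++
  encodeSubset (initial A) ++ encodeSubset (final A)

{-# OPTIONS --safe #-}
-- For a trim ε-cycle free automaton, exponential ambiguity means that it is not polynomially ambiguous. If two
-- different paths with the same ends, all of whose transitions lie on cycles, spell the same word, then they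
-- close up to two cycles at one state with equal labels and different first transitions; iterating these in
-- any order gives 2 ^ k paths for words of length O(k). If there are no two such paths, then a path is
-- determined by its ends, its label, and the places in that label of its transitions that lie on no cycle. No
-- such transition occurs twice in a path, so the number of paths is polynomial in the length of the word.
--
-- A first search finds the transitions on cycles. A second one looks for two runs that separate at a state
-- and meet again. The left run is committed to a transition that the right run has already skipped in the
-- adjacency list, so the runs differ from the outset and ε-moves can be interleaved freely, without a filter.
-- A run is a position in an adjacency list, where it can only skip or take the current entry. Hence every
-- pair of runs has at most five successors, and there are O(|E|²) pairs.
module Submission where

open import Defs
open import Data.Bool as Bool using (Bool; true; false; not; if_then_else_; T)
open import Data.Empty using (⊥; ⊥-elim)
open import Data.Fin as Fin using (Fin; toℕ; fromℕ<)
open import Data.Fin.Properties as Finₚ using (toℕ<n; toℕ-injective; toℕ-fromℕ<; fromℕ<-toℕ)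
open import Data.Fin.Subset using (Subset) renaming (_∈_ to _∈ₛ_)
import Data.Fin.Subset.Properties as Subsetₚ
open import Data.List using (List; []; _∷_; _++_; length; map; head; take; drop; lookup; filter; deduplicate; concatMap; catMaybes; allFin; upTo; cartesianProduct; cartesianProductWith)
open import Data.List.Membership.Propositional using (_∈_; _∉_)
open import Data.List.Membership.Propositional.Properties using (∈-++⁺ˡ; ∈-++⁺ʳ; ∈-++⁻; ∈-∃++; ∈-map⁺; ∈-map⁻; ∈-allFin; ∈-upTo⁺; ∈-lookup; ∈-filter⁺; ∈-filter⁻; ∈-deduplicate⁺; ∈-concatMap⁺; ∈-cartesianProduct⁺; ∈-cartesianProductWith⁺)
import Data.List.Membership.DecPropositional as DecMembership
open import Data.List.Properties using (++-assoc; ++-identityʳ; ++-cancelˡ; ++-cancelʳ; ∷-injectiveˡ; ∷-injectiveʳ; ≡-dec; length-++; length-++-≤ˡ; length-map; length-drop; length-upTo; length-tabulate; length-filter; length-deduplicate; mapMaybe-++; drop-drop)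
open import Data.List.Relation.Unary.All as All using (All; []; _∷_)
import Data.List.Relation.Unary.All.Properties as Allₚ
open import Data.List.Relation.Unary.AllPairs using ([]; _∷_)
open import Data.List.Relation.Unary.Any as Any using (here; there)
open import Data.List.Relation.Unary.Any.Properties using (lookup-index)
open import Data.List.Relation.Unary.Unique.Propositional using (Unique)
import Data.List.Relation.Unary.Unique.DecPropositional.Properties as DecUniqueₚ
import Data.List.Relation.Unary.Unique.Propositional.Properties as Uniqueₚ
open import Data.Maybe using (Maybe; just; nothing; maybe′; fromMaybe)
import Data.Maybe.Properties as Maybeₚ
open import Data.Nat
open import Data.Nat.DivMod using (_%_; [m+kn]%n≡m%n; m<n⇒m%n≡m)
open import Data.Nat.ListAction using (sum)
open import Data.Nat.Properties
open import Data.Nat.Tactic.RingSolver using (solve-∀)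
open import Data.Product using (∃; _×_; _,_; proj₁; proj₂)
import Data.Product.Properties as Productₚ
open import Data.Sum using (_⊎_; inj₁; inj₂; [_,_]′)
open import Data.Unit using (⊤; tt)
open import Data.Vec using (toList)
open import Data.Vec.Properties using (length-toList)
open import Function using (_∘_; id; mk⇔; Equivalence)
open import Relation.Binary.Definitions using (DecidableEquality; tri<; tri≈; tri>)
open import Relation.Binary.PropositionalEquality
open import Relation.Nullary using (¬_; Dec; yes; no; does)
open import Relation.Nullary.Decidable using (_×-dec_; map′)
open import Relation.Nullary.Reflects using (Reflects; ofʸ; ofⁿ)

-- Lists

-- The time bound may depend on `|E|` alone, yet a trim automaton can have any number of isolated
-- states that are both initial and final. Hence no loop runs over states: the array of list heads
-- lies beyond the input, where memory is zero, and zero is the address of `nil`, so all adjacency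
-- lists start out empty at no cost. The machine cannot multiply, so the row addresses of the matrix
-- of marks are tabulated once by repeated addition. The two searches share that matrix and are told
-- apart by the marks 1 and 2. Transitions that lie on no cycle are not unlinked from their lists;
-- their targets are set to `nil`, so that a run that takes one is dead. ε-cycle freeness enters the
-- second search in one degenerate case, where the left run returns to its origin before the right
-- one has moved; it also bounds the length of a path in terms of its label.

unique-⊆⇒length≤ : ∀ {X : Set} {xs ys : List X} → Unique xs → (∀ {x} → x ∈ xs → x ∈ ys) → length xs ≤ length ys
unique-⊆⇒length≤ {xs = []} _ _ = z≤n
unique-⊆⇒length≤ {X} {x ∷ xs} u@(_ ∷ u′) incl with ∈-∃++ (incl (here refl))
... | as , bs , refl = begin
  suc (length xs)               ≤⟨ s≤s (unique-⊆⇒length≤ u′ incl′) ⟩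
  suc (length (as ++ bs))       ≡⟨ cong suc (length-++ as) ⟩
  suc (length as + length bs)   ≡⟨ +-suc (length as) (length bs) ⟨
  length as + suc (length bs)   ≡⟨ length-++ as ⟨
  length (as ++ x ∷ bs)         ∎
  where
  open ≤-Reasoning
  incl′ : ∀ {y} → y ∈ xs → y ∈ as ++ bs
  incl′ y∈xs with ∈-++⁻ as (incl (there y∈xs))
  ... | inj₁ y∈as         = ∈-++⁺ˡ y∈as
  ... | inj₂ (here refl)  = ⊥-elim (Uniqueₚ.Unique[x∷xs]⇒x∉xs u y∈xs)
  ... | inj₂ (there y∈bs) = ∈-++⁺ʳ as y∈bs

unique-lookup-injective : ∀ {X : Set} {xs : List X} → Unique xs → ∀ i j → lookup xs i ≡ lookup xs j → i ≡ j
unique-lookup-injective (_ ∷ _)  Fin.zero    Fin.zero    _  = refl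
unique-lookup-injective (x ∷ _)  Fin.zero    (Fin.suc j) eq = ⊥-elim (All.lookup x (∈-lookup j) eq)
unique-lookup-injective (x ∷ _)  (Fin.suc i) Fin.zero    eq = ⊥-elim (All.lookup x (∈-lookup i) (sym eq))
unique-lookup-injective (_ ∷ xs) (Fin.suc i) (Fin.suc j) eq = cong Fin.suc (unique-lookup-injective xs i j eq)

unique-Fin⇒length≤ : ∀ {k} {xs : List (Fin k)} → Unique xs → length xs ≤ k
unique-Fin⇒length≤ {k} u = ≤-trans (unique-⊆⇒length≤ u (λ {x} _ → ∈-allFin x)) (≤-reflexive (length-tabulate {n = k} id))

length-cartesianProduct : ∀ {X Y : Set} (xs : List X) (ys : List Y) → length (cartesianProduct xs ys) ≡ length xs * length ys
length-cartesianProduct []       ys = refl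
length-cartesianProduct (x ∷ xs) ys = trans (length-++ (map (x ,_) ys))
  (cong₂ _+_ (length-map (x ,_) ys) (length-cartesianProduct xs ys))

length-concatMap≤ : ∀ {X Y : Set} (f : X → List Y) {k} → (∀ x → length (f x) ≤ k) → ∀ xs → length (concatMap f xs) ≤ length xs * k
length-concatMap≤ f f≤ []       = z≤n
length-concatMap≤ f f≤ (x ∷ xs) = ≤-trans (≤-reflexive (length-++ (f x))) (+-mono-≤ (f≤ x) (length-concatMap≤ f f≤ xs))

∈-concatMap : ∀ {X Y : Set} (f : X → List Y) {x y xs} → x ∈ xs → y ∈ f x → y ∈ concatMap f xs
∈-concatMap f {y = y} x∈ y∈ = ∈-concatMap⁺ f (Any.map (λ { refl → y∈ }) x∈)

unique-singleton : ∀ {X : Set} {xs : List X} → Unique xs → (∀ {x y} → x ∈ xs → y ∈ xs → x ≡ y) → length xs ≤ 1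
unique-singleton {xs = []}          _                _    = z≤n
unique-singleton {xs = _ ∷ []}      _                _    = s≤s z≤n
unique-singleton {xs = _ ∷ _ ∷ _}   ((x≢y ∷ _) ∷ _) same = ⊥-elim (x≢y (same (here refl) (there (here refl))))

take-++ : ∀ {X : Set} (u v : List X) → take (length u) (u ++ v) ≡ u
take-++ []      v = refl
take-++ (a ∷ u) v = cong (a ∷_) (take-++ u v)

drop-++ : ∀ {X : Set} (u v : List X) → drop (length u) (u ++ v) ≡ v
drop-++ []      v = refl
drop-++ (a ∷ u) v = drop-++ u v

-- Polynomials

n<2^n : ∀ n → n < 2 ^ n
n<2^n zero    = s≤s z≤n
n<2^n (suc n) = begin-strict
  suc n                ≤⟨ n<2^n n ⟩
  2 ^ n                <⟨ m<m+n (2 ^ n) (≤-trans (s≤s z≤n) (n<2^n n)) ⟩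
  2 ^ n + 2 ^ n        ≡⟨ cong (2 ^ n +_) (+-identityʳ (2 ^ n)) ⟨
  2 ^ suc n            ∎
  where open ≤-Reasoning

-- Coarse, but a single power of `1 + N` can be compared with a power of two by exponents alone.
eval≤power : ∀ h N → eval h N ≤ sum h * (1 + N) ^ length h
eval≤power []      N = z≤n
eval≤power (c ∷ h) N = begin
  c + N * eval h N                        ≤⟨ +-monoʳ-≤ c (*-monoʳ-≤ N (eval≤power h N)) ⟩
  c + N * (sum h * p)                     ≤⟨ +-mono-≤ c≤ (m≤n+m (N * (sum h * p)) (sum h * p)) ⟩
  c * (p + N * p) + (sum h * p + N * (sum h * p)) ≡⟨ collect c (sum h) N p ⟩
  (c + sum h) * ((1 + N) * p)             ∎
  where
  open ≤-Reasoning
  p : ℕ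
  p = (1 + N) ^ length h
  p>0 : 0 < p
  p>0 = m^n>0 (1 + N) (length h)
  c≤ : c ≤ c * (p + N * p)
  c≤ = m≤m*n c (p + N * p) {{>-nonZero (≤-trans p>0 (m≤m+n p (N * p)))}}
  collect : ∀ c s N p → c * (p + N * p) + (s * p + N * (s * p)) ≡ (c + s) * ((1 + N) * p)
  collect = solve-∀

-- For k = 2 ^ j ∸ 1 the polynomial is at most 2 to a power that is linear in j.
eval<2^ : ∀ h a b → ∃ λ k → eval h (a + k * b) < 2 ^ k
eval<2^ h a b = k , (begin-strict
  eval h (a + k * b)                    ≤⟨ eval≤power h (a + k * b) ⟩
  S * (1 + (a + k * b)) ^ d             ≤⟨ *-mono-≤ (<⇒≤ (n<2^n S)) (^-monoˡ-≤ d base≤) ⟩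
  2 ^ S * (2 ^ (c + j)) ^ d             ≡⟨ cong (2 ^ S *_) (^-*-assoc 2 (c + j) d) ⟩
  2 ^ S * 2 ^ ((c + j) * d)             ≡⟨ ^-distribˡ-+-* 2 S ((c + j) * d) ⟨
  2 ^ (S + (c + j) * d)                 <⟨ ^-monoʳ-< 2 (s≤s (s≤s z≤n)) exponent< ⟩
  2 ^ k                                 ∎)
  where
  open ≤-Reasoning
  S d c i j k : ℕ
  S = sum h
  d = length h
  c = 1 + a + b
  -- The exponent `S + (c + (i + i)) * d` is linear in `i` with slope `2 * d` and constant term
  -- `S + c * d`. As `i` exceeds the sum of both, the square `(1 + i) * (1 + i)` wins, and
  -- `j = i + i` puts `2 ^ j` above that square.
  i = 1 + S + c * d + 2 * d
  j = i + i
  k = 2 ^ j ∸ 1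
  1+k : 1 + k ≡ 2 ^ j
  1+k = m+[n∸m]≡n (≤-trans (s≤s z≤n) (n<2^n j))
  base≤ : 1 + (a + k * b) ≤ 2 ^ (c + j)
  base≤ = begin
    1 + (a + k * b)                          ≤⟨ m≤m+n _ (b + k + k * a) ⟩
    1 + (a + k * b) + (b + k + k * a)        ≡⟨ collect a b k ⟩
    (1 + a + b) * (1 + k)                    ≤⟨ *-monoˡ-≤ (1 + k) (<⇒≤ (n<2^n c)) ⟩
    2 ^ c * (1 + k)                          ≡⟨ cong (2 ^ c *_) 1+k ⟩
    2 ^ c * 2 ^ j                            ≡⟨ ^-distribˡ-+-* 2 c j ⟨
    2 ^ (c + j)                              ∎
    where
    collect : ∀ a b k → 1 + (a + k * b) + (b + k + k * a) ≡ (1 + a + b) * (1 + k)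
    collect = solve-∀
  exponent< : S + (c + j) * d < k
  exponent< = ≤-pred (begin
    2 + (S + (c + j) * d)                    ≤⟨ m≤m+n _ _ ⟩
    2 + (S + (c + j) * d) + ((S + c * d + 2 * d) * (1 + S + c * d) + (1 + S + c * d + 2 * d) * 2) ≡⟨ collect S c d ⟩
    (1 + i) * (1 + i)                        ≤⟨ *-mono-≤ (n<2^n i) (n<2^n i) ⟩
    2 ^ i * 2 ^ i                            ≡⟨ ^-distribˡ-+-* 2 i i ⟨
    2 ^ j                                    ≡⟨ 1+k ⟨
    1 + k                                    ∎)
    where
    collect : ∀ S c d → let i = 1 + S + c * d + 2 * d in
      2 + (S + (c + (i + i)) * d) + ((S + c * d + 2 * d) * (1 + S + c * d) + (1 + S + c * d + 2 * d) * 2) ≡ (1 + i) * (1 + i)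
    collect = solve-∀

infixl 6 _⊞_
_⊞_ : List ℕ → List ℕ → List ℕ
[]      ⊞ g       = g
(a ∷ f) ⊞ []      = a ∷ f
(a ∷ f) ⊞ (b ∷ g) = a + b ∷ f ⊞ g

eval-⊞ : ∀ f g N → eval (f ⊞ g) N ≡ eval f N + eval g N
eval-⊞ []      g       N = refl
eval-⊞ (a ∷ f) []      N = sym (+-identityʳ _)
eval-⊞ (a ∷ f) (b ∷ g) N = trans (cong (λ v → a + b + N * v) (eval-⊞ f g N)) (collect a b N (eval f N) (eval g N))
  where
  collect : ∀ a b N u v → a + b + N * (u + v) ≡ a + N * u + (b + N * v)
  collect = solve-∀

eval-scale : ∀ c f N → eval (map (c *_) f) N ≡ c * eval f N
eval-scale c []      N = sym (*-zeroʳ c)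
eval-scale c (a ∷ f) N = trans (cong (λ v → c * a + N * v) (eval-scale c f N)) (collect c a N (eval f N))
  where
  collect : ∀ c a N v → c * a + N * (c * v) ≡ c * (a + N * v)
  collect = solve-∀

-- A structured language for the machine

record Store : Set where
  constructor store
  field
    ρ : ℕ → ℕ
    μ : ℕ → ℕ
open Store public

infix 8 _≔#_ _≔_⊕_ _≔_⊖_ _≔[_] [_]≔_
data Op : Set where
  _≔#_   : Reg → ℕ → Op
  _≔_⊕_  : Reg → Reg → Reg → Op
  _≔_⊖_  : Reg → Reg → Reg → Op
  _≔[_]  : Reg → Reg → Op
  [_]≔_  : Reg → Reg → Op

instr : Op → Instr
instr (d ≔# c)    = const d c
instr (d ≔ s ⊕ t) = add d s t
instr (d ≔ s ⊖ t) = sub d s t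
instr (d ≔[ s ])  = load d s
instr ([ d ]≔ s)  = store d s

step : Op → Store → Store
step (d ≔# c)    (store R M) = store (R [ d ↦ c ]) M
step (d ≔ s ⊕ t) (store R M) = store (R [ d ↦ R s + R t ]) M
step (d ≔ s ⊖ t) (store R M) = store (R [ d ↦ R s ∸ R t ]) M
step (d ≔[ s ])  (store R M) = store (R [ d ↦ M (R s) ]) M
step ([ d ]≔ s)  (store R M) = store R (M [ R d ↦ R s ])

steps : List Op → Store → Store
steps []       s = s
steps (o ∷ os) s = steps os (step o s)

infixr 5 _⨾_
data Cmd : Set where
  ops   : List Op → Cmd
  _⨾_   : Cmd → Cmd → Cmd
  when  : Reg → Cmd → Cmd
  while : Reg → Cmd → Cmd

codeSize : Cmd → ℕ
codeSize (ops os)    = length os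
codeSize (c ⨾ d)     = codeSize c + codeSize d
codeSize (when r c)  = 1 + codeSize c
codeSize (while r c) = 2 + codeSize c

-- The position `p` is a parameter because jump targets are absolute.
compile : ℕ → Cmd → Program
compile p (ops os)    = map instr os
compile p (c ⨾ d)     = compile p c ++ compile (p + codeSize c) d
compile p (when r c)  = jzero r (p + (1 + codeSize c)) ∷ compile (suc p) c
compile p (while r c) = jzero r (p + (2 + codeSize c)) ∷ compile (suc p) c ++ jump p ∷ []

-- The last index is the exact number of instructions executed: a test costs 1, and a loop round one
-- more for the jump back.
data Exec : Cmd → Store → Store → ℕ → Set where
  ops    : ∀ {os s} → Exec (ops os) s (steps os s) (length os)
  _⨾_    : ∀ {c d s s′ s″ t u} → Exec c s s′ t → Exec d s′ s″ u → Exec (c ⨾ d) s s″ (t + u)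
  skip   : ∀ {r c s} → ρ s r ≡ 0 → Exec (when r c) s s 1
  enter  : ∀ {r c s s′ t} → ρ s r ≢ 0 → Exec c s s′ t → Exec (when r c) s s′ (1 + t)
  exit   : ∀ {r c s} → ρ s r ≡ 0 → Exec (while r c) s s 1
  loop   : ∀ {r c s s′ s″ t u} → ρ s r ≢ 0 → Exec c s s′ t → Exec (while r c) s′ s″ u →
           Exec (while r c) s s″ (2 + t + u)

length-compile : ∀ p c → length (compile p c) ≡ codeSize c
length-compile p (ops os)    = length-map instr os
length-compile p (c ⨾ d)     = trans (length-++ (compile p c))
  (cong₂ _+_ (length-compile p c) (length-compile (p + codeSize c) d))
length-compile p (when r c)  = cong suc (length-compile (suc p) c)
length-compile p (while r c) = cong suc (trans (length-++ (compile (suc p) c))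
  (trans (+-comm _ 1) (cong suc (length-compile (suc p) c))))

record CodeAt (P : Program) (p : ℕ) (code : Program) : Set where
  constructor _,_
  field
    rest    : Program
    located : drop p P ≡ code ++ rest

CodeAt-++ˡ : ∀ {P p} xs {ys} → CodeAt P p (xs ++ ys) → CodeAt P p xs
CodeAt-++ˡ xs {ys} (rest , eq) = ys ++ rest , trans eq (++-assoc xs ys rest)

CodeAt-++ʳ : ∀ {P p} xs {ys} → CodeAt P p (xs ++ ys) → CodeAt P (p + length xs) ys
CodeAt-++ʳ {P} {p} xs {ys} (rest , eq) = rest , (begin
  drop (p + length xs) P                   ≡⟨ drop-drop p (length xs) P ⟨
  drop (length xs) (drop p P)              ≡⟨ cong (drop (length xs)) (trans eq (++-assoc xs ys rest)) ⟩
  drop (length xs) (xs ++ ys ++ rest)      ≡⟨ drop-++ xs (ys ++ rest) ⟩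
  ys ++ rest                               ∎)
  where open ≡-Reasoning

CodeAt-tail : ∀ {P p i code} → CodeAt P p (i ∷ code) → CodeAt P (suc p) code
CodeAt-tail {P} {p} {i} {code} at = subst (λ q → CodeAt P q code) (+-comm p 1) (CodeAt-++ʳ (i ∷ []) at)

config-of : ℕ → Store → Config
config-of p s = config p (ρ s) (μ s)

run-fetch : ∀ {P p i code} s u → CodeAt P p (i ∷ code) →
  run P (suc u) (config-of p s) ≡ continue P u (exec i (config-of p s))
run-fetch s u (rest , eq) rewrite eq = refl

exec-step : ∀ o p s → exec (instr o) (config-of p s) ≡ inj₁ (config-of (suc p) (step o s))
exec-step (d ≔# c)    p s = refl
exec-step (d ≔ x ⊕ t) p s = refl
exec-step (d ≔ x ⊖ t) p s = refl
exec-step (d ≔[ x ])  p s = refl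
exec-step ([ d ]≔ x)  p s = refl

≡ᵇ0-false : ∀ {v} → v ≢ 0 → (v ≡ᵇ 0) ≡ false
≡ᵇ0-false {zero}  v≢0 = ⊥-elim (v≢0 refl)
≡ᵇ0-false {suc v} v≢0 = refl

run-jzero-taken : ∀ {P p r l code} s u → CodeAt P p (jzero r l ∷ code) → ρ s r ≡ 0 →
  run P (suc u) (config-of p s) ≡ run P u (config-of l s)
run-jzero-taken {P} {p} {r} {l} s u at r≡0 = trans (run-fetch s u at)
  (cong (λ b → run P u (config (if b then l else suc p) (ρ s) (μ s))) (cong (_≡ᵇ 0) r≡0))

run-jzero-fallthrough : ∀ {P p r l code} s u → CodeAt P p (jzero r l ∷ code) → ρ s r ≢ 0 →
  run P (suc u) (config-of p s) ≡ run P u (config-of (suc p) s)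
run-jzero-fallthrough {P} {p} {r} {l} s u at r≢0 = trans (run-fetch s u at)
  (cong (λ b → run P u (config (if b then l else suc p) (ρ s) (μ s))) (≡ᵇ0-false r≢0))

run-ops : ∀ {P} os p s u → CodeAt P p (map instr os) →
  run P (length os + u) (config-of p s) ≡ run P u (config-of (p + length os) (steps os s))
run-ops []       p s u at = cong (λ q → run _ u (config-of q s)) (sym (+-identityʳ p))
run-ops {P} (o ∷ os) p s u at = begin
  run P (suc (length os + u)) (config-of p s)               ≡⟨ run-fetch s _ at ⟩
  continue P (length os + u) (exec (instr o) (config-of p s)) ≡⟨ cong (continue P _) (exec-step o p s) ⟩
  run P (length os + u) (config-of (suc p) (step o s))      ≡⟨ run-ops os (suc p) (step o s) u (CodeAt-tail at) ⟩
  run P u (config-of (suc p + length os) _)                 ≡⟨ cong (λ q → run P u (config-of q (steps os (step o s)))) (+-suc p (length os)) ⟨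
  run P u (config-of (p + suc (length os)) _)               ∎
  where open ≡-Reasoning

-- The surplus fuel `u` is arbitrary, so that whatever follows a command can be run on it;
-- sequencing is then associativity of addition.
run-compile : ∀ {P c s s′ t} p u → Exec c s s′ t → CodeAt P p (compile p c) →
  run P (t + u) (config-of p s) ≡ run P u (config-of (p + codeSize c) s′)
run-compile p u (ops {os} {s}) at = run-ops os p s u at
run-compile {P} {c ⨾ d} {s} {s″} p u (_⨾_ {s′ = s′} {t = t₁} {u = t₂} e f) at = begin
  run P (t₁ + t₂ + u) (config-of p s)             ≡⟨ cong (λ v → run P v (config-of p s)) (+-assoc t₁ t₂ u) ⟩
  run P (t₁ + (t₂ + u)) (config-of p s)           ≡⟨ run-compile p (t₂ + u) e (CodeAt-++ˡ (compile p c) at) ⟩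
  run P (t₂ + u) (config-of (p + codeSize c) s′)      ≡⟨ run-compile (p + codeSize c) u f at-d ⟩
  run P u (config-of (p + codeSize c + codeSize d) s″)    ≡⟨ cong (λ q → run P u (config-of q s″)) (+-assoc p (codeSize c) (codeSize d)) ⟩
  run P u (config-of (p + (codeSize c + codeSize d)) s″)  ∎
  where
  open ≡-Reasoning
  at-d : CodeAt P (p + codeSize c) (compile (p + codeSize c) d)
  at-d = subst (λ l → CodeAt P (p + l) (compile (p + codeSize c) d)) (length-compile p c)
               (CodeAt-++ʳ (compile p c) at)
run-compile {s = s} p u (skip r≡0) at = run-jzero-taken s u at r≡0
run-compile {P} {when r c} {s} {s′} p u (enter {t = t} r≢0 e) at = begin
  run P (suc (t + u)) (config-of p s)      ≡⟨ run-jzero-fallthrough s (t + u) at r≢0 ⟩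
  run P (t + u) (config-of (suc p) s)      ≡⟨ run-compile (suc p) u e (CodeAt-tail at) ⟩
  run P u (config-of (suc p + codeSize c) s′)  ≡⟨ cong (λ q → run P u (config-of q s′)) (+-suc p (codeSize c)) ⟨
  run P u (config-of (p + suc (codeSize c)) s′) ∎
  where open ≡-Reasoning
run-compile {s = s} p u (exit r≡0) at = run-jzero-taken s u at r≡0
run-compile {P} {while r c} {s} {s″} p u (loop {s′ = s′} {t = t₁} {u = t₂} r≢0 e f) at = begin
  run P (2 + t₁ + t₂ + u) (config-of p s)            ≡⟨ cong (λ v → run P v (config-of p s)) arith ⟩
  run P (suc (t₁ + suc (t₂ + u))) (config-of p s)    ≡⟨ run-jzero-fallthrough s _ at r≢0 ⟩
  run P (t₁ + suc (t₂ + u)) (config-of (suc p) s)    ≡⟨ run-compile (suc p) _ e (CodeAt-++ˡ (compile (suc p) c) (CodeAt-tail at)) ⟩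
  run P (suc (t₂ + u)) (config-of (suc p + codeSize c) s′) ≡⟨ run-fetch s′ (t₂ + u) at-jump ⟩
  run P (t₂ + u) (config-of p s′)                    ≡⟨ run-compile p u f at ⟩
  run P u (config-of (p + (2 + codeSize c)) s″)          ∎
  where
  open ≡-Reasoning
  arith : 2 + t₁ + t₂ + u ≡ suc (t₁ + suc (t₂ + u))
  arith = cong suc (trans (cong suc (+-assoc t₁ t₂ u)) (sym (+-suc t₁ (t₂ + u))))
  at-jump : CodeAt P (suc p + codeSize c) (jump p ∷ [])
  at-jump = subst (λ l → CodeAt P (suc p + l) (jump p ∷ [])) (length-compile (suc p) c)
                  (CodeAt-++ʳ (compile (suc p) c) (CodeAt-tail at))

-- Correctness triples with time bounds

record Within (t : ℕ) (c : Cmd) (s : Store) (Post : Store → Set) : Set where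
  constructor within
  field
    {result} : Store
    {time}   : ℕ
    executes : Exec c s result time
    time≤    : time ≤ t
    holds    : Post result

ops-within : ∀ {os s Post} → Post (steps os s) → Within (length os) (ops os) s Post
ops-within post = within ops ≤-refl post

infixr 5 _then_
_then_ : ∀ {t u c d s Mid Post} → Within t c s Mid →
  (∀ {s′} → Mid s′ → Within u d s′ Post) → Within (t + u) (c ⨾ d) s Post
within e le mid then k with k mid
... | within f le′ post = within (e ⨾ f) (+-mono-≤ le le′) post

after-ops : ∀ {u os d s Post} → Within u d (steps os s) Post → Within (length os + u) (ops os ⨾ d) s Post
after-ops {os = os} (within e le post) = within (ops ⨾ e) (+-monoʳ-≤ (length os) le) post

relax : ∀ {t u c s P Q} → t ≤ u → (∀ {s′} → P s′ → Q s′) → Within t c s P → Within u c s Q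
relax t≤u f (within e le p) = within e (≤-trans le t≤u) (f p)

when-within : ∀ {t r c s Post} → (ρ s r ≡ 0 → Post s) → (ρ s r ≢ 0 → Within t c s Post) →
  Within (1 + t) (when r c) s Post
when-within {r = r} {s = s} skipped entered with ρ s r ≟ 0
... | yes r≡0 = within (skip r≡0) (s≤s z≤n) (skipped r≡0)
... | no  r≢0 with entered r≢0
...   | within e le post = within (enter r≢0 e) (s≤s le) post

-- The variant may drop by more than one in a round, so the induction is on an upper bound `w` of
-- it, which is also the number of rounds charged.
while-within : ∀ {t r c} (Inv : ℕ → Store → Set) →
  (∀ {v s} → Inv v s → ρ s r ≢ 0 → Within t c s (λ s′ → ∃ λ v′ → v′ < v × Inv v′ s′)) →
  ∀ {v} w {s} → v ≤ w → Inv v s →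
  Within (w * (2 + t) + 1) (while r c) s (λ s′ → ρ s′ r ≡ 0 × ∃ λ v′ → Inv v′ s′)
while-within {t} {r} Inv body {v} w {s} v≤w inv with ρ s r ≟ 0
... | yes r≡0 = within (exit r≡0) (m≤n+m 1 (w * (2 + t))) (r≡0 , v , inv)
... | no  r≢0 with body inv r≢0
...   | within e le (v′ , v′<v , inv′) with w
...     | zero  = ⊥-elim (n≮0 (≤-trans v′<v v≤w))
...     | suc w with while-within Inv body w (≤-pred (≤-trans v′<v v≤w)) inv′
...       | within f le′ post = within (loop r≢0 e f)
            (≤-trans (+-mono-≤ (s≤s (s≤s le)) le′) (≤-reflexive (sym (+-assoc (2 + t) (w * (2 + t)) 1)))) post

-- Here the loop register is itself the variant, so the invariant at the exit is known to be the one
-- of index 0.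
for-within : ∀ {t r c} (Inv : ℕ → Store → Set) → (∀ {k s} → Inv k s → ρ s r ≡ k) →
  (∀ {k s} → Inv (suc k) s → Within t c s (Inv k)) →
  ∀ {k s} → Inv k s → Within (k * (2 + t) + 1) (while r c) s (Inv 0)
for-within Inv counter body {zero}  inv = within (exit (counter inv)) ≤-refl inv
for-within {t} Inv counter body {suc k} inv with body inv
... | within e le inv′ with for-within Inv counter body inv′
...   | within f le′ post = within (loop (λ r≡0 → 1+n≢0 (trans (sym (counter inv)) r≡0)) e f)
        (≤-trans (+-mono-≤ (s≤s (s≤s le)) le′) (≤-reflexive (sym (+-assoc (2 + t) (k * (2 + t)) 1)))) post

decider : Cmd → Reg → Program
decider c r = compile 0 c ++ jzero r (2 + codeSize c) ∷ halt true ∷ halt false ∷ []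

run-decider : ∀ {c s s′ t} r u → Exec c s s′ t → 3 + t ≤ u →
  run (decider c r) u (config-of 0 s) ≡ just (not (ρ s′ r ≡ᵇ 0))
run-decider {c} {s} {s′} {t} r u e 3+t≤u = begin
  run P u (config-of 0 s)                       ≡⟨ cong (λ u → run P u (config-of 0 s)) total ⟨
  run P (t + (3 + v)) (config-of 0 s)           ≡⟨ run-compile 0 (3 + v) e (CodeAt-++ˡ (compile 0 c) ([] , sym (++-identityʳ P))) ⟩
  run P (3 + v) (config-of (codeSize c) s′)         ≡⟨ verdict ⟩
  just (not (ρ s′ r ≡ᵇ 0))                      ∎
  where
  open ≡-Reasoning
  P : Program
  P = decider c r
  v : ℕ
  v = u ∸ (3 + t)
  total : t + (3 + v) ≡ u
  total = trans (trans (sym (+-assoc t 3 v)) (cong (_+ v) (+-comm t 3))) (m+[n∸m]≡n 3+t≤u)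
  at-end : CodeAt P (codeSize c) (jzero r (2 + codeSize c) ∷ halt true ∷ halt false ∷ [])
  at-end = subst (λ l → CodeAt P l (jzero r (2 + codeSize c) ∷ halt true ∷ halt false ∷ [])) (length-compile 0 c)
    (CodeAt-++ʳ {P} {0} (compile 0 c) ([] , sym (++-identityʳ P)))
  verdict : run P (3 + v) (config-of (codeSize c) s′) ≡ just (not (ρ s′ r ≡ᵇ 0))
  verdict with ρ s′ r ≟ 0
  ... | yes r≡0 = trans (run-jzero-taken s′ (2 + v) at-end r≡0)
        (trans (run-fetch s′ (1 + v) (CodeAt-tail (CodeAt-tail at-end))) (cong (λ w → just (not (w ≡ᵇ 0))) (sym r≡0)))
  ... | no  r≢0 = trans (run-jzero-fallthrough s′ (2 + v) at-end r≢0)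
        (trans (run-fetch s′ (1 + v) (CodeAt-tail at-end)) (cong (λ b → just (not b)) (sym (≡ᵇ0-false r≢0))))

-- The program

-- Scratch registers come first, so that "no register from number b on has changed" is the frame
-- condition of every subroutine.
pattern rT     = 0
pattern rU     = 1
pattern rV     = 2
pattern rPX    = 3
pattern rPY    = 4
pattern rL     = 5
pattern rX     = 6
pattern rY     = 7
pattern rH     = 8
pattern rD     = 9
pattern rA     = 10
pattern rK     = 11
pattern rO     = 12
pattern rzero  = 13
pattern rone   = 14
pattern rtwo   = 15
pattern rthree = 16
pattern rm     = 17
pattern r3m    = 18
pattern rB     = 19
pattern rC     = 20
pattern rW     = 21
pattern rG     = 22

initialise : List Op
initialise =
  rone ≔# 1 ∷ rtwo ≔# 2 ∷ rthree ≔# 3 ∷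
  rU ≔[ rzero ] ∷ rm ≔[ rtwo ] ∷ r3m ≔ rm ⊕ rm ∷ r3m ≔ r3m ⊕ rm ∷
  rW ≔ r3m ⊕ r3m ∷ rW ≔ rW ⊕ rthree ∷
  rB ≔ rW ⊕ rU ∷ rB ≔ rB ⊕ rU ∷ rC ≔ rB ⊕ rU ∷ rG ≔ rC ⊕ rW ∷
  -- The header of the input lies in the three cells of `nil`. Once `|Q|` and `|E|` are in
  -- registers, it gives way to a node labelled ε whose two successors are itself.
  [ rzero ]≔ rzero ∷ [ rone ]≔ rzero ∷ [ rtwo ]≔ rzero ∷ []

first-edge next-edge : List Op
first-edge = rA ≔ rzero ⊕ rthree ∷ rD ≔ rzero ⊕ rm ∷ []
next-edge  = rA ≔ rA ⊕ rthree ∷ rD ≔ rD ⊖ rone ∷ []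

for-edges : Cmd → Cmd
for-edges c = ops first-edge ⨾ while rD (c ⨾ ops next-edge)

-- The link to the previous head takes the place of the source, which membership in the list now
-- records. Each list therefore runs from later transitions to earlier ones.
link-heads : Cmd
link-heads = ops (rU ≔[ rA ] ∷ rU ≔ rB ⊕ rU ∷ rV ≔[ rU ] ∷ [ rA ]≔ rV ∷ [ rU ]≔ rA ∷ [])

-- A pass of its own, because a target can be replaced by the head of its list only after all lists
-- are complete.
link-targets : Cmd
link-targets = ops
  ( rU ≔ rA ⊕ rtwo ∷ rV ≔[ rU ] ∷ rV ≔ rB ⊕ rV ∷ rV ≔[ rV ] ∷ [ rU ]≔ rV ∷
    rPX ≔ rA ⊕ rone ∷ rPX ≔[ rPX ] ∷
    rU ≔ rA ⊕ r3m ∷ [ rU ]≔ rzero ∷ rU ≔ rU ⊕ rone ∷ [ rU ]≔ rPX ∷ rU ≔ rU ⊕ rone ∷ [ rU ]≔ rV ∷ [])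

-- The table turns the product in `mark` into a look-up. After the last row `rU` has reached `Q`,
-- the first address of the queue.
tabulate-rows : Cmd
tabulate-rows =
  ops (rD ≔ rzero ⊕ rW ∷ rA ≔ rzero ⊕ rC ∷ rU ≔ rzero ⊕ rG ∷ []) ⨾
  while rD (ops ([ rA ]≔ rU ∷ rA ≔ rA ⊕ rone ∷ rU ≔ rU ⊕ rW ∷ rD ≔ rD ⊖ rone ∷ [])) ⨾
  ops (rT ≔ rzero ⊕ rU ∷ [])

-- A pair is new if its mark is below the key `rK` of the current search, so marks of the first
-- search count as absent in the second.
push : Cmd
push =
  ops (rU ≔ rC ⊕ rPX ∷ rU ≔[ rU ] ∷ rU ≔ rU ⊕ rPY ∷ rV ≔[ rU ] ∷ rV ≔ rK ⊖ rV ∷ []) ⨾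
  when rV (ops ([ rU ]≔ rK ∷ [ rT ]≔ rPX ∷ rT ≔ rT ⊕ rone ∷ [ rT ]≔ rPY ∷ rT ≔ rT ⊕ rone ∷ []))

-- `rO` selects the field of `cur j` at which the right component starts: 2 for its target, 0 for
-- its successor in the list.
seed : Cmd
seed = ops (rPX ≔ rA ⊕ r3m ∷ rPY ≔ rA ⊕ rO ∷ rPY ≔[ rPY ] ∷ []) ⨾ push

search : Cmd → Cmd
search body =
  ops (rD ≔ rT ⊖ rH ∷ []) ⨾
  while rD (ops (rX ≔[ rH ] ∷ rH ≔ rH ⊕ rone ∷ rY ≔[ rH ] ∷ rH ≔ rH ⊕ rone ∷ []) ⨾
            body ⨾ ops (rD ≔ rT ⊖ rH ∷ []))

explore₁ : Cmd
explore₁ =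
  (ops (rPX ≔ rzero ⊕ rX ∷ rPY ≔[ rY ] ∷ []) ⨾ push) ⨾
  (ops (rPX ≔ rzero ⊕ rX ∷ rPY ≔ rY ⊕ rtwo ∷ rPY ≔[ rPY ] ∷ []) ⨾ push)

explore₂ : Cmd
explore₂ =
  (ops (rPX ≔[ rX ] ∷ rPY ≔ rzero ⊕ rY ∷ []) ⨾ push) ⨾
  (ops (rPX ≔ rzero ⊕ rX ∷ rPY ≔[ rY ] ∷ []) ⨾ push) ⨾
  (ops (rL ≔ rX ⊕ rone ∷ rL ≔[ rL ] ∷ rL ≔ rone ⊖ rL ∷ []) ⨾
   when rL (ops (rPX ≔ rX ⊕ rtwo ∷ rPX ≔[ rPX ] ∷ rPY ≔ rzero ⊕ rY ∷ []) ⨾ push)) ⨾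
  (ops (rL ≔ rY ⊕ rone ∷ rL ≔[ rL ] ∷ rL ≔ rone ⊖ rL ∷ []) ⨾
   when rL (ops (rPX ≔ rzero ⊕ rX ∷ rPY ≔ rY ⊕ rtwo ∷ rPY ≔[ rPY ] ∷ []) ⨾ push)) ⨾
  (ops (rPX ≔ rX ⊕ rone ∷ rPX ≔[ rPX ] ∷ rPY ≔ rY ⊕ rone ∷ rPY ≔[ rPY ] ∷
        -- At least one truncated difference vanishes, so their sum is the distance of the labels,
        -- and `rL` ends nonzero exactly if they are equal.
        rL ≔ rPX ⊖ rPY ∷ rPX ≔ rPY ⊖ rPX ∷ rL ≔ rL ⊕ rPX ∷ rL ≔ rone ⊖ rL ∷ []) ⨾
   when rL (ops (rPX ≔ rX ⊕ rtwo ∷ rPX ≔[ rPX ] ∷ rPY ≔ rY ⊕ rtwo ∷ rPY ≔[ rPY ] ∷ []) ⨾ push))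

-- The link to the next list entry stays intact: a dead transition can still be skipped, only taking
-- it leads to `nil`.
kill-unmarked : Cmd
kill-unmarked =
  ops (rU ≔ rA ⊕ r3m ∷ rV ≔ rU ⊕ rtwo ∷
       rU ≔ rC ⊕ rU ∷ rU ≔[ rU ] ∷ rU ≔ rU ⊕ rA ∷ rU ≔[ rU ] ∷ rU ≔ rone ⊖ rU ∷ []) ⨾
  when rU (ops ([ rV ]≔ rzero ∷ rV ≔ rA ⊕ rtwo ∷ [ rV ]≔ rzero ∷ []))

-- Only the mark 2 of the second search survives the subtraction of 1.
collect-diagonal : Cmd
collect-diagonal =
  ops (rU ≔ rC ⊕ rA ∷ rU ≔[ rU ] ∷ rU ≔ rU ⊕ rA ∷ rU ≔[ rU ] ∷ rU ≔ rU ⊖ rone ∷ rL ≔ rL ⊕ rU ∷ [])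

phase₁ phase₂ main : Cmd
phase₁ =
  ops (rK ≔# 1 ∷ rO ≔# 2 ∷ rH ≔ rzero ⊕ rT ∷ []) ⨾ for-edges seed ⨾ search explore₁
phase₂ =
  ops (rK ≔# 2 ∷ rO ≔# 0 ∷ rH ≔ rzero ⊕ rT ∷ []) ⨾ for-edges seed ⨾ search explore₂
main =
  ops initialise ⨾ for-edges link-heads ⨾ for-edges link-targets ⨾ tabulate-rows ⨾
  phase₁ ⨾ for-edges kill-unmarked ⨾ phase₂ ⨾
  ops (rL ≔# 0 ∷ []) ⨾ for-edges collect-diagonal

-- The time bound

quadratic≤ : ∀ a b c m → a + b * m + c * (m * m) ≤ (a + b + c) * (1 + m ^ 2)
quadratic≤ a b c m = begin
  a + b * m + c * (m * m)                        ≤⟨ +-monoˡ-≤ (c * (m * m)) (+-monoʳ-≤ a (*-monoʳ-≤ b (m≤m*m m))) ⟩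
  a + b * (m * m) + c * (m * m)                  ≤⟨ m≤m+n _ (a * (m * m) + b + c) ⟩
  a + b * (m * m) + c * (m * m) + (a * (m * m) + b + c) ≡⟨ collect a b c m ⟩
  (a + b + c) * (1 + m ^ 2)                      ∎
  where
  open ≤-Reasoning
  m≤m*m : ∀ k → k ≤ k * k
  m≤m*m zero    = z≤n
  m≤m*m (suc k) = m≤m*n (suc k) (suc k)
  collect : ∀ a b c m → a + b * (m * m) + c * (m * m) + (a * (m * m) + b + c) ≡ (a + b + c) * (1 + m * (m * 1))
  collect = solve-∀

searchTime : ℕ → ℕ → ℕ
searchTime m t = 3 + (2 + (m * (2 + (14 + 2)) + 1) + (1 + ((1 + (m + m)) * (1 + (m + m)) * (2 + (4 + (t + 1))) + 1)))

-- The sums are left as the bounds of the individual loops produce them.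
mainTime : ℕ → ℕ
mainTime m = 16 + (2 + (m * (2 + (5 + 2)) + 1) + (2 + (m * (2 + (13 + 2)) + 1) + (3 + ((1 + (m + m)) * 3 * (2 + 4) + 1 + 1) +
  (searchTime m 27 + (2 + (m * (2 + (11 + 2)) + 1) + (searchTime m 86 + (1 + (2 + (m * (2 + (6 + 2)) + 1)))))))))

-- Abstract, because a literal factor would be unfolded in unary.
abstract
  timeFactor : ℕ
  timeFactor = 198 + 631 + 508

  mainTime≤ : ∀ m → 3 + mainTime m ≤ timeFactor * (1 + m ^ 2)
  mainTime≤ m = ≤-trans (≤-reflexive (expand m)) (quadratic≤ 198 631 508 m)
    where
    -- The coefficients come from multiplying out. The quadratic one is 4 * (34 + 93): each search
    -- treats up to `(1 + (m + m)) * (1 + (m + m))` pairs, at 34 or 93 instructions per pair.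
    expand : ∀ m → 3 + (16 + (2 + (m * 9 + 1) + (2 + (m * 17 + 1) + (3 + ((1 + (m + m)) * 3 * 6 + 1 + 1) +
      ((3 + (2 + (m * 18 + 1) + (1 + ((1 + (m + m)) * (1 + (m + m)) * 34 + 1)))) + (2 + (m * 15 + 1) +
      ((3 + (2 + (m * 18 + 1) + (1 + ((1 + (m + m)) * (1 + (m + m)) * 93 + 1)))) + (1 + (2 + (m * 10 + 1)))))))))) ≡
      198 + 631 * m + 508 * (m * m)
    expand = solve-∀

-- The input in memory

contents : List ℕ → ℕ → ℕ
contents xs a = fromMaybe 0 (head (drop a xs))

contents-beyond : ∀ xs {a} → length xs ≤ a → contents xs a ≡ 0
contents-beyond []       {zero}  _        = refl
contents-beyond []       {suc a} _        = refl
contents-beyond (x ∷ xs)         (s≤s le) = contents-beyond xs le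

contents-edge : ∀ {k n} (E : List (Transition k n)) rest (j : Fin (length E)) {f} → f < 3 →
  contents (concatMap encodeTransition E ++ rest) (f + toℕ j * 3) ≡ contents (encodeTransition (lookup E j)) f
contents-edge (e ∷ E) rest Fin.zero {0} f<3 = refl
contents-edge (e ∷ E) rest Fin.zero {1} f<3 = refl
contents-edge (e ∷ E) rest Fin.zero {2} f<3 = refl
contents-edge (e ∷ E) rest Fin.zero {suc (suc (suc f))} (s≤s (s≤s (s≤s ())))
contents-edge (e ∷ E) rest (Fin.suc j) {f} f<3 =
  trans (cong (contents (concatMap encodeTransition (e ∷ E) ++ rest)) (shift f (toℕ j))) (contents-edge E rest j f<3)
  where
  shift : ∀ f j → f + (3 + j * 3) ≡ 3 + (f + j * 3)
  shift = solve-∀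

length-encodeEdges : ∀ {k n} (E : List (Transition k n)) → length (concatMap encodeTransition E) ≡ length E * 3
length-encodeEdges []      = refl
length-encodeEdges (e ∷ E) = cong (3 +_) (length-encodeEdges E)

length-encodeSubset : ∀ {k} (S : Subset k) → length (encodeSubset S) ≡ k
length-encodeSubset S = trans (length-map _ (toList S)) (length-toList S)

module _ (A : Automaton) where

  -- Nodes and their place in memory

  m n : ℕ
  m = ∣ A ∣ᴱ
  n = stateCount A

  edge : Fin m → Edge A
  edge = lookup (transitions A)

  -- cur j is a position in the adjacency list of the source of transition j: the run may take j or skip
  -- to the next list entry. com j is a run committed to taking j. nil is the end of a list, or a dead run.
  data Node : Set where
    nil     : Node
    cur com : Fin m → Node

  rank : Node → ℕ
  rank nil     = 0
  rank (cur j) = 1 + toℕ j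
  rank (com j) = 1 + (m + toℕ j)

  -- The three cells from address ⟦ x ⟧ on hold next x, lab x and tgt x; for cur j these are the cells of the
  -- input that encode transition j.
  ⟦_⟧ : Node → ℕ
  ⟦ x ⟧ = rank x * 3

  -- The last of the first k transitions that leave p.
  hd : ℕ → State A → Node
  hd zero    p = nil
  hd (suc k) p with k <? m
  ... | no  _   = hd k p
  ... | yes k<m = if does (source (edge (fromℕ< k<m)) Fin.≟ p) then cur (fromℕ< k<m) else hd k p

  letter : Maybe (Letter A) → ℕ
  letter = maybe′ (λ l → suc (toℕ l)) 0

  next : Node → Node
  next nil     = nil
  next (cur j) = hd (toℕ j) (source (edge j))
  next (com j) = nil

  lab : Node → ℕ
  lab nil     = 0
  lab (cur j) = letter (label (edge j))
  lab (com j) = letter (label (edge j))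

  tgt : Node → Node
  tgt nil     = nil
  tgt (cur j) = hd m (target (edge j))
  tgt (com j) = hd m (target (edge j))

  -- Memory layout: nodes below W (the com nodes overwrite I and F), list heads from B on, row addresses of
  -- the W × W matrix of marks from C on, that matrix from G on, and the queue from Q on.
  W B C G Q : ℕ
  W = (1 + (m + m)) * 3
  B = W + n + n
  C = B + n
  G = C + W
  Q = G + W * W

  -- Rows and columns are indexed by addresses instead of ranks: a factor 9 in space saves every
  -- conversion.
  mark : Node → Node → ℕ
  mark x y = G + ⟦ x ⟧ * W + ⟦ y ⟧

  rank< : ∀ x → rank x < 1 + (m + m)
  rank< nil     = s≤s z≤n
  rank< (cur j) = s≤s (≤-trans (toℕ<n j) (m≤m+n m m))
  rank< (com j) = s≤s (+-monoʳ-< m (toℕ<n j))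

  rank-injective : ∀ x y → rank x ≡ rank y → x ≡ y
  rank-injective nil     nil     eq = refl
  rank-injective (cur i) (cur j) eq = cong cur (toℕ-injective (suc-injective eq))
  rank-injective (cur i) (com j) eq = ⊥-elim (<⇒≱ (toℕ<n i) (≤-trans (m≤m+n m _) (≤-reflexive (sym (suc-injective eq)))))
  rank-injective (com i) (cur j) eq = ⊥-elim (<⇒≱ (toℕ<n j) (≤-trans (m≤m+n m _) (≤-reflexive (suc-injective eq))))
  rank-injective (com i) (com j) eq = cong com (toℕ-injective (+-cancelˡ-≡ m _ _ (suc-injective eq)))

  -- Uniqueness of digits. Base 3 separates the cells of nodes, base `W` the entries of the matrix.
  digit-injective : ∀ b .{{_ : NonZero b}} {f g} i j → f < b → g < b → f + i * b ≡ g + j * b → f ≡ g × i ≡ j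
  digit-injective b {f} {g} i j f<b g<b eq = f≡g , *-cancelʳ-≡ i j b (+-cancelˡ-≡ g _ _ (trans (cong (_+ i * b) (sym f≡g)) eq))
    where
    f≡g : f ≡ g
    f≡g = begin
      f                  ≡⟨ m<n⇒m%n≡m f<b ⟨
      f % b              ≡⟨ [m+kn]%n≡m%n f i b ⟨
      (f + i * b) % b    ≡⟨ cong (_% b) eq ⟩
      (g + j * b) % b    ≡⟨ [m+kn]%n≡m%n g j b ⟩
      g % b              ≡⟨ m<n⇒m%n≡m g<b ⟩
      g                  ∎
      where open ≡-Reasoning

  cell-injective : ∀ {f g x y} → f < 3 → g < 3 → f + ⟦ x ⟧ ≡ g + ⟦ y ⟧ → f ≡ g × x ≡ y
  cell-injective {x = x} {y} f<3 g<3 eq with digit-injective 3 (rank x) (rank y) f<3 g<3 eq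
  ... | f≡g , r = f≡g , rank-injective x y r

  cell< : ∀ {f} x → f < 3 → f + ⟦ x ⟧ < W
  cell< {f} x f<3 = ≤-trans (+-monoˡ-≤ ⟦ x ⟧ f<3) (*-monoˡ-≤ 3 (rank< x))

  ⟦⟧<W : ∀ x → ⟦ x ⟧ < W
  ⟦⟧<W x = cell< x (s≤s z≤n)

  W≤B : W ≤ B
  W≤B = ≤-trans (m≤m+n W n) (m≤m+n (W + n) n)

  B≤C : B ≤ C
  B≤C = m≤m+n B n

  C≤G : C ≤ G
  C≤G = m≤m+n C W

  G≤Q : G ≤ Q
  G≤Q = m≤m+n G (W * W)

  W≤C : W ≤ C
  W≤C = ≤-trans W≤B B≤C

  W≤G : W ≤ G
  W≤G = ≤-trans W≤C C≤G

  mark≥G : ∀ x y → G ≤ mark x y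
  mark≥G x y = ≤-trans (m≤m+n G _) (m≤m+n _ ⟦ y ⟧)

  mark<Q : ∀ x y → mark x y < Q
  mark<Q x y = begin-strict
    G + ⟦ x ⟧ * W + ⟦ y ⟧   ≡⟨ +-assoc G _ _ ⟩
    G + (⟦ x ⟧ * W + ⟦ y ⟧) <⟨ +-monoʳ-< G (+-monoʳ-< (⟦ x ⟧ * W) (⟦⟧<W y)) ⟩
    G + (⟦ x ⟧ * W + W)     ≡⟨ cong (G +_) (+-comm (⟦ x ⟧ * W) W) ⟩
    G + suc ⟦ x ⟧ * W       ≤⟨ +-monoʳ-≤ G (*-monoˡ-≤ W (⟦⟧<W x)) ⟩
    Q                       ∎
    where open ≤-Reasoning

  ⟦⟧-injective : ∀ {x y} → ⟦ x ⟧ ≡ ⟦ y ⟧ → x ≡ y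
  ⟦⟧-injective eq = proj₂ (cell-injective (s≤s z≤n) (s≤s z≤n) eq)

  mark-injective : ∀ {x y x′ y′} → mark x y ≡ mark x′ y′ → x ≡ x′ × y ≡ y′
  mark-injective {x} {y} {x′} {y′} eq with digit-injective W ⟦ x ⟧ ⟦ x′ ⟧ (⟦⟧<W y) (⟦⟧<W y′) eq′
    where
    eq′ : ⟦ y ⟧ + ⟦ x ⟧ * W ≡ ⟦ y′ ⟧ + ⟦ x′ ⟧ * W
    eq′ = begin
      ⟦ y ⟧ + ⟦ x ⟧ * W   ≡⟨ +-comm ⟦ y ⟧ _ ⟩
      ⟦ x ⟧ * W + ⟦ y ⟧   ≡⟨ +-cancelˡ-≡ G _ _ (trans (sym (+-assoc G _ _)) (trans eq (+-assoc G _ _))) ⟩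
      ⟦ x′ ⟧ * W + ⟦ y′ ⟧ ≡⟨ +-comm _ ⟦ y′ ⟧ ⟩
      ⟦ y′ ⟧ + ⟦ x′ ⟧ * W ∎
      where open ≡-Reasoning
  ... | q , p = ⟦⟧-injective p , ⟦⟧-injective q

  com-offset : ∀ j → ⟦ com j ⟧ ≡ ⟦ cur j ⟧ + m * 3
  com-offset j = lemma m (toℕ j)
    where
    lemma : ∀ a b → (1 + (a + b)) * 3 ≡ (1 + b) * 3 + a * 3
    lemma = solve-∀

  updated : ∀ (f : ℕ → ℕ) k v → (f [ k ↦ v ]) k ≡ v
  updated f zero    v = refl
  updated f (suc k) v = updated (λ j → f (suc j)) k v

  untouched : ∀ (f : ℕ → ℕ) {k j} v → j ≢ k → (f [ k ↦ v ]) j ≡ f j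
  untouched f {k} {j} v j≢k with j ≡ᵇ k in eq
  ... | false = refl
  ... | true  = ⊥-elim (j≢k (≡ᵇ⇒≡ j k (subst T (sym eq) _)))

  -- Searching the graph of pairs of nodes

  constants : ℕ → ℕ
  constants 0 = 0
  constants 1 = 1
  constants 2 = 2
  constants 3 = 3
  constants 4 = m
  constants 5 = m * 3
  constants 6 = B
  constants 7 = C
  constants 8 = W
  constants 9 = G
  constants _ = 0

  Pair : Set
  Pair = Node × Node

  Queue : ℕ → List Pair → (ℕ → ℕ) → Set
  Queue q []            M = ⊤
  Queue q ((x , y) ∷ V) M = M q ≡ ⟦ x ⟧ × M (1 + q) ≡ ⟦ y ⟧ × Queue (2 + q) V M

  record Tables (tg : Node → Node) (M : ℕ → ℕ) : Set where
    field
      nexts  : ∀ x → M ⟦ x ⟧ ≡ ⟦ next x ⟧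
      labels : ∀ x → M (1 + ⟦ x ⟧) ≡ lab x
      tgts   : ∀ x → M (2 + ⟦ x ⟧) ≡ ⟦ tg x ⟧

  Rows : (ℕ → ℕ) → Set
  Rows M = ∀ x → M (C + ⟦ x ⟧) ≡ G + ⟦ x ⟧ * W

  -- The queue is never shortened: `V` lists all visited pairs in the order of their arrival, and
  -- the popped ones form a prefix. In `outs` a smaller mark is allowed instead of zero because an
  -- earlier search may have left one.
  record Visited (k q : ℕ) (V : List Pair) (t : ℕ) (M : ℕ → ℕ) : Set where
    field
      ins    : ∀ {x y} → (x , y) ∈ V → M (mark x y) ≡ k
      outs   : ∀ {x y} → (x , y) ∉ V → M (mark x y) < k
      unique : Unique V
      base   : Q ≤ q
      top    : t ≡ q + length V * 2
      queue  : Queue q V M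

  Env : (ℕ → ℕ) → Set
  Env κ = ∀ r → κ r ≡ constants r

  -- κ stands for the registers from rK on.
  record Searching (tg : Node → Node) (k q : ℕ) (V : List Pair) (t : ℕ) (κ M : ℕ → ℕ) : Set where
    field
      env     : Env (λ r → κ (2 + r))
      key     : κ 0 ≡ k
      rows    : Rows M
      tables  : Tables tg M
      visited : Visited k q V t M
    open Tables tables public
    open Visited visited public

  -- The invariant sees a store only through `rT`, the registers from `rK` on and the memory, so
  -- that operations on the other scratch registers preserve it definitionally.
  State-of : (tg : Node → Node) (k q : ℕ) (V : List Pair) → Store → Set
  State-of tg k q V s = Searching tg k q V (ρ s rT) (λ r → ρ s (11 + r)) (μ s)

  queue-cong : ∀ q V {M M′} → (∀ a → q ≤ a → a < q + length V * 2 → M′ a ≡ M a) → Queue q V M → Queue q V M′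
  queue-cong q []      eq _             = tt
  queue-cong q (v ∷ V) {M} {M′} eq (p , r , rest) =
    trans (eq q ≤-refl (≤-trans (m<m+n q {2} (s≤s z≤n)) 2≤)) p ,
    trans (eq (1 + q) (n≤1+n q) (≤-trans (≤-reflexive (+-comm 2 q)) 2≤)) r ,
    queue-cong (2 + q) V (λ a le lt → eq a (≤-trans (≤-trans (n≤1+n q) (n≤1+n (1 + q))) le) (≤-trans lt (≤-reflexive shift))) rest
    where
    2≤ : q + 2 ≤ q + length (v ∷ V) * 2
    2≤ = +-monoʳ-≤ q (s≤s (s≤s z≤n))
    shift : 2 + q + length V * 2 ≡ q + length (v ∷ V) * 2
    shift = lemma q (length V)
      where
      lemma : ∀ q l → 2 + q + l * 2 ≡ q + (2 + l * 2)
      lemma = solve-∀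

  queue-snoc : ∀ q V {M x y} → Queue q V M → M (q + length V * 2) ≡ ⟦ x ⟧ → M (1 + (q + length V * 2)) ≡ ⟦ y ⟧ →
    Queue q (V ++ (x , y) ∷ []) M
  queue-snoc q []      {M} tt px py = trans (cong M (sym (+-identityʳ q))) px , trans (cong (M ∘ suc) (sym (+-identityʳ q))) py , tt
  queue-snoc q (v ∷ V) {M} (p , r , rest) px py = p , r ,
    queue-snoc (2 + q) V rest (trans (cong M (shift q (length V))) px) (trans (cong (M ∘ suc) (shift q (length V))) py)
    where
    shift : ∀ q l → 2 + q + l * 2 ≡ q + (2 + l * 2)
    shift = solve-∀

  queue-at : ∀ q V {x y V′ M} → Queue q (V ++ (x , y) ∷ V′) M →
    M (q + length V * 2) ≡ ⟦ x ⟧ × M (1 + (q + length V * 2)) ≡ ⟦ y ⟧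
  queue-at q []      {M = M} (p , r , _) =
    trans (cong M (+-identityʳ q)) p , trans (cong (M ∘ suc) (+-identityʳ q)) r
  queue-at q (v ∷ V) {M = M} (_ , _ , rest) with queue-at (2 + q) V rest
  ... | p , r = trans (cong M (shift q (length V))) p , trans (cong (M ∘ suc) (shift q (length V))) r
    where
    shift : ∀ q l → q + (2 + l * 2) ≡ 2 + q + l * 2
    shift = solve-∀

  length-snoc : ∀ (V : List Pair) v → length (V ++ v ∷ []) ≡ suc (length V)
  length-snoc V v = trans (length-++ V) (+-comm (length V) 1)

  -- The effect of pushing the pairs `S` on the visited list. As a relation it composes along `++`,
  -- which lets successors be treated one by one.
  record Grown (S V V′ : List Pair) : Set where
    field
      added  : List Pair
      grown  : V′ ≡ V ++ added
      covers : All (_∈ V′) S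
      sound  : ∀ {v} → v ∈ V′ → v ∈ V ⊎ v ∈ S

    keeps : ∀ {v} → v ∈ V → v ∈ V′
    keeps v∈V rewrite grown = ∈-++⁺ˡ v∈V
  open Grown

  Grown-nil : ∀ {V} → Grown [] V V
  Grown-nil {V} = record { added = [] ; grown = sym (++-identityʳ V) ; covers = [] ; sound = inj₁ }

  Grown-++ : ∀ {S S′ V V′ V″} → Grown S V V′ → Grown S′ V′ V″ → Grown (S ++ S′) V V″
  Grown-++ {S} {S′} {V} g h = record
    { added  = added g ++ added h
    ; grown  = trans (grown h) (trans (cong (_++ added h) (grown g)) (++-assoc V (added g) (added h)))
    ; covers = Allₚ.++⁺ (All.map (keeps h) (covers g)) (covers h)
    ; sound  = λ v∈ → [ (λ v∈V′ → [ inj₁ , inj₂ ∘ ∈-++⁺ˡ ]′ (sound g v∈V′)) , inj₂ ∘ ∈-++⁺ʳ S ]′ (sound h v∈)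
    }

  Grown-old : ∀ {v V} → v ∈ V → Grown (v ∷ []) V V
  Grown-old {V = V} v∈V = record { added = [] ; grown = sym (++-identityʳ V) ; covers = v∈V ∷ [] ; sound = inj₁ }

  Grown-new : ∀ {v V} → Grown (v ∷ []) V (V ++ v ∷ [])
  Grown-new {v} {V} = record { added = v ∷ [] ; grown = refl ; covers = ∈-++⁺ʳ V (here refl) ∷ [] ; sound = ∈-++⁻ V }

  Pushed : (b : ℕ) (tg : Node → Node) (k q : ℕ) (S V : List Pair) (s s′ : Store) → Set
  Pushed b tg k q S V s s′ = (∀ r → ρ s′ (b + r) ≡ ρ s (b + r)) ×
    ∃ λ V′ → Grown S V V′ × State-of tg k q V′ s′

  _≟ⁿ_ : (x y : Node) → Dec (x ≡ y)
  x ≟ⁿ y with rank x ≟ rank y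
  ... | yes eq = yes (rank-injective x y eq)
  ... | no neq = no (neq ∘ cong rank)

  _∈ᵖ?_ : (u : Pair) (V : List Pair) → Dec (u ∈ V)
  _∈ᵖ?_ = DecMembership._∈?_ (Productₚ.≡-dec _≟ⁿ_ _≟ⁿ_)

  mark-changed : ∀ {x y x′ y′} → (x , y) ≢ (x′ , y′) → mark x y ≢ mark x′ y′
  mark-changed {x} {y} {x′} {y′} neq eq with mark-injective {x} {y} {x′} {y′} eq
  ... | refl , refl = neq refl

  module _ {tg : Node → Node} {k q : ℕ} where

    private
      -- The intermediate memories come with equations, so that addresses computed in registers are
      -- identified once, at the call, and the proof works with their closed forms.
      new-visited : ∀ {V t M x y} → Visited k q V t M → (x , y) ∉ V →
        ∀ {M₁ M₂ M₃} → M₁ ≡ M [ mark x y ↦ k ] → M₂ ≡ M₁ [ t ↦ ⟦ x ⟧ ] → M₃ ≡ M₂ [ t + 1 ↦ ⟦ y ⟧ ] →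
        Visited k q (V ++ (x , y) ∷ []) (t + 1 + 1) M₃
      new-visited {V} {t} {M} {x} {y} v v∉V refl refl refl = record
        { ins    = ins′
        ; outs   = λ {x′} {y′} w∉ → subst (_< k) (sym (other {x′} {y′} (λ { refl → w∉ (∈-++⁺ʳ V (here refl)) }))) (outs (w∉ ∘ ∈-++⁺ˡ))
        ; unique = Uniqueₚ.++⁺ unique ([] ∷ []) (λ { (w∈V , here refl) → v∉V w∈V })
        ; base   = base
        ; top    = trans (cong (λ z → z + 1 + 1) top) (trans (shift q (length V)) (cong (λ l → q + l * 2) (sym (length-snoc V (x , y)))))
        ; queue  = queue-snoc q V (queue-cong q V below queue)
            (trans (cong M₃ (sym top)) (trans (untouched M₂ _ (λ eq → m+1+n≢m t (sym eq))) (updated M₁ t _)))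
            (trans (cong M₃ (trans (cong suc (sym top)) (+-comm 1 t))) (updated M₂ (t + 1) _))
        }
        where
        open Visited v
        M₁ = M [ mark x y ↦ k ]
        M₂ = M₁ [ t ↦ ⟦ x ⟧ ]
        M₃ = M₂ [ t + 1 ↦ ⟦ y ⟧ ]
        shift : ∀ q l → q + l * 2 + 1 + 1 ≡ q + (1 + l) * 2
        shift = solve-∀
        q≤t : q ≤ t
        q≤t = ≤-trans (m≤m+n q _) (≤-reflexive (sym top))
        Q≤t : Q ≤ t
        Q≤t = ≤-trans base q≤t
        lower : ∀ {a} → a < t → M₃ a ≡ M₁ a
        lower {a} a<t = trans (untouched M₂ _ (<⇒≢ (≤-trans a<t (m≤m+n t 1)))) (untouched M₁ _ (<⇒≢ a<t))
        other : ∀ {x′ y′} → (x′ , y′) ≢ (x , y) → M₃ (mark x′ y′) ≡ M (mark x′ y′)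
        other {x′} {y′} neq = trans (lower (≤-trans (mark<Q x′ y′) Q≤t)) (untouched M k (mark-changed neq))
        here-marked : M₃ (mark x y) ≡ k
        here-marked = trans (lower (≤-trans (mark<Q x y) Q≤t)) (updated M (mark x y) k)
        ins′ : ∀ {x′ y′} → (x′ , y′) ∈ V ++ (x , y) ∷ [] → M₃ (mark x′ y′) ≡ k
        ins′ {x′} {y′} w∈ with ∈-++⁻ V w∈
        ... | inj₂ (here refl) = here-marked
        ... | inj₁ w∈V = trans (other {x′} {y′} (λ { refl → v∉V w∈V })) (ins w∈V)
        below : ∀ a → q ≤ a → a < q + length V * 2 → M₃ a ≡ M a
        below a q≤a a<t = trans (lower (≤-trans a<t (≤-reflexive (sym top))))
          (untouched M k (λ eq → <⇒≱ (mark<Q x y) (≤-trans base (≤-trans q≤a (≤-reflexive eq)))))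

      frame-rows : ∀ {M M′} → (∀ a → a < G → M′ a ≡ M a) → Rows M → Rows M′
      frame-rows eq rows x = trans (eq _ (+-monoʳ-< C (⟦⟧<W x))) (rows x)

      frame-tables : ∀ {M M′} → (∀ a → a < W → M′ a ≡ M a) → Tables tg M → Tables tg M′
      frame-tables eq tables = record
        { nexts  = λ x → trans (eq _ (⟦⟧<W x)) (nexts x)
        ; labels = λ x → trans (eq _ (cell< x (s≤s (s≤s z≤n)))) (labels x)
        ; tgts   = λ x → trans (eq _ (cell< x (s≤s (s≤s (s≤s z≤n))))) (tgts x)
        }
        where open Tables tables

    push-within : ∀ {V s x y} → State-of tg k q V s → ρ s rPX ≡ ⟦ x ⟧ → ρ s rPY ≡ ⟦ y ⟧ →
      Within 11 push s (Pushed 3 tg k q ((x , y) ∷ []) V s)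
    push-within {V} {s} {x} {y} st ≡x ≡y =
      ops-within {Post = Mid}
        ((address , cong₂ _∸_ key (cong (μ s) address)) , refl , refl , λ r → refl)
      then λ {s₁} mid → when-within (old {s₁} mid) (λ v≢0 → ops-within (new {s₁} mid v≢0))
      where
      open Searching st
      address : μ s (ρ s rC + ρ s rPX) + ρ s rPY ≡ mark x y
      address = cong₂ _+_ (trans (cong (μ s) (cong₂ _+_ (env 7) ≡x)) (rows x)) ≡y

      Mid : Store → Set
      Mid s₁ = (ρ s₁ rU ≡ mark x y × ρ s₁ rV ≡ k ∸ μ s (mark x y)) × (μ s₁ ≡ μ s) × (ρ s₁ rT ≡ ρ s rT) × (∀ r → ρ s₁ (3 + r) ≡ ρ s (3 + r))

      old : ∀ {s₁} → Mid s₁ → ρ s₁ rV ≡ 0 → Pushed 3 tg k q ((x , y) ∷ []) V s s₁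
      old {s₁} ((_ , ≡v) , μ≡ , t≡ , frame) v≡0 = frame , V , Grown-old v∈V , record
        { env = λ r → trans (frame (10 + r)) (env r) ; key = trans (frame 8) key
        ; rows = subst Rows (sym μ≡) rows ; tables = subst (Tables tg) (sym μ≡) tables
        ; visited = subst₂ (Visited k q V) (sym t≡) (sym μ≡) visited }
        where
        v∈V : (x , y) ∈ V
        v∈V with (x , y) ∈ᵖ? V
        ... | yes v∈V = v∈V
        ... | no  v∉V = ⊥-elim (<⇒≱ (outs v∉V) (m∸n≡0⇒m≤n (trans (sym ≡v) v≡0)))

      new : ∀ {s₁} → Mid s₁ → ρ s₁ rV ≢ 0 →
        Pushed 3 tg k q ((x , y) ∷ []) V s (steps ([ rU ]≔ rK ∷ [ rT ]≔ rPX ∷ rT ≔ rT ⊕ rone ∷ [ rT ]≔ rPY ∷ rT ≔ rT ⊕ rone ∷ []) s₁)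
      new {s₁} ((≡u , ≡v) , μ≡ , t≡ , frame) v≢0 = frame , V ++ (x , y) ∷ [] , Grown-new , record
        { env = λ r → trans (frame (10 + r)) (env r) ; key = trans (frame 8) key
        ; rows = frame-rows below rows
        ; tables = frame-tables (λ a a<W → below a (≤-trans a<W W≤G)) tables
        ; visited = subst (λ z → Visited k q (V ++ (x , y) ∷ []) z M₃) (cong₂ _+_ (cong₂ _+_ (sym t≡) (sym one)) (sym one))
            (new-visited visited v∉V {M₁ = M₁} {M₂} {M₃}
              (trans (cong₂ (λ a c → μ s₁ [ a ↦ c ]) ≡u (trans (frame 8) key)) (cong (_[ mark x y ↦ k ]) μ≡))
              (cong₂ (λ a c → M₁ [ a ↦ c ]) t≡ ≡px)
              (cong₂ (λ a c → M₂ [ a ↦ c ]) (cong₂ _+_ t≡ one) ≡py)) }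
        where
        M₁ M₂ M₃ : ℕ → ℕ
        M₁ = μ s₁ [ ρ s₁ rU ↦ ρ s₁ rK ]
        M₂ = M₁ [ ρ s₁ rT ↦ ρ s₁ rPX ]
        M₃ = M₂ [ ρ s₁ rT + ρ s₁ rone ↦ ρ s₁ rPY ]
        one : ρ s₁ rone ≡ 1
        one = trans (frame 11) (env 1)
        ≡px : ρ s₁ rPX ≡ ⟦ x ⟧
        ≡px = trans (frame 0) ≡x
        ≡py : ρ s₁ rPY ≡ ⟦ y ⟧
        ≡py = trans (frame 1) ≡y
        v∉V : (x , y) ∉ V
        v∉V v∈V = v≢0 (trans ≡v (m≤n⇒m∸n≡0 (≤-reflexive (sym (ins v∈V)))))
        G≤t : G ≤ ρ s₁ rT
        G≤t = ≤-trans G≤Q (≤-trans base (≤-trans (m≤m+n q _) (≤-reflexive (sym (trans t≡ top)))))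
        below : ∀ a → a < G → M₃ a ≡ μ s a
        below a a<G = trans (untouched M₂ _ (<⇒≢ (≤-trans a<G (≤-trans G≤t (m≤m+n _ _)))))
          (trans (untouched M₁ _ (<⇒≢ (≤-trans a<G G≤t)))
          (trans (untouched (μ s₁) _ (<⇒≢ (≤-trans a<G (≤-trans (mark≥G x y) (≤-reflexive (sym ≡u)))))) (cong (λ f → f a) μ≡)))

  -- The machine counts down in `rD` and the invariant counts up, tied together by `i + k ≡ m`.
  -- Transition `i` sits at `(1 + i) * 3` because rank 0 belongs to `nil`.
  for-edges-within : ∀ {t body} (Inv : ℕ → Store → Set) →
    (∀ {i s} → Inv i s → Env (λ r → ρ s (13 + r))) →
    (∀ {i s} → Inv i s → Inv i (steps next-edge s)) →
    (∀ (j : Fin m) {s} → Inv (toℕ j) s → ρ s rA ≡ ⟦ cur j ⟧ →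
       Within t body s (λ s′ → Inv (suc (toℕ j)) s′ × ρ s′ rA ≡ ρ s rA × ρ s′ rD ≡ ρ s rD)) →
    ∀ {s} → Inv 0 (steps first-edge s) →
    Within (2 + (m * (2 + (t + 2)) + 1)) (for-edges body) s (Inv m)
  for-edges-within {t} {body} Inv env advance each {s} inv₀ =
    ops-within {Post = Counted m} (0 , refl , inv₀ , cong₂ _+_ (env inv₀ 0) (env inv₀ 3) , cong₂ _+_ (env inv₀ 0) (env inv₀ 4))
    then λ c → relax ≤-refl done (for-within Counted (λ (_ , _ , _ , _ , d) → d) iterate c)
    where
    Counted : ℕ → Store → Set
    Counted k s = ∃ λ i → i + k ≡ m × Inv i s × ρ s rA ≡ (1 + i) * 3 × ρ s rD ≡ k

    done : ∀ {s} → Counted 0 s → Inv m s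
    done (i , eq , inv , _) = subst (λ i → Inv i _) (trans (sym (+-identityʳ i)) eq) inv

    iterate : ∀ {k s} → Counted (suc k) s → Within (t + 2) (body ⨾ ops next-edge) s (Counted k)
    iterate {k} {s} (i , eq , inv , ≡a , ≡d) =
      each j (subst (λ i → Inv i s) (sym j≡i) inv) (trans ≡a (cong (λ i → (1 + i) * 3) (sym j≡i)))
      then λ { {s′} (inv′ , a , d) → ops-within
        ( suc i , trans (sym (+-suc i k)) eq
        , subst (λ i → Inv (suc i) (steps next-edge s′)) j≡i (advance inv′)
        , trans (cong₂ _+_ (trans a ≡a) (env inv′ 3)) (+-comm ((1 + i) * 3) 3)
        , cong₂ _∸_ (trans d ≡d) (env inv′ 1)) }
      where
      i<m : i < m
      i<m = ≤-trans (≤-trans (s≤s (m≤m+n i k)) (≤-reflexive (sym (+-suc i k)))) (≤-reflexive eq)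
      j : Fin m
      j = fromℕ< i<m
      j≡i : toℕ j ≡ i
      j≡i = toℕ-fromℕ< i<m

  data Reach (seed : Fin m → Pair) (succ : Pair → List Pair) : Pair → Set where
    seeded : ∀ j → Reach seed succ (seed j)
    move  : ∀ {u v} → Reach seed succ u → v ∈ succ u → Reach seed succ v

  guard : Bool → Pair → List Pair
  guard b v = if b then v ∷ [] else []

  -- In `succ₂` either run may skip, take an ε-transition alone, or take a transition jointly with
  -- the other under equal labels. Two ε-transitions may also be taken jointly, which changes
  -- neither word.
  succ₁ succ₂ : (Node → Node) → Pair → List Pair
  succ₁ tg (x , y) = (x , next y) ∷ (x , tg y) ∷ []
  succ₂ tg (x , y) = (next x , y) ∷ (x , next y) ∷
    (guard (lab x ≡ᵇ 0) (tg x , y) ++ guard (lab y ≡ᵇ 0) (x , tg y) ++ guard (lab x ≡ᵇ lab y) (tg x , tg y))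

  nodes : List Node
  nodes = nil ∷ map cur (allFin m) ++ map com (allFin m)

  ∈-nodes : ∀ x → x ∈ nodes
  ∈-nodes nil     = here refl
  ∈-nodes (cur j) = there (∈-++⁺ˡ (∈-map⁺ cur (∈-allFin j)))
  ∈-nodes (com j) = there (∈-++⁺ʳ (map cur (allFin m)) (∈-map⁺ com (∈-allFin j)))

  length-nodes : length nodes ≡ 1 + (m + m)
  length-nodes = cong suc (trans (length-++ (map cur (allFin m)))
    (cong₂ _+_ (trans (length-map cur (allFin m)) allFin≡) (trans (length-map com (allFin m)) allFin≡)))
    where
    allFin≡ : length (allFin m) ≡ m
    allFin≡ = length-tabulate {n = m} id

  pairCount : ℕ
  pairCount = (1 + (m + m)) * (1 + (m + m))

  -- The visited list has no repetitions, so this bounds the rounds of a search quadratically in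
  -- `m`.
  length-pairs≤ : ∀ {V : List Pair} → Unique V → length V ≤ pairCount
  length-pairs≤ u = ≤-trans (unique-⊆⇒length≤ u (λ { {x , y} _ → ∈-cartesianProduct⁺ (∈-nodes x) (∈-nodes y) }))
    (≤-reflexive (trans (length-cartesianProduct nodes nodes) (cong₂ _*_ length-nodes length-nodes)))

  module _ (tg : Node → Node) (k q : ℕ) where

    Explores : ℕ → Cmd → (x y : Node) → List Pair → Set
    Explores t c x y S = ∀ {V s} → State-of tg k q V s → ρ s rX ≡ ⟦ x ⟧ → ρ s rY ≡ ⟦ y ⟧ →
      Within t c s (Pushed 6 tg k q S V s)

    private
      at : ∀ (M : ℕ → ℕ) {a b c d e} → a ≡ b → c ≡ d → M (d + b) ≡ e → M (a + c) ≡ e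
      at M {b = b} {d = d} refl refl eq = trans (cong M (+-comm b d)) eq

      isZero : ∀ a → (1 ∸ a ≡ 0 → (a ≡ᵇ 0) ≡ false) × (1 ∸ a ≢ 0 → (a ≡ᵇ 0) ≡ true)
      isZero zero    = (λ ()) , λ _ → refl
      isZero (suc a) = (λ _ → refl) , λ ne → ⊥-elim (ne (0∸n≡0 a))

      isEqual : ∀ a b → (1 ∸ ((a ∸ b) + (b ∸ a)) ≡ 0 → (a ≡ᵇ b) ≡ false) × (1 ∸ ((a ∸ b) + (b ∸ a)) ≢ 0 → (a ≡ᵇ b) ≡ true)
      isEqual zero    zero    = (λ ()) , λ _ → refl
      isEqual zero    (suc b) = (λ _ → refl) , λ ne → ⊥-elim (ne (0∸n≡0 b))
      isEqual (suc a) zero    = (λ _ → refl) , λ ne → ⊥-elim (ne (0∸n≡0 (a + 0)))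
      isEqual (suc a) (suc b) = isEqual a b

    module _ (x y : Node) where

      infixr 5 _and_
      -- An exploration leaves the registers from `rX` on unchanged, so the next one still finds the
      -- popped pair there.
      _and_ : ∀ {t u c d S S′} → Explores t c x y S → Explores u d x y S′ → Explores (t + u) (c ⨾ d) x y (S ++ S′)
      (e and f) st ≡x ≡y = e st ≡x ≡y then λ { (frame , V′ , g , st′) →
        relax ≤-refl (λ { (frame′ , V″ , g′ , st″) → (λ r → trans (frame′ r) (frame r)) , V″ , Grown-++ g g′ , st″ })
          (f st′ (trans (frame 0) ≡x) (trans (frame 1) ≡y)) }

      pushing : ∀ os a b {V s} → (∀ r → ρ (steps os s) (6 + r) ≡ ρ s (6 + r)) → State-of tg k q V (steps os s) →
        ρ (steps os s) rPX ≡ ⟦ a ⟧ → ρ (steps os s) rPY ≡ ⟦ b ⟧ →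
        Within (length os + 11) (ops os ⨾ push) s (Pushed 6 tg k q ((a , b) ∷ []) V s)
      pushing os a b {V} {s} eq st ≡a ≡b = after-ops (
        relax ≤-refl (λ { (frame , rest) → (λ r → trans (frame (3 + r)) (eq r)) , rest }) (push-within {x = a} {b} st ≡a ≡b))

      conditionally : ∀ os b {t c v} → Explores t c x y (v ∷ []) →
        ∀ {V s} → (∀ r → ρ (steps os s) (6 + r) ≡ ρ s (6 + r)) → State-of tg k q V (steps os s) →
        ρ s rX ≡ ⟦ x ⟧ → ρ s rY ≡ ⟦ y ⟧ →
        (ρ (steps os s) rL ≡ 0 → b ≡ false) → (ρ (steps os s) rL ≢ 0 → b ≡ true) →
        Within (length os + (1 + t)) (ops os ⨾ when rL c) s (Pushed 6 tg k q (guard b v) V s)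
      conditionally os b {t} {c} {v} e {V} {s} eq st ≡x ≡y no′ yes′ = after-ops ( when-within
        (λ l≡0 → eq , V , subst (λ b → Grown (guard b v) V V) (sym (no′ l≡0)) Grown-nil , st)
        (λ l≢0 → subst (λ b → Within t c (steps os s) (Pushed 6 tg k q (guard b v) V s)) (sym (yes′ l≢0))
          (relax ≤-refl (λ { (frame , rest) → (λ r → trans (frame r) (eq r)) , rest })
            (e {V} {steps os s} st (trans (eq 0) ≡x) (trans (eq 1) ≡y)))))

      left-skip : Explores 13 _ x y ((next x , y) ∷ [])
      left-skip {V} {s} st ≡x ≡y = pushing (rPX ≔[ rX ] ∷ rPY ≔ rzero ⊕ rY ∷ []) (next x) y (λ r → refl) st
        (trans (cong (μ s) ≡x) (nexts x)) (cong₂ _+_ (env 0) ≡y)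
        where open Searching st

      right-skip : Explores 13 _ x y ((x , next y) ∷ [])
      right-skip {V} {s} st ≡x ≡y = pushing (rPX ≔ rzero ⊕ rX ∷ rPY ≔[ rY ] ∷ []) x (next y) (λ r → refl) st
        (cong₂ _+_ (env 0) ≡x) (trans (cong (μ s) ≡y) (nexts y))
        where open Searching st

      left-take : Explores 14 _ x y ((tg x , y) ∷ [])
      left-take {V} {s} st ≡x ≡y = pushing (rPX ≔ rX ⊕ rtwo ∷ rPX ≔[ rPX ] ∷ rPY ≔ rzero ⊕ rY ∷ []) (tg x) y (λ r → refl) st
        (at (μ s) ≡x (env 2) (tgts x)) (cong₂ _+_ (env 0) ≡y)
        where open Searching st

      right-take : Explores 14 _ x y ((x , tg y) ∷ [])
      right-take {V} {s} st ≡x ≡y = pushing (rPX ≔ rzero ⊕ rX ∷ rPY ≔ rY ⊕ rtwo ∷ rPY ≔[ rPY ] ∷ []) x (tg y) (λ r → refl) st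
        (cong₂ _+_ (env 0) ≡x) (at (μ s) ≡y (env 2) (tgts y))
        where open Searching st

      joint-take : Explores 15 _ x y ((tg x , tg y) ∷ [])
      joint-take {V} {s} st ≡x ≡y =
        pushing (rPX ≔ rX ⊕ rtwo ∷ rPX ≔[ rPX ] ∷ rPY ≔ rY ⊕ rtwo ∷ rPY ≔[ rPY ] ∷ []) (tg x) (tg y) (λ r → refl) st
          (at (μ s) ≡x (env 2) (tgts x)) (at (μ s) ≡y (env 2) (tgts y))
        where open Searching st

      left-ε : Explores 18 _ x y (guard (lab x ≡ᵇ 0) (tg x , y))
      left-ε {V} {s} st ≡x ≡y =
        conditionally (rL ≔ rX ⊕ rone ∷ rL ≔[ rL ] ∷ rL ≔ rone ⊖ rL ∷ []) (lab x ≡ᵇ 0) left-take (λ r → refl) st ≡x ≡y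
          (proj₁ (isZero (lab x)) ∘ trans (sym label≡)) (λ ne → proj₂ (isZero (lab x)) (ne ∘ trans label≡))
        where
        open Searching st
        label≡ : ρ s rone ∸ μ s (ρ s rX + ρ s rone) ≡ 1 ∸ lab x
        label≡ = cong₂ _∸_ (env 1) (at (μ s) ≡x (env 1) (labels x))

      right-ε : Explores 18 _ x y (guard (lab y ≡ᵇ 0) (x , tg y))
      right-ε {V} {s} st ≡x ≡y =
        conditionally (rL ≔ rY ⊕ rone ∷ rL ≔[ rL ] ∷ rL ≔ rone ⊖ rL ∷ []) (lab y ≡ᵇ 0) right-take (λ r → refl) st ≡x ≡y
          (proj₁ (isZero (lab y)) ∘ trans (sym label≡)) (λ ne → proj₂ (isZero (lab y)) (ne ∘ trans label≡))
        where
        open Searching st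
        label≡ : ρ s rone ∸ μ s (ρ s rY + ρ s rone) ≡ 1 ∸ lab y
        label≡ = cong₂ _∸_ (env 1) (at (μ s) ≡y (env 1) (labels y))

      joint : Explores 24 _ x y (guard (lab x ≡ᵇ lab y) (tg x , tg y))
      joint {V} {s} st ≡x ≡y =
        conditionally (rPX ≔ rX ⊕ rone ∷ rPX ≔[ rPX ] ∷ rPY ≔ rY ⊕ rone ∷ rPY ≔[ rPY ] ∷
          rL ≔ rPX ⊖ rPY ∷ rPX ≔ rPY ⊖ rPX ∷ rL ≔ rL ⊕ rPX ∷ rL ≔ rone ⊖ rL ∷ [])
          (lab x ≡ᵇ lab y) joint-take (λ r → refl) st ≡x ≡y
          (proj₁ (isEqual (lab x) (lab y)) ∘ trans (sym label≡)) (λ ne → proj₂ (isEqual (lab x) (lab y)) (ne ∘ trans label≡))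
        where
        open Searching st
        labx : μ s (ρ s rX + ρ s rone) ≡ lab x
        labx = at (μ s) ≡x (env 1) (labels x)
        laby : μ s (ρ s rY + ρ s rone) ≡ lab y
        laby = at (μ s) ≡y (env 1) (labels y)
        label≡ : ρ s rone ∸ ((μ s (ρ s rX + ρ s rone) ∸ μ s (ρ s rY + ρ s rone)) + (μ s (ρ s rY + ρ s rone) ∸ μ s (ρ s rX + ρ s rone)))
               ≡ 1 ∸ ((lab x ∸ lab y) + (lab y ∸ lab x))
        label≡ = cong₂ _∸_ (env 1) (cong₂ _+_ (cong₂ _∸_ labx laby) (cong₂ _∸_ laby labx))

      explore₁-correct : Explores 27 explore₁ x y (succ₁ tg (x , y))
      explore₁-correct = right-skip and right-take

      explore₂-correct : Explores 86 explore₂ x y (succ₂ tg (x , y))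
      explore₂-correct = left-skip and right-skip and left-ε and right-ε and joint

    module _ (o : ℕ) (field-of : Node → Node)
      (field-at : ∀ {M} → Tables tg M → ∀ x → M (o + ⟦ x ⟧) ≡ ⟦ field-of x ⟧) where

      seedPair : Fin m → Pair
      seedPair j = com j , field-of (cur j)

      record Seeded (i h o′ : ℕ) (t : ℕ) (κ M : ℕ → ℕ) : Set where
        field
          {V}     : List Pair
          started : h ≡ q
          offset  : o′ ≡ o
          state   : Searching tg k q V t κ M
          seeds   : ∀ j → toℕ j < i → seedPair j ∈ V
          only    : ∀ {v} → v ∈ V → ∃ λ j → v ≡ seedPair j

      Seeded-of : ℕ → Store → Set
      Seeded-of i s = Seeded i (ρ s rH) (ρ s rO) (ρ s rT) (λ r → ρ s (11 + r)) (μ s)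

      seed-within : ∀ {s} → State-of tg k q [] s → ρ s rH ≡ q → ρ s rO ≡ o →
        Within (2 + (m * (2 + (14 + 2)) + 1)) (for-edges seed) s (Seeded-of m)
      seed-within {s} st ≡h ≡o = for-edges-within Seeded-of (λ inv → Searching.env (Seeded.state inv)) (λ inv → inv) each
        (record { started = ≡h ; offset = ≡o ; state = st ; seeds = λ j () ; only = λ () })
        where
        each : ∀ j {s} → Seeded-of (toℕ j) s → ρ s rA ≡ ⟦ cur j ⟧ →
          Within 14 seed s (λ s′ → Seeded-of (suc (toℕ j)) s′ × ρ s′ rA ≡ ρ s rA × ρ s′ rD ≡ ρ s rD)
        each j {s} inv ≡a =
          after-ops (
            relax ≤-refl (λ { (frame , V′ , g , st′) → record
                { started = trans (frame 5) started
                ; offset  = trans (frame 9) offset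
                ; state   = st′
                ; seeds   = λ i i<1+j → seeds′ g i (≤-pred i<1+j)
                ; only    = λ v∈ → [ only , (λ { (here refl) → j , refl }) ]′ (sound g v∈)
                } , frame 7 , frame 6 })
              (push-within {x = com j} {field-of (cur j)} state
                (trans (cong₂ _+_ ≡a (env 5)) (sym (com-offset j)))
                (at (μ s) ≡a offset (field-at tables (cur j)))))
          where
          open Seeded inv
          open Searching state
          seeds′ : ∀ {V′} → Grown (seedPair j ∷ []) V V′ → ∀ i → toℕ i ≤ toℕ j → seedPair i ∈ V′
          seeds′ g i i≤j with toℕ i ≟ toℕ j
          ... | yes i≡j rewrite toℕ-injective i≡j = All.head (covers g)
          ... | no  i≢j = keeps g (seeds i (≤∧≢⇒< i≤j i≢j))

      module _ {t body} (succ : Pair → List Pair) (explores : ∀ x y → Explores t body x y (succ (x , y))) where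

        record Loop (v : ℕ) (d h : ℕ) (tp : ℕ) (κ M : ℕ → ℕ) : Set where
          field
            {done todo} : List Pair
            state   : Searching tg k q (done ++ todo) tp κ M
            popped  : h ≡ q + length done * 2
            counter : d ≡ tp ∸ h
            variant : v ≡ pairCount ∸ length done
            seeds   : ∀ j → seedPair j ∈ done ++ todo
            closed  : ∀ {u} → u ∈ done → All (_∈ done ++ todo) (succ u)
            reached : ∀ {u} → u ∈ done ++ todo → Reach seedPair succ u

        Loop-of : ℕ → Store → Set
        Loop-of v s = Loop v (ρ s rD) (ρ s rH) (ρ s rT) (λ r → ρ s (11 + r)) (μ s)

        Searched : Store → Set
        Searched s = ∃ λ V → State-of tg k q V s ×
          (∀ {u} → u ∈ V → Reach seedPair succ u) × (∀ {u} → Reach seedPair succ u → u ∈ V)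

        private
          shift : ∀ q l → q + l * 2 + 1 + 1 ≡ q + (l + 1) * 2
          shift = solve-∀

          iterate : ∀ {v s} → Loop-of v s → ρ s rD ≢ 0 →
            Within (4 + (t + 1)) (ops (rX ≔[ rH ] ∷ rH ≔ rH ⊕ rone ∷ rY ≔[ rH ] ∷ rH ≔ rH ⊕ rone ∷ []) ⨾
                          body ⨾ ops (rD ≔ rT ⊖ rH ∷ [])) s (λ s′ → ∃ λ v′ → v′ < v × Loop-of v′ s′)
          iterate {v} {s} inv d≢0 with Loop.todo inv in todo≡
          ... | [] = ⊥-elim (d≢0 (trans counter (m≤n⇒m∸n≡0 (≤-reflexive
                  (trans top (trans (cong (λ V → q + length V * 2) (trans (cong (done ++_) todo≡) (++-identityʳ done))) (sym popped)))))))
            where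
            open Loop inv
            open Searching state
          ... | (x , y) ∷ todo′ =
            after-ops (
              explores x y state ≡x ≡y then λ { {s′} (frame , V′ , g , st′) → ops-within
                ( pairCount ∸ length (done ++ (x , y) ∷ [])
                , subst (pairCount ∸ length (done ++ (x , y) ∷ []) <_) (sym variant) decreases
                , record
                  { done    = done ++ (x , y) ∷ []
                  ; todo    = todo′ ++ added g
                  ; state   = subst (λ V → State-of tg k q V s′) (split g) st′
                  ; popped  = trans (frame 2) (trans (cong₂ (λ a b → a + b + b) popped (env 1))
                                (trans (shift q (length done)) (cong (λ l → q + l * 2) (sym (length-++ done)))))
                  ; counter = refl
                  ; variant = refl
                  ; seeds   = λ j → subst (seedPair j ∈_) (split g) (keeps g (seeds j))
                  ; closed  = λ u∈ → subst (λ V → All (_∈ V) _) (split g) (closed′ g u∈)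
                  ; reached = λ u∈ → reached′ g (subst (_ ∈_) (sym (split g)) u∈)
                  }) })
            where
            open Loop inv
            open Searching state
            queue-here : μ s (q + length done * 2) ≡ ⟦ x ⟧ × μ s (1 + (q + length done * 2)) ≡ ⟦ y ⟧
            queue-here = queue-at q done (subst (λ V → Queue q (done ++ V) (μ s)) todo≡ queue)
            ≡x : μ s (ρ s rH) ≡ ⟦ x ⟧
            ≡x = trans (cong (μ s) popped) (proj₁ queue-here)
            ≡y : μ s (ρ s rH + ρ s rone) ≡ ⟦ y ⟧
            ≡y = trans (cong (μ s) (trans (cong₂ _+_ popped (env 1)) (+-comm _ 1))) (proj₂ queue-here)
            split : ∀ {V′} (g : Grown (succ (x , y)) (done ++ todo) V′) → V′ ≡ (done ++ (x , y) ∷ []) ++ (todo′ ++ added g)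
            split g = begin
              _                                           ≡⟨ grown g ⟩
              (done ++ todo) ++ added g                   ≡⟨ cong (λ T → (done ++ T) ++ added g) todo≡ ⟩
              (done ++ (x , y) ∷ todo′) ++ added g        ≡⟨ ++-assoc done ((x , y) ∷ todo′) (added g) ⟩
              done ++ (x , y) ∷ (todo′ ++ added g)        ≡⟨ ++-assoc done ((x , y) ∷ []) (todo′ ++ added g) ⟨
              (done ++ (x , y) ∷ []) ++ (todo′ ++ added g) ∎
              where open ≡-Reasoning
            closed′ : ∀ {V′ u} → Grown (succ (x , y)) (done ++ todo) V′ → u ∈ done ++ (x , y) ∷ [] → All (_∈ V′) (succ u)
            closed′ g u∈ with ∈-++⁻ done u∈
            ... | inj₁ u∈done      = All.map (keeps g) (closed u∈done)
            ... | inj₂ (here refl) = covers g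
            xy∈ : (x , y) ∈ done ++ todo
            xy∈ = ∈-++⁺ʳ done (subst ((x , y) ∈_) (sym todo≡) (here refl))
            reached′ : ∀ {V′ u} → Grown (succ (x , y)) (done ++ todo) V′ → u ∈ V′ → Reach seedPair succ u
            reached′ g u∈ = [ reached , move (reached xy∈) ]′ (sound g u∈)
            decreases : pairCount ∸ length (done ++ (x , y) ∷ []) < pairCount ∸ length done
            decreases = subst (λ l → pairCount ∸ l < pairCount ∸ length done) (sym (trans (length-++ done) (+-comm (length done) 1)))
              (∸-monoʳ-< {pairCount} ≤-refl (begin
                suc (length done)                ≡⟨ +-comm 1 (length done) ⟩
                length done + 1                  ≤⟨ +-monoʳ-≤ (length done) (s≤s z≤n) ⟩
                length done + length ((x , y) ∷ todo′)  ≡⟨ cong (λ T → length done + length T) todo≡ ⟨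
                length done + length todo        ≡⟨ length-++ done ⟨
                length (done ++ todo)            ≤⟨ length-pairs≤ unique ⟩
                pairCount                        ∎))
              where open ≤-Reasoning

          finish : ∀ {s} → ρ s rD ≡ 0 × (∃ λ v → Loop-of v s) → Searched s
          finish {s} (d≡0 , v , inv) with Loop.todo inv in todo≡
          ... | u ∷ todo′ = ⊥-elim (<⇒≱ h<t (m∸n≡0⇒m≤n (trans (sym counter) d≡0)))
            where
            open Loop inv
            open Searching state
            todo>0 : 0 < length todo
            todo>0 = subst (λ T → 0 < length T) (sym todo≡) (s≤s z≤n)
            h<t : ρ s rH < ρ s rT
            h<t = begin-strict
              ρ s rH                            ≡⟨ popped ⟩
              q + length done * 2               <⟨ +-monoʳ-< q (*-monoˡ-< 2 (m<m+n (length done) todo>0)) ⟩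
              q + (length done + length todo) * 2 ≡⟨ cong (λ l → q + l * 2) (length-++ done) ⟨
              q + length (done ++ todo) * 2     ≡⟨ top ⟨
              ρ s rT                            ∎
              where open ≤-Reasoning
          ... | [] = done ++ todo , state , reached , complete
            where
            open Loop inv
            all-done : done ++ todo ≡ done
            all-done = trans (cong (done ++_) todo≡) (++-identityʳ done)
            complete : ∀ {u} → Reach seedPair succ u → u ∈ done ++ todo
            complete (seeded j)   = seeds j
            complete (move r v∈) = All.lookup (closed (subst (_ ∈_) all-done (complete r))) v∈

        search-within : ∀ {s} → Seeded-of m s →
          Within (1 + (pairCount * (2 + (4 + (t + 1))) + 1)) (search body) s Searched
        search-within {s} sd = ops-within
            {Post = Loop-of pairCount} (record
              { done = [] ; state = state ; popped = trans started (sym (+-identityʳ q)) ; counter = refl ; variant = refl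
              ; seeds = λ j → seeds j (toℕ<n j) ; closed = λ () ; reached = λ u∈ → reach (only u∈) })
          then λ inv → relax ≤-refl (λ {s} → finish {s}) (while-within Loop-of iterate pairCount ≤-refl inv)
          where
          open Seeded sd
          reach : ∀ {v} → (∃ λ j → v ≡ seedPair j) → Reach seedPair succ v
          reach (j , refl) = seeded j

  -- Building the tables

  length-encode : length (encode A) ≡ 3 + (m * 3 + (n + n))
  length-encode = cong (3 +_) (trans (length-++ (concatMap encodeTransition (transitions A)))
    (cong₂ _+_ (length-encodeEdges (transitions A)) (trans (length-++ (encodeSubset (initial A)))
      (cong₂ _+_ (length-encodeSubset (initial A)) (length-encodeSubset (final A))))))

  other-cell : ∀ M {f g} x y v → f < 3 → g < 3 → ¬ (g ≡ f × y ≡ x) → (M [ f + ⟦ x ⟧ ↦ v ]) (g + ⟦ y ⟧) ≡ M (g + ⟦ y ⟧)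
  other-cell M {f} {g} x y v f<3 g<3 ne = untouched M v (λ eq → ne (cell-injective {x = y} {x} g<3 f<3 eq))

  beyond-cell : ∀ M {f a} x v → f < 3 → W ≤ a → (M [ f + ⟦ x ⟧ ↦ v ]) a ≡ M a
  beyond-cell M x v f<3 W≤a = untouched M v (λ eq → <⇒≱ (cell< x f<3) (≤-trans W≤a (≤-reflexive eq)))

  0<3 : 0 < 3
  0<3 = s≤s z≤n
  1<3 : 1 < 3
  1<3 = s≤s (s≤s z≤n)
  2<3 : 2 < 3
  2<3 = s≤s (s≤s (s≤s z≤n))

  cur-injective : ∀ {i j} → cur i ≡ cur j → i ≡ j
  cur-injective refl = refl

  com-injective : ∀ {i j} → com i ≡ com j → i ≡ j
  com-injective refl = refl

  hd-suc : ∀ j p → hd (suc (toℕ j)) p ≡ (if does (source (edge j) Fin.≟ p) then cur j else hd (toℕ j) p)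
  hd-suc j p with toℕ j <? m
  ... | no  ≮m = ⊥-elim (≮m (toℕ<n j))
  ... | yes <m = cong (λ i → if does (source (edge i) Fin.≟ p) then cur i else hd (toℕ j) p) (fromℕ<-toℕ j <m)

  -- In the middle of the pass the first cell of `cur j` is a link for `j` below `i` and still a
  -- source from `i` on. `high` keeps the region of rows, marks and queue at zero for later.
  record Linking (i : ℕ) (κ M : ℕ → ℕ) : Set where
    field
      env     : Env κ
      nexts   : ∀ j → toℕ j < i → M ⟦ cur j ⟧ ≡ ⟦ next (cur j) ⟧
      sources : ∀ j → i ≤ toℕ j → M ⟦ cur j ⟧ ≡ toℕ (source (edge j))
      labels  : ∀ j → M (1 + ⟦ cur j ⟧) ≡ lab (cur j)
      targets : ∀ j → M (2 + ⟦ cur j ⟧) ≡ toℕ (target (edge j))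
      nils    : ∀ {f} → f < 3 → M (f + ⟦ nil ⟧) ≡ 0
      heads   : ∀ p → M (B + toℕ p) ≡ ⟦ hd i p ⟧
      high    : ∀ {a} → C ≤ a → M a ≡ 0

  Linking-of : ℕ → Store → Set
  Linking-of i s = Linking i (λ r → ρ s (13 + r)) (μ s)

  initialise-within :
    Within 16 (ops initialise) (store (λ _ → 0) (contents (encode A))) (λ s → Linking-of 0 (steps first-edge s))
  initialise-within = ops-within record
    { env     = env′
    ; nexts   = λ j ()
    ; sources = λ j _ → raw 0<3 j
    ; labels  = raw 1<3
    ; targets = raw 2<3
    ; nils    = nils′
    -- The head array lies beyond the input, so it reads zero, the address of `nil`, which is
    -- `hd 0 p`.
    ; heads   = λ p → trans (keep (≤-trans 3≤B (m≤m+n B (toℕ p)))) (zero-from (m≤m+n B _))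
    ; high    = λ C≤a → trans (keep (≤-trans 3≤B (≤-trans B≤C C≤a))) (zero-from (≤-trans B≤C C≤a))
    }
    where
    M₀ M₁ : ℕ → ℕ
    M₀ = contents (encode A)
    M₁ = M₀ [ 0 ↦ 0 ] [ 1 ↦ 0 ] [ 2 ↦ 0 ]
    keep : ∀ {a} → 3 ≤ a → M₁ a ≡ M₀ a
    keep (s≤s (s≤s (s≤s _))) = refl
    3≤B : 3 ≤ B
    3≤B = ≤-trans (s≤s (s≤s (s≤s z≤n))) W≤B
    zero-from : ∀ {a} → B ≤ a → M₀ a ≡ 0
    zero-from {a} B≤a = contents-beyond (encode A) (begin
      length (encode A)          ≡⟨ length-encode ⟩
      3 + (m * 3 + (n + n))      ≤⟨ m≤m+n _ (m * 3) ⟩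
      3 + (m * 3 + (n + n)) + m * 3 ≡⟨ rearrange m n ⟩
      B                          ≤⟨ B≤a ⟩
      a                          ∎)
      where
      open ≤-Reasoning
      rearrange : ∀ m n → 3 + (m * 3 + (n + n)) + m * 3 ≡ (1 + (m + m)) * 3 + n + n
      rearrange = solve-∀
    raw : ∀ {f} → f < 3 → ∀ j → M₁ (f + ⟦ cur j ⟧) ≡ contents (encodeTransition (edge j)) f
    raw {f} f<3 j = trans (keep (≤-trans (s≤s (s≤s (s≤s z≤n))) (m≤n+m ⟦ cur j ⟧ f)))
      (trans (cong M₀ (shift f (toℕ j))) (contents-edge (transitions A) _ j f<3))
      where
      shift : ∀ f j → f + (1 + j) * 3 ≡ 3 + (f + j * 3)
      shift = solve-∀
    nils′ : ∀ {f} → f < 3 → M₁ (f + 0) ≡ 0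
    nils′ {0} _ = refl
    nils′ {1} _ = refl
    nils′ {2} _ = refl
    nils′ {suc (suc (suc f))} (s≤s (s≤s (s≤s ())))
    3m≡ : ∀ m → m + m + m ≡ m * 3
    3m≡ = solve-∀
    W≡ : ∀ m → m + m + m + (m + m + m) + 3 ≡ (1 + (m + m)) * 3
    W≡ = solve-∀
    env′ : ∀ r → ρ (steps initialise (store (λ _ → 0) M₀)) (13 + r) ≡ constants r
    env′ 0 = refl
    env′ 1 = refl
    env′ 2 = refl
    env′ 3 = refl
    env′ 4 = refl
    env′ 5 = 3m≡ m
    env′ 6 = cong (λ w → w + n + n) (W≡ m)
    env′ 7 = cong (λ w → w + n + n + n) (W≡ m)
    env′ 8 = W≡ m
    env′ 9 = cong (λ w → w + n + n + n + w) (W≡ m)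
    env′ (suc (suc (suc (suc (suc (suc (suc (suc (suc (suc r)))))))))) = refl

  link-heads-step : ∀ {κ M} j → Linking (toℕ j) κ M →
    ∀ {M₁ M₂} → M₁ ≡ M [ ⟦ cur j ⟧ ↦ M (B + toℕ (source (edge j))) ] → M₂ ≡ M₁ [ B + toℕ (source (edge j)) ↦ ⟦ cur j ⟧ ] →
    Linking (suc (toℕ j)) κ M₂
  link-heads-step {κ} {M} j l refl refl = record
    { env     = env
    ; nexts   = nexts′
    ; sources = λ i j<i → trans (cell′ {0} 0<3 (cur i) (λ { (_ , eq) → <⇒≢ j<i (cong toℕ (sym (cur-injective eq))) })) (sources i (<⇒≤ j<i))
    ; labels  = λ i → trans (cell′ {1} 1<3 (cur i) (λ ())) (labels i)
    ; targets = λ i → trans (cell′ {2} 2<3 (cur i) (λ ())) (targets i)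
    ; nils    = λ f<3 → trans (cell′ f<3 nil (λ ())) (nils f<3)
    ; heads   = heads′
    ; high    = λ {a} C≤a → trans (untouched M₁ _ (λ eq → <⇒≱ (+-monoʳ-< B (toℕ<n p)) (≤-trans C≤a (≤-reflexive eq))))
                  (trans (beyond-cell M (cur j) _ 0<3 (≤-trans W≤C C≤a)) (high C≤a))
    }
    where
    open Linking l
    p = source (edge j)
    M₁ = M [ ⟦ cur j ⟧ ↦ M (B + toℕ p) ]
    M₂ = M₁ [ B + toℕ p ↦ ⟦ cur j ⟧ ]
    low : ∀ {a} → a < W → M₂ a ≡ M₁ a
    low a<W = untouched M₁ _ (<⇒≢ (≤-trans a<W (≤-trans W≤B (m≤m+n B _))))
    cell′ : ∀ {f} → f < 3 → ∀ x → ¬ (f ≡ 0 × x ≡ cur j) → M₂ (f + ⟦ x ⟧) ≡ M (f + ⟦ x ⟧)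
    cell′ f<3 x ne = trans (low (cell< x f<3)) (other-cell M (cur j) x _ 0<3 f<3 ne)
    nexts′ : ∀ i → toℕ i < suc (toℕ j) → M₂ ⟦ cur i ⟧ ≡ ⟦ next (cur i) ⟧
    nexts′ i i≤j with toℕ i ≟ toℕ j
    ... | no  i≢j = trans (cell′ {0} 0<3 (cur i) (λ { (_ , eq) → i≢j (cong toℕ (cur-injective eq)) })) (nexts i (≤∧≢⇒< (≤-pred i≤j) i≢j))
    ... | yes i≡j rewrite toℕ-injective i≡j = trans (low (⟦⟧<W (cur j))) (trans (updated M ⟦ cur j ⟧ _) (heads p))
    heads′ : ∀ r → M₂ (B + toℕ r) ≡ ⟦ hd (suc (toℕ j)) r ⟧
    heads′ r rewrite hd-suc j r with p Fin.≟ r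
    ... | yes refl = updated M₁ (B + toℕ p) _
    ... | no  p≢r  = trans (untouched M₁ _ (λ eq → p≢r (toℕ-injective (sym (+-cancelˡ-≡ B _ _ eq)))))
                       (trans (beyond-cell M (cur j) _ 0<3 (≤-trans W≤B (m≤m+n B _))) (heads r))

  link-heads-within : ∀ {s} → Linking-of 0 (steps first-edge s) →
    Within (2 + (m * (2 + (5 + 2)) + 1)) (for-edges link-heads) s (Linking-of m)
  link-heads-within = for-edges-within Linking-of Linking.env (λ inv → inv) each
    where
    each : ∀ j {s} → Linking-of (toℕ j) s → ρ s rA ≡ ⟦ cur j ⟧ →
      Within 5 link-heads s (λ s′ → Linking-of (suc (toℕ j)) s′ × ρ s′ rA ≡ ρ s rA × ρ s′ rD ≡ ρ s rD)
    each j {s} inv ≡a = ops-within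
      ( link-heads-step j inv {M₁ = M₁} {M₁ [ ρ s rB + μ s (ρ s rA) ↦ ρ s rA ]}
          (cong₂ (λ a b → μ s [ a ↦ μ s b ]) ≡a address) (cong₂ (λ a b → M₁ [ a ↦ b ]) address ≡a)
      , refl , refl)
      where
      open Linking inv
      M₁ : ℕ → ℕ
      M₁ = μ s [ ρ s rA ↦ μ s (ρ s rB + μ s (ρ s rA)) ]
      address : ρ s rB + μ s (ρ s rA) ≡ B + toℕ (source (edge j))
      address = cong₂ _+_ (env 6) (trans (cong (μ s) ≡a) (sources j ≤-refl))

  record Targeting (i : ℕ) (κ M : ℕ → ℕ) : Set where
    field
      env     : Env κ
      nexts   : ∀ j → M ⟦ cur j ⟧ ≡ ⟦ next (cur j) ⟧
      labels  : ∀ j → M (1 + ⟦ cur j ⟧) ≡ lab (cur j)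
      targets : ∀ j → i ≤ toℕ j → M (2 + ⟦ cur j ⟧) ≡ toℕ (target (edge j))
      tgts    : ∀ j → toℕ j < i → M (2 + ⟦ cur j ⟧) ≡ ⟦ tgt (cur j) ⟧
      copies  : ∀ j → toℕ j < i → M ⟦ com j ⟧ ≡ 0 × M (1 + ⟦ com j ⟧) ≡ lab (com j) × M (2 + ⟦ com j ⟧) ≡ ⟦ tgt (com j) ⟧
      nils    : ∀ {f} → f < 3 → M (f + ⟦ nil ⟧) ≡ 0
      heads   : ∀ p → M (B + toℕ p) ≡ ⟦ hd m p ⟧
      high    : ∀ {a} → C ≤ a → M a ≡ 0

  Targeting-of : ℕ → Store → Set
  Targeting-of i s = Targeting i (λ r → ρ s (13 + r)) (μ s)

  link-targets-step : ∀ {κ M} j → Targeting (toℕ j) κ M →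
    ∀ {t l M₁ M₂ M₃ M₄} → t ≡ ⟦ tgt (cur j) ⟧ → l ≡ lab (cur j) →
    M₁ ≡ M [ 2 + ⟦ cur j ⟧ ↦ t ] → M₂ ≡ M₁ [ 0 + ⟦ com j ⟧ ↦ 0 ] →
    M₃ ≡ M₂ [ 1 + ⟦ com j ⟧ ↦ l ] → M₄ ≡ M₃ [ 2 + ⟦ com j ⟧ ↦ t ] →
    Targeting (suc (toℕ j)) κ M₄
  link-targets-step {κ} {M} j l refl refl refl refl refl refl = record
    { env     = env
    ; nexts   = λ i → trans (cell-cur 0<3 i (λ ())) (nexts i)
    ; labels  = λ i → trans (cell-cur 1<3 i (λ ())) (labels i)
    ; targets = λ i j<i → trans (cell-cur 2<3 i (λ { (_ , eq) → <⇒≢ j<i (cong toℕ (sym eq)) })) (targets i (<⇒≤ j<i))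
    ; tgts    = tgts′
    ; copies  = copies′
    ; nils    = λ f<3 → trans (cell f<3 nil (λ ()) (λ ())) (nils f<3)
    ; heads   = λ p → trans (above (≤-trans W≤B (m≤m+n B _))) (heads p)
    ; high    = λ C≤a → trans (above (≤-trans W≤C C≤a)) (high C≤a)
    }
    where
    open Targeting l
    M₁ = M [ 2 + ⟦ cur j ⟧ ↦ ⟦ tgt (cur j) ⟧ ]
    M₂ = M₁ [ 0 + ⟦ com j ⟧ ↦ 0 ]
    M₃ = M₂ [ 1 + ⟦ com j ⟧ ↦ lab (cur j) ]
    M₄ = M₃ [ 2 + ⟦ com j ⟧ ↦ ⟦ tgt (cur j) ⟧ ]
    cell₁ : ∀ {f} → f < 3 → ∀ x → x ≢ com j → M₄ (f + ⟦ x ⟧) ≡ M₁ (f + ⟦ x ⟧)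
    cell₁ f<3 x ne = trans (other-cell M₃ (com j) x _ 2<3 f<3 (ne ∘ proj₂))
      (trans (other-cell M₂ (com j) x _ 1<3 f<3 (ne ∘ proj₂)) (other-cell M₁ (com j) x _ 0<3 f<3 (ne ∘ proj₂)))
    cell : ∀ {f} → f < 3 → ∀ x → x ≢ com j → ¬ (f ≡ 2 × x ≡ cur j) → M₄ (f + ⟦ x ⟧) ≡ M (f + ⟦ x ⟧)
    cell f<3 x ne ne′ = trans (cell₁ f<3 x ne) (other-cell M (cur j) x _ 2<3 f<3 ne′)
    cell-cur : ∀ {f} → f < 3 → ∀ i → ¬ (f ≡ 2 × i ≡ j) → M₄ (f + ⟦ cur i ⟧) ≡ M (f + ⟦ cur i ⟧)
    cell-cur f<3 i ne = cell f<3 (cur i) (λ ()) (λ { (a , b) → ne (a , cur-injective b) })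
    above : ∀ {a} → W ≤ a → M₄ a ≡ M a
    above W≤a = trans (beyond-cell M₃ (com j) _ 2<3 W≤a) (trans (beyond-cell M₂ (com j) _ 1<3 W≤a)
      (trans (beyond-cell M₁ (com j) _ 0<3 W≤a) (beyond-cell M (cur j) _ 2<3 W≤a)))
    tgts′ : ∀ i → toℕ i < suc (toℕ j) → M₄ (2 + ⟦ cur i ⟧) ≡ ⟦ tgt (cur i) ⟧
    tgts′ i i≤j with toℕ i ≟ toℕ j
    ... | no  i≢j = trans (cell-cur 2<3 i (λ { (_ , eq) → i≢j (cong toℕ eq) })) (tgts i (≤∧≢⇒< (≤-pred i≤j) i≢j))
    ... | yes i≡j rewrite toℕ-injective i≡j = trans (cell₁ 2<3 (cur j) (λ ())) (updated M (2 + ⟦ cur j ⟧) _)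
    copies′ : ∀ i → toℕ i < suc (toℕ j) → M₄ ⟦ com i ⟧ ≡ 0 × M₄ (1 + ⟦ com i ⟧) ≡ lab (com i) × M₄ (2 + ⟦ com i ⟧) ≡ ⟦ tgt (com i) ⟧
    copies′ i i≤j with toℕ i ≟ toℕ j
    ... | no  i≢j = trans (cell-com 0<3) (proj₁ old) , trans (cell-com 1<3) (proj₁ (proj₂ old)) , trans (cell-com 2<3) (proj₂ (proj₂ old))
      where
      old = copies i (≤∧≢⇒< (≤-pred i≤j) i≢j)
      cell-com : ∀ {f} → f < 3 → M₄ (f + ⟦ com i ⟧) ≡ M (f + ⟦ com i ⟧)
      cell-com f<3 = cell f<3 (com i) (λ eq → i≢j (cong toℕ (com-injective eq))) (λ ())
    ... | yes i≡j rewrite toℕ-injective i≡j =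
      trans (other-cell M₃ (com j) (com j) _ 2<3 0<3 (λ ())) (trans (other-cell M₂ (com j) (com j) _ 1<3 0<3 (λ ())) (updated M₁ ⟦ com j ⟧ _)) ,
      trans (other-cell M₃ (com j) (com j) _ 2<3 1<3 (λ ())) (updated M₂ (1 + ⟦ com j ⟧) _) ,
      updated M₃ (2 + ⟦ com j ⟧) _

  link-targets-within : ∀ {s} → Linking-of m s →
    Within (2 + (m * (2 + (13 + 2)) + 1)) (for-edges link-targets) s (Targeting-of m)
  link-targets-within lk = for-edges-within Targeting-of Targeting.env (λ inv → inv) each (record
    { env = L.env ; nexts = λ j → L.nexts j (toℕ<n j) ; labels = L.labels ; targets = λ j _ → L.targets j ; tgts = λ j ()
    ; copies = λ j () ; nils = L.nils ; heads = L.heads ; high = L.high })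
    where
    module L = Linking lk
    each : ∀ j {s} → Targeting-of (toℕ j) s → ρ s rA ≡ ⟦ cur j ⟧ →
      Within 13 link-targets s (λ s′ → Targeting-of (suc (toℕ j)) s′ × ρ s′ rA ≡ ρ s rA × ρ s′ rD ≡ ρ s rD)
    each j {s} inv ≡a = ops-within
      ( link-targets-step j inv {t} {l} {M₁} {M₂} {M₃} {M₃ [ ρ s rA + ρ s r3m + ρ s rone + ρ s rone ↦ t ]} t≡ l≡
          (cong (λ a → μ s [ a ↦ t ]) a+2)
          (cong₂ (λ a b → M₁ [ a ↦ b ]) a+3m (env 0))
          (cong (λ a → M₂ [ a ↦ l ]) (trans (cong₂ _+_ a+3m (env 1)) (+-comm ⟦ com j ⟧ 1)))
          (cong (λ a → M₃ [ a ↦ t ]) (trans (cong₂ _+_ (cong₂ _+_ a+3m (env 1)) (env 1)) (trans (+-assoc ⟦ com j ⟧ 1 1) (+-comm ⟦ com j ⟧ 2))))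
      , refl , refl)
      where
      open Targeting inv
      t l : ℕ
      t = μ s (ρ s rB + μ s (ρ s rA + ρ s rtwo))
      M₁ M₂ M₃ : ℕ → ℕ
      M₁ = μ s [ ρ s rA + ρ s rtwo ↦ t ]
      l = M₁ (ρ s rA + ρ s rone)
      M₂ = M₁ [ ρ s rA + ρ s r3m ↦ ρ s rzero ]
      M₃ = M₂ [ ρ s rA + ρ s r3m + ρ s rone ↦ l ]
      a+2 : ρ s rA + ρ s rtwo ≡ 2 + ⟦ cur j ⟧
      a+2 = trans (cong₂ _+_ ≡a (env 2)) (+-comm ⟦ cur j ⟧ 2)
      a+1 : ρ s rA + ρ s rone ≡ 1 + ⟦ cur j ⟧
      a+1 = trans (cong₂ _+_ ≡a (env 1)) (+-comm ⟦ cur j ⟧ 1)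
      a+3m : ρ s rA + ρ s r3m ≡ ⟦ com j ⟧
      a+3m = trans (cong₂ _+_ ≡a (env 5)) (sym (com-offset j))
      t≡ : t ≡ ⟦ tgt (cur j) ⟧
      t≡ = trans (cong (μ s) (cong₂ _+_ (env 6) (trans (cong (μ s) a+2) (targets j ≤-refl)))) (heads (target (edge j)))
      l≡ : l ≡ lab (cur j)
      l≡ = trans (cong₂ (λ a b → (μ s [ a ↦ t ]) b) a+2 a+1) (trans (other-cell (μ s) (cur j) (cur j) t 2<3 1<3 (λ ())) (labels j))

  record Prepared (κ M : ℕ → ℕ) (t : ℕ) : Set where
    field
      env    : Env κ
      tables : Tables tgt M
      rows   : Rows M
      high   : ∀ {a} → G ≤ a → M a ≡ 0
      top    : t ≡ Q

  Prepared-of : Store → Set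
  Prepared-of s = Prepared (λ r → ρ s (13 + r)) (μ s) (ρ s rT)

  tabulate-rows-within : ∀ {s} → Targeting-of m s →
    Within (3 + (W * (2 + 4) + 1 + 1)) tabulate-rows s Prepared-of
  tabulate-rows-within {s₀} tg₀ =
    ops-within {Post = Counted W} (record
      { i       = 0
      ; total   = refl
      ; env     = env
      ; address = trans (cong₂ _+_ (env 0) (env 7)) (sym (+-identityʳ C))
      ; value   = trans (cong₂ _+_ (env 0) (env 9)) (sym (+-identityʳ G))
      ; counter = cong₂ _+_ (env 0) (env 8)
      ; written = λ x ()
      ; low     = λ _ → refl
      ; zeros   = λ C+0≤a → high (≤-trans (≤-reflexive (sym (+-identityʳ C))) C+0≤a)
      }) then λ c →
    for-within Counted Counting.counter iterate c then λ { {s} c → ops-within (finished {s} c) }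
    where
    open Targeting tg₀
    record Counting (k : ℕ) (κ M : ℕ → ℕ) (a u d : ℕ) : Set where
      field
        {i}     : ℕ
        total   : i + k ≡ W
        env     : Env κ
        address : a ≡ C + i
        value   : u ≡ G + i * W
        counter : d ≡ k
        written : ∀ x → x < i → M (C + x) ≡ G + x * W
        low     : ∀ {b} → b < C → M b ≡ μ s₀ b
        zeros   : ∀ {b} → C + i ≤ b → M b ≡ 0

    Counted : ℕ → Store → Set
    Counted k s = Counting k (λ r → ρ s (13 + r)) (μ s) (ρ s rA) (ρ s rU) (ρ s rD)

    iterate : ∀ {k s} → Counted (suc k) s → Within 4 (ops ([ rA ]≔ rU ∷ rA ≔ rA ⊕ rone ∷ rU ≔ rU ⊕ rW ∷ rD ≔ rD ⊖ rone ∷ [])) s (Counted k)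
    iterate {k} {s} c = ops-within record
      { i       = suc i
      ; total   = trans (sym (+-suc i k)) total
      ; env     = env′
      ; address = trans (cong₂ _+_ address (env′ 1)) (trans (+-comm _ 1) (sym (+-suc C i)))
      ; value   = trans (cong₂ _+_ value (env′ 8)) (trans (+-assoc G (i * W) W) (cong (G +_) (+-comm (i * W) W)))
      ; counter = cong₂ _∸_ counter (env′ 1)
      ; written = written′
      ; low     = λ b<C → trans (untouched (μ s) _ (<⇒≢ (≤-trans b<C (≤-trans (m≤m+n C i) (≤-reflexive (sym address)))))) (low b<C)
      ; zeros   = λ {b} le → trans (untouched (μ s) _ (λ eq → <⇒≢ (≤-trans (≤-reflexive (sym (+-suc C i))) le) (sym (trans eq address))))
                    (zeros (≤-trans (+-monoʳ-≤ C (n≤1+n i)) le))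
      }
      where
      open Counting c renaming (env to env′)
      written′ : ∀ x → x < suc i → (μ s [ ρ s rA ↦ ρ s rU ]) (C + x) ≡ G + x * W
      written′ x x≤i with x ≟ i
      ... | no  x≢i  = trans (untouched (μ s) _ (λ eq → x≢i (+-cancelˡ-≡ C _ _ (trans eq address)))) (written x (≤∧≢⇒< (≤-pred x≤i) x≢i))
      ... | yes refl = trans (cong (μ s [ ρ s rA ↦ ρ s rU ]) (sym address)) (trans (updated (μ s) (ρ s rA) _) value)

    finished : ∀ {s} → Counted 0 s → Prepared (λ r → ρ s (13 + r)) (μ s) (ρ s rzero + ρ s rU)
    finished {s} c = record
      { env    = env′
      ; tables = record { nexts = nexts′ ; labels = labels′ ; tgts = tgts′ }
      ; rows   = λ x → written ⟦ x ⟧ (subst (⟦ x ⟧ <_) (sym i≡W) (⟦⟧<W x))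
      ; high   = λ le → zeros (subst (λ i → C + i ≤ _) (sym i≡W) le)
      ; top    = trans (cong₂ _+_ (env′ 0) value) (cong (λ i → G + i * W) i≡W)
      }
      where
      open Counting c renaming (env to env′)
      i≡W : i ≡ W
      i≡W = trans (sym (+-identityʳ i)) total
      cell : ∀ {f} x → f < 3 → μ s (f + ⟦ x ⟧) ≡ μ s₀ (f + ⟦ x ⟧)
      cell x f<3 = low (≤-trans (cell< x f<3) W≤C)
      nexts′ : ∀ x → μ s ⟦ x ⟧ ≡ ⟦ next x ⟧
      nexts′ nil     = trans (cell nil 0<3) (nils 0<3)
      nexts′ (cur j) = trans (cell (cur j) 0<3) (nexts j)
      nexts′ (com j) = trans (cell (com j) 0<3) (proj₁ (copies j (toℕ<n j)))
      labels′ : ∀ x → μ s (1 + ⟦ x ⟧) ≡ lab x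
      labels′ nil     = trans (cell nil 1<3) (nils 1<3)
      labels′ (cur j) = trans (cell (cur j) 1<3) (labels j)
      labels′ (com j) = trans (cell (com j) 1<3) (proj₁ (proj₂ (copies j (toℕ<n j))))
      tgts′ : ∀ x → μ s (2 + ⟦ x ⟧) ≡ ⟦ tgt x ⟧
      tgts′ nil     = trans (cell nil 2<3) (nils 2<3)
      tgts′ (cur j) = trans (cell (cur j) 2<3) (tgts j (toℕ<n j))
      tgts′ (com j) = trans (cell (com j) 2<3) (proj₂ (proj₂ (copies j (toℕ<n j))))

  -- The two phases

  -- The left component never moves and only names a transition; the right one wanders through the
  -- lists of all states reachable from its target. So `(com j , cur j)` is reached exactly if
  -- transition `j` lies on a cycle.
  Reach₁ : Pair → Set
  Reach₁ = Reach (λ j → com j , tgt (cur j)) (succ₁ tgt)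

  tgt₂ : (Fin m → Bool) → Node → Node
  tgt₂ flag nil     = nil
  tgt₂ flag (cur j) = if flag j then tgt (cur j) else nil
  tgt₂ flag (com j) = if flag j then tgt (com j) else nil

  Reach₂ : (Fin m → Bool) → Pair → Set
  Reach₂ flag = Reach (λ j → com j , next (cur j)) (succ₂ (tgt₂ flag))

  -- What remains of a search for the later passes: the queue is forgotten, and the marks alone tell
  -- which pairs were reached.
  record Done (tg : Node → Node) (k : ℕ) (R : Pair → Set) (κ M : ℕ → ℕ) (t : ℕ) : Set where
    field
      env     : Env κ
      rows    : Rows M
      tables  : Tables tg M
      marked  : ∀ {x y} → R (x , y) → M (mark x y) ≡ k
      decide  : ∀ x y → Dec (R (x , y))
      clear   : ∀ {x y} → ¬ R (x , y) → M (mark x y) < k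
      top     : Q ≤ t

  Done-of : (tg : Node → Node) (k : ℕ) (R : Pair → Set) → Store → Set
  Done-of tg k R s = Done tg k R (λ r → ρ s (13 + r)) (μ s) (ρ s rT)

  phase-result : ∀ {tg k q R V t} {κ M : ℕ → ℕ} → Searching tg k q V t κ M →
    (∀ {u} → u ∈ V → R u) → (∀ {u} → R u → u ∈ V) → Done tg k R (λ r → κ (2 + r)) M t
  phase-result {tg} {k} {q} {R} {V} st snd cmp = record
    { env = env ; rows = rows ; tables = tables ; marked = ins ∘ cmp ; decide = decide ; clear = λ ¬r → outs (¬r ∘ snd)
    ; top = ≤-trans base (≤-trans (m≤m+n q _) (≤-reflexive (sym top))) }
    where
    open Searching st
    decide : ∀ x y → Dec (R (x , y))
    decide x y with (x , y) ∈ᵖ? V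
    ... | yes v∈ = yes (snd v∈)
    ... | no  v∉ = no (v∉ ∘ cmp)

  phase₁-within : ∀ {s} → Prepared-of s → Within (searchTime m 27) phase₁ s (Done-of tgt 1 Reach₁)
  phase₁-within {s} p =
    after-ops (
    seed-within tgt 1 Q 2 tgt Tables.tgts (record
      { env = env ; key = refl ; rows = rows ; tables = tables ; visited = record
        { ins = λ () ; outs = λ {x} {y} _ → subst (_< 1) (sym (high (mark≥G x y))) (s≤s z≤n) ; unique = []
        ; base = ≤-refl ; top = trans top (sym (+-identityʳ Q)) } })
      (cong₂ _+_ (env 0) top) refl then λ sd →
    relax ≤-refl (λ { (V , st , snd , cmp) → phase-result st snd cmp })
      (search-within tgt 1 Q 2 tgt Tables.tgts (succ₁ tgt) (explore₁-correct tgt 1 Q) sd))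
    where open Prepared p

  module _ (flag : Fin m → Bool) (flag-marks : ℕ → ℕ)
           (flagged : ∀ j → flag-marks (mark (com j) (cur j)) ≡ (if flag j then 1 else 0)) where

    -- `flag-marks` is the memory as the first search left it. Only cells below `G` change here, so
    -- the flags of the remaining transitions stay readable.
    record Killing (i : ℕ) (κ M : ℕ → ℕ) (t : ℕ) : Set where
      field
        env     : Env κ
        rows    : Rows M
        nexts   : ∀ x → M ⟦ x ⟧ ≡ ⟦ next x ⟧
        labels  : ∀ x → M (1 + ⟦ x ⟧) ≡ lab x
        tgt-nil : M 2 ≡ 0
        killed  : ∀ j → toℕ j < i → M (2 + ⟦ cur j ⟧) ≡ ⟦ tgt₂ flag (cur j) ⟧ × M (2 + ⟦ com j ⟧) ≡ ⟦ tgt₂ flag (com j) ⟧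
        alive   : ∀ j → i ≤ toℕ j → M (2 + ⟦ cur j ⟧) ≡ ⟦ tgt (cur j) ⟧ × M (2 + ⟦ com j ⟧) ≡ ⟦ tgt (com j) ⟧
        high    : ∀ {a} → G ≤ a → M a ≡ flag-marks a
        top     : Q ≤ t

    Killing-of : ℕ → Store → Set
    Killing-of i s = Killing i (λ r → ρ s (13 + r)) (μ s) (ρ s rT)

    spare-step : ∀ {κ M t} j → Killing (toℕ j) κ M t → flag j ≡ true → Killing (suc (toℕ j)) κ M t
    spare-step {κ} {M} j inv f = record
      { env = env ; rows = rows ; nexts = nexts ; labels = labels ; tgt-nil = tgt-nil ; killed = killed′
      ; alive = λ i j<i → alive i (<⇒≤ j<i) ; high = high ; top = top }
      where
      open Killing inv
      killed′ : ∀ i → toℕ i < suc (toℕ j) → M (2 + ⟦ cur i ⟧) ≡ ⟦ tgt₂ flag (cur i) ⟧ × M (2 + ⟦ com i ⟧) ≡ ⟦ tgt₂ flag (com i) ⟧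
      killed′ i i≤j with toℕ i ≟ toℕ j
      ... | no  i≢j = killed i (≤∧≢⇒< (≤-pred i≤j) i≢j)
      ... | yes i≡j rewrite toℕ-injective i≡j | f = alive j ≤-refl

    kill-step : ∀ {κ M t} j → Killing (toℕ j) κ M t → flag j ≡ false →
      ∀ {M₁ M₂} → M₁ ≡ M [ 2 + ⟦ com j ⟧ ↦ 0 ] → M₂ ≡ M₁ [ 2 + ⟦ cur j ⟧ ↦ 0 ] → Killing (suc (toℕ j)) κ M₂ t
    kill-step {κ} {M} j inv f refl refl = record
      { env = env
      ; rows = λ x → trans (above (≤-trans W≤C (m≤m+n C _))) (rows x)
      ; nexts = λ x → trans (cell 0<3 x (λ ()) (λ ())) (nexts x)
      ; labels = λ x → trans (cell 1<3 x (λ ()) (λ ())) (labels x)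
      ; tgt-nil = trans (cell 2<3 nil (λ ()) (λ ())) tgt-nil
      ; killed = killed′
      ; alive = λ i j<i → let i≢j = <⇒≢ j<i ∘ sym in
          trans (cell-cur i i≢j) (proj₁ (alive i (<⇒≤ j<i))) , trans (cell-com i i≢j) (proj₂ (alive i (<⇒≤ j<i)))
      ; high = λ G≤a → trans (above (≤-trans W≤G G≤a)) (high G≤a)
      ; top = top }
      where
      open Killing inv
      M₁ = M [ 2 + ⟦ com j ⟧ ↦ 0 ]
      M₂ = M₁ [ 2 + ⟦ cur j ⟧ ↦ 0 ]
      above : ∀ {a} → W ≤ a → M₂ a ≡ M a
      above W≤a = trans (beyond-cell M₁ (cur j) _ 2<3 W≤a) (beyond-cell M (com j) _ 2<3 W≤a)
      cell : ∀ {f} → f < 3 → ∀ x → ¬ (f ≡ 2 × x ≡ cur j) → ¬ (f ≡ 2 × x ≡ com j) → M₂ (f + ⟦ x ⟧) ≡ M (f + ⟦ x ⟧)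
      cell f<3 x ne ne′ = trans (other-cell M₁ (cur j) x _ 2<3 f<3 ne) (other-cell M (com j) x _ 2<3 f<3 ne′)
      cell-cur : ∀ i → toℕ i ≢ toℕ j → M₂ (2 + ⟦ cur i ⟧) ≡ M (2 + ⟦ cur i ⟧)
      cell-cur i i≢j = cell 2<3 (cur i) (λ { (_ , eq) → i≢j (cong toℕ (cur-injective eq)) }) (λ ())
      cell-com : ∀ i → toℕ i ≢ toℕ j → M₂ (2 + ⟦ com i ⟧) ≡ M (2 + ⟦ com i ⟧)
      cell-com i i≢j = cell 2<3 (com i) (λ ()) (λ { (_ , eq) → i≢j (cong toℕ (com-injective eq)) })
      killed′ : ∀ i → toℕ i < suc (toℕ j) → M₂ (2 + ⟦ cur i ⟧) ≡ ⟦ tgt₂ flag (cur i) ⟧ × M₂ (2 + ⟦ com i ⟧) ≡ ⟦ tgt₂ flag (com i) ⟧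
      killed′ i i≤j with toℕ i ≟ toℕ j
      ... | no  i≢j = let k₁ , k₂ = killed i (≤∧≢⇒< (≤-pred i≤j) i≢j) in trans (cell-cur i i≢j) k₁ , trans (cell-com i i≢j) k₂
      ... | yes i≡j rewrite toℕ-injective i≡j | f =
        updated M₁ (2 + ⟦ cur j ⟧) 0 ,
        trans (other-cell M₁ (cur j) (com j) 0 2<3 2<3 (λ ())) (updated M (2 + ⟦ com j ⟧) 0)

    kill-within : ∀ {s} → Killing-of 0 s → Within (2 + (m * (2 + (11 + 2)) + 1)) (for-edges kill-unmarked) s (Killing-of m)
    kill-within = for-edges-within Killing-of Killing.env (λ inv → inv) each
      where
      each : ∀ j {s} → Killing-of (toℕ j) s → ρ s rA ≡ ⟦ cur j ⟧ →
        Within 11 kill-unmarked s (λ s′ → Killing-of (suc (toℕ j)) s′ × ρ s′ rA ≡ ρ s rA × ρ s′ rD ≡ ρ s rD)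
      each j {s} inv ≡a =
        after-ops ( when-within
          (λ u≡0 → spare-step j inv (spared (trans (sym unflagged) u≡0)) , refl , refl)
          (λ u≢0 → ops-within (kill-step j inv (doomed (u≢0 ∘ trans unflagged))
              {M₁ = M₁} {M₁ [ ρ s rA + ρ s rtwo ↦ ρ s rzero ]}
              (cong₂ (λ a b → μ s [ a ↦ b ]) (trans (cong₂ _+_ a+3m (env 2)) (+-comm ⟦ com j ⟧ 2)) (env 0))
              (cong₂ (λ a b → M₁ [ a ↦ b ]) (trans (cong₂ _+_ ≡a (env 2)) (+-comm ⟦ cur j ⟧ 2)) (env 0))
            , refl , refl)))
        where
        open Killing inv
        M₁ : ℕ → ℕ
        M₁ = μ s [ ρ s rA + ρ s r3m + ρ s rtwo ↦ ρ s rzero ]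
        a+3m : ρ s rA + ρ s r3m ≡ ⟦ com j ⟧
        a+3m = trans (cong₂ _+_ ≡a (env 5)) (sym (com-offset j))
        unflagged : ρ s rone ∸ μ s (μ s (ρ s rC + (ρ s rA + ρ s r3m)) + ρ s rA) ≡ 1 ∸ (if flag j then 1 else 0)
        unflagged = cong₂ _∸_ (env 1) (trans
          (cong (μ s) (cong₂ _+_ (trans (cong (μ s) (cong₂ _+_ (env 7) a+3m)) (rows (com j))) ≡a))
          (trans (high (mark≥G (com j) (cur j))) (flagged j)))
        spared : 1 ∸ (if flag j then 1 else 0) ≡ 0 → flag j ≡ true
        spared eq with flag j
        ... | true  = refl
        doomed : 1 ∸ (if flag j then 1 else 0) ≢ 0 → flag j ≡ false
        doomed ne with flag j
        ... | false = refl
        ... | true  = ⊥-elim (ne refl)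

    phase₂-within : ∀ {s} → (∀ x y → flag-marks (mark x y) ≤ 1) → Killing-of m s →
      Within (searchTime m 86) phase₂ s (Done-of (tgt₂ flag) 2 (Reach₂ flag))
    phase₂-within {s} marks≤1 p =
      after-ops (
      -- The second queue begins where the first one ended. Marks left over are at most 1, hence
      -- below the new key 2.
      seed-within (tgt₂ flag) 2 (ρ s rT) 0 next Tables.nexts (record
        { env = env ; key = refl ; rows = rows
        ; tables = record { nexts = nexts ; labels = labels ; tgts = tgts }
        ; visited = record
          { ins = λ () ; outs = λ {x} {y} _ → subst (_< 2) (sym (high (mark≥G x y))) (s≤s (marks≤1 x y)) ; unique = []
          ; base = top ; top = sym (+-identityʳ _) } })
        (cong₂ _+_ (env 0) refl) refl then λ sd →
      relax ≤-refl (λ { (V , st , snd , cmp) → phase-result st snd cmp })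
        (search-within (tgt₂ flag) 2 (ρ s rT) 0 next Tables.nexts (succ₂ (tgt₂ flag)) (explore₂-correct (tgt₂ flag) 2 (ρ s rT)) sd))
      where
      open Killing p
      tgts : ∀ x → μ s (2 + ⟦ x ⟧) ≡ ⟦ tgt₂ flag x ⟧
      tgts nil     = tgt-nil
      tgts (cur j) = proj₁ (killed j (toℕ<n j))
      tgts (com j) = proj₂ (killed j (toℕ<n j))

  module _ {tg : Node → Node} {R : Pair → Set} where

    record Collecting (i : ℕ) (κ M : ℕ → ℕ) (t l : ℕ) : Set where
      field
        done  : Done tg 2 R κ M t
        found : l ≢ 0 → ∃ λ j → R (cur j , cur j)
        none  : l ≡ 0 → ∀ j → toℕ j < i → ¬ R (cur j , cur j)

    Collecting-of : ℕ → Store → Set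
    Collecting-of i s = Collecting i (λ r → ρ s (13 + r)) (μ s) (ρ s rT) (ρ s rL)

    collect-within : ∀ {s} → Done-of tg 2 R s →
      Within (1 + (2 + (m * (2 + (6 + 2)) + 1))) (ops (rL ≔# 0 ∷ []) ⨾ for-edges collect-diagonal) s (Collecting-of m)
    collect-within {s} d = after-ops (
      for-edges-within Collecting-of (λ inv → Done.env (Collecting.done inv)) (λ inv → inv) each
        (record { done = d ; found = λ ne → ⊥-elim (ne refl) ; none = λ _ j () }))
      where
      each : ∀ j {s} → Collecting-of (toℕ j) s → ρ s rA ≡ ⟦ cur j ⟧ →
        Within 6 collect-diagonal s (λ s′ → Collecting-of (suc (toℕ j)) s′ × ρ s′ rA ≡ ρ s rA × ρ s′ rD ≡ ρ s rD)
      each j {s} inv ≡a = ops-within (record { done = done ; found = found′ (decide _ _) ; none = none′ } , refl , refl)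
        where
        open Collecting inv
        open Done done
        gain : ℕ
        gain = μ s (μ s (ρ s rC + ρ s rA) + ρ s rA) ∸ ρ s rone
        gain≡ : gain ≡ μ s (mark (cur j) (cur j)) ∸ 1
        gain≡ = cong₂ _∸_ (cong (μ s) (cong₂ _+_ (trans (cong (μ s) (cong₂ _+_ (env 7) ≡a)) (rows (cur j))) ≡a)) (env 1)
        found′ : Dec (R (cur j , cur j)) → ρ s rL + gain ≢ 0 → ∃ λ j → R (cur j , cur j)
        found′ (yes r) _  = j , r
        found′ (no ¬r) ne = found (λ l≡0 → ne (cong₂ _+_ l≡0 (trans gain≡ (m≤n⇒m∸n≡0 (≤-pred (clear ¬r))))))
        none′ : ρ s rL + gain ≡ 0 → ∀ i → toℕ i < suc (toℕ j) → ¬ R (cur i , cur i)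
        none′ eq i i≤j r with toℕ i ≟ toℕ j
        ... | no  i≢j = none (m+n≡0⇒m≡0 (ρ s rL) eq) i (≤∧≢⇒< (≤-pred i≤j) i≢j) r
        ... | yes i≡j rewrite toℕ-injective i≡j =
          1+n≢0 (trans (sym (trans gain≡ (cong (_∸ 1) (marked r)))) (m+n≡0⇒n≡0 (ρ s rL) eq))

  -- The verdict in terms of the two reachability relations, which is all that the argument about
  -- paths uses of the machine.
  record Decided (b : Bool) : Set where
    field
      flag     : Fin m → Bool
      flagged  : ∀ j → flag j ≡ true → Reach₁ (com j , cur j)
      flagged⁻ : ∀ j → Reach₁ (com j , cur j) → flag j ≡ true
      found    : b ≡ true → ∃ λ j → Reach₂ flag (cur j , cur j)
      none     : b ≡ false → ∀ j → ¬ Reach₂ flag (cur j , cur j)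

  main-within : Within (mainTime m) main (store (λ _ → 0) (contents (encode A))) (λ s → Decided (not (ρ s rL ≡ᵇ 0)))
  main-within =
    initialise-within then λ p₁ → link-heads-within p₁ then λ p₂ → link-targets-within p₂ then λ p₃ →
    tabulate-rows-within p₃ then λ p₄ → phase₁-within p₄ then λ {s} p₅ → rest s p₅
    where
    is-zero : ∀ l → not (l ≡ᵇ 0) ≡ false → l ≡ 0
    is-zero zero _ = refl
    nonzero : ∀ l → not (l ≡ᵇ 0) ≡ true → l ≢ 0
    nonzero (suc l) _ ()
    rest : ∀ s → Done-of tgt 1 Reach₁ s → Within _ _ s (λ s → Decided (not (ρ s rL ≡ᵇ 0)))
    rest s d =
      kill-within flag (μ s) flag≡ (record
        { env = env ; rows = rows ; nexts = nexts ; labels = labels ; tgt-nil = tgts nil ; killed = λ j ()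
        ; alive = λ j _ → tgts (cur j) , tgts (com j) ; high = λ _ → refl ; top = top }) then λ p₁ →
      phase₂-within flag (μ s) flag≡ marks≤1 p₁ then λ p₂ →
      relax ≤-refl (λ c → record
        { flag = flag ; flagged = flagged ; flagged⁻ = flagged⁻ ; found = Collecting.found c ∘ nonzero _
        ; none = λ eq j → Collecting.none c (is-zero _ eq) j (toℕ<n j) })
        (collect-within p₂)
      where
      open Done d
      open Tables tables
      flag : Fin m → Bool
      flag j = does (decide (com j) (cur j))
      flag≡ : ∀ j → μ s (mark (com j) (cur j)) ≡ (if flag j then 1 else 0)
      flag≡ j with decide (com j) (cur j)
      ... | yes r = marked r
      ... | no ¬r = n≤0⇒n≡0 (≤-pred (clear ¬r))
      marks≤1 : ∀ x y → μ s (mark x y) ≤ 1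
      marks≤1 x y with decide x y
      ... | yes r = ≤-reflexive (marked r)
      ... | no ¬r = <⇒≤ (clear ¬r)
      flagged : ∀ j → flag j ≡ true → Reach₁ (com j , cur j)
      flagged j eq with decide (com j) (cur j)
      ... | yes r = r
      flagged⁻ : ∀ j → Reach₁ (com j , cur j) → flag j ≡ true
      flagged⁻ j r with decide (com j) (cur j)
      ... | yes _ = refl
      ... | no ¬r = ⊥-elim (¬r r)

  run-main : ∃ λ b → run (decider main rL) (timeFactor * (1 + m ^ 2)) (start (encode A)) ≡ just b × Decided b
  run-main = conclude main-within
    where
    conclude : Within (mainTime m) main (store (λ _ → 0) (contents (encode A))) (λ s → Decided (not (ρ s rL ≡ᵇ 0))) →
      ∃ λ b → run (decider main rL) (timeFactor * (1 + m ^ 2)) (start (encode A)) ≡ just b × Decided b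
    conclude (within {s} e t≤ d) = not (ρ s rL ≡ᵇ 0) ,
      run-decider {main} rL (timeFactor * (1 + m ^ 2)) e (≤-trans (+-monoʳ-≤ 3 t≤) (mainTime≤ m)) , d

  -- Visited pairs as pairs of runs

  word-++ : ∀ (es es′ : List (Edge A)) → word (es ++ es′) ≡ word es ++ word es′
  word-++ = mapMaybe-++ label

  infixr 5 _++ᵖ_
  _++ᵖ_ : ∀ {p q r es es′} → IsPath A p es q → IsPath A q es′ r → IsPath A p (es ++ es′) r
  []      ++ᵖ ys = ys
  (e ∷ xs) ++ᵖ ys = e ∷ (xs ++ᵖ ys)

  uncons : ∀ {p e es q} → IsPath A p (e ∷ es) q → source e ≡ p × IsPath A (target e) es q
  uncons (_ ∷ path) = refl , path

  edge∈ : ∀ j → edge j ∈ transitions A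
  edge∈ = ∈-lookup

  single : ∀ j → IsPath A (source (edge j)) (edge j ∷ []) (target (edge j))
  single j = edge∈ j ∷ []

  edge-index : ∀ {e} → e ∈ transitions A → ∃ λ j → edge j ≡ e
  edge-index e∈ = Any.index e∈ , sym (lookup-index e∈)

  edge-injective : ∀ {i j} → edge i ≡ edge j → i ≡ j
  edge-injective = unique-lookup-injective (distinct A) _ _

  Connected : State A → State A → Set
  Connected p q = ∃ λ es → IsPath A p es q

  Cyclic : Edge A → Set
  Cyclic e = Connected (target e) (source e)

  hd-view : ∀ k p → hd k p ≡ nil ⊎ ∃ λ i → hd k p ≡ cur i × source (edge i) ≡ p × toℕ i < k
  hd-view zero    p = inj₁ refl
  hd-view (suc k) p with k <? m
  ... | no _ with hd-view k p
  ...   | inj₁ eq = inj₁ eq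
  ...   | inj₂ (i , eq , src , i<k) = inj₂ (i , eq , src , m<n⇒m<1+n i<k)
  hd-view (suc k) p | yes k<m with source (edge (fromℕ< k<m)) Fin.≟ p
  ... | yes src = inj₂ (fromℕ< k<m , refl , src , s≤s (≤-reflexive (toℕ-fromℕ< k<m)))
  ... | no  _ with hd-view k p
  ...   | inj₁ eq = inj₁ eq
  ...   | inj₂ (i , eq , src , i<k) = inj₂ (i , eq , src , m<n⇒m<1+n i<k)

  data _⇝_ : Node → Node → Set where
    stay : ∀ {x} → x ⇝ x
    skip : ∀ {x y} → next x ⇝ y → x ⇝ y

  -- Lists link a transition to the latest earlier one with the same source, so skipping from a head
  -- passes every transition of its state.
  hd⇝ : ∀ k i → toℕ i < k → hd k (source (edge i)) ⇝ cur i
  hd⇝ (suc k) i i<1+k with k <? m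
  ... | no k≮m = hd⇝ k i (≤-trans (toℕ<n i) (≮⇒≥ k≮m))
  ... | yes k<m with toℕ i ≟ k
  ...   | yes refl with source (edge (fromℕ< k<m)) Fin.≟ source (edge i)
  ...     | yes _ = subst (λ j → cur j ⇝ cur i) (sym (Finₚ.fromℕ<-toℕ i k<m)) stay
  ...     | no ne = ⊥-elim (ne (cong (source ∘ edge) (Finₚ.fromℕ<-toℕ i k<m)))
  hd⇝ (suc k) i i<1+k | yes k<m | no i≢k with source (edge (fromℕ< k<m)) Fin.≟ source (edge i)
  ... | no _ = hd⇝ k i (≤∧≢⇒< (≤-pred i<1+k) i≢k)
  ... | yes eq = skip (subst₂ (λ k p → hd k p ⇝ cur i) (sym (toℕ-fromℕ< k<m)) (sym eq) (hd⇝ k i (≤∧≢⇒< (≤-pred i<1+k) i≢k)))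

  nil⇝̸ : ∀ {i} → ¬ (nil ⇝ cur i)
  nil⇝̸ (skip s) = nil⇝̸ s

  hd-nonempty : ∀ i → ∃ λ i′ → hd m (source (edge i)) ≡ cur i′
  hd-nonempty i with hd-view m (source (edge i))
  ... | inj₂ (i′ , eq , _) = i′ , eq
  ... | inj₁ eq = ⊥-elim (nil⇝̸ (subst (_⇝ cur i) eq (hd⇝ m i (toℕ<n i))))

  guard∈ : ∀ b {u v} → v ∈ guard b u → T b × v ≡ u
  guard∈ true (here refl) = _ , refl

  ∈guard : ∀ b {v} → T b → v ∈ guard b v
  ∈guard true _ = here refl

  -- The first search and transitions on cycles

  Origin : Pair → Set
  Origin (x , y) = ∃ λ j → x ≡ com j × (y ≡ nil ⊎ ∃ λ i → y ≡ cur i × Connected (target (edge j)) (source (edge i)))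

  origin-hd : ∀ {k j p} → Connected (target (edge j)) p → Origin (com j , hd k p)
  origin-hd {k} {j} {p} c with hd-view k p
  ... | inj₁ eq = j , refl , inj₁ eq
  ... | inj₂ (i , eq , refl , _) = j , refl , inj₂ (i , eq , c)

  Reach₁⇒Origin : ∀ {u} → Reach₁ u → Origin u
  Reach₁⇒Origin (seeded j) = origin-hd {m} ([] , [])
  Reach₁⇒Origin (move r v∈) with Reach₁⇒Origin r
  Reach₁⇒Origin (move r (here refl))         | j , refl , inj₁ refl           = j , refl , inj₁ refl
  Reach₁⇒Origin (move r (there (here refl))) | j , refl , inj₁ refl           = j , refl , inj₁ refl
  Reach₁⇒Origin (move r (here refl))         | j , refl , inj₂ (i , refl , c) = origin-hd {toℕ i} c
  Reach₁⇒Origin (move r (there (here refl))) | j , refl , inj₂ (i , refl , (es , c)) =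
    origin-hd {m} (es ++ edge i ∷ [] , c ++ᵖ single i)

  Reach₁⇒Cyclic : ∀ j → Reach₁ (com j , cur j) → Cyclic (edge j)
  Reach₁⇒Cyclic j r with Reach₁⇒Origin r
  ... | _ , refl , inj₂ (_ , refl , c) = c

  skip₁ : ∀ {x y z} → Reach₁ (x , y) → y ⇝ z → Reach₁ (x , z)
  skip₁ r stay     = r
  skip₁ r (skip s) = skip₁ (move r (here refl)) s

  follow₁ : ∀ {x p es i} → Reach₁ (x , hd m p) → IsPath A p es (source (edge i)) → Reach₁ (x , cur i)
  follow₁ {i = i} r [] = skip₁ r (hd⇝ m i (toℕ<n i))
  follow₁ r (e∈ ∷ path) with edge-index e∈
  ... | j , refl = follow₁ (move (skip₁ r (hd⇝ m j (toℕ<n j))) (there (here refl))) path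

  Cyclic⇒Reach₁ : ∀ j → Cyclic (edge j) → Reach₁ (com j , cur j)
  Cyclic⇒Reach₁ j (es , path) = follow₁ (seeded j) path

  letter-injective : ∀ {a b : Maybe (Letter A)} → letter a ≡ letter b → a ≡ b
  letter-injective {just a}  {just b}  eq = cong just (toℕ-injective (suc-injective eq))
  letter-injective {nothing} {nothing} eq = refl

  -- The criterion known as EDA, a state with two different cycles of one label, in the form where
  -- already the first transitions differ.
  record DistinctCycles : Set where
    field
      {base}   : State A
      {e e′}   : Edge A
      {σ σ′}   : List (Edge A)
      differ   : e ≢ e′
      cycle    : IsPath A base (e ∷ σ) base
      cycle′   : IsPath A base (e′ ∷ σ′) base
      same     : word (e ∷ σ) ≡ word (e′ ∷ σ′)

  word-[]⇒ε : ∀ (es : List (Edge A)) → word es ≡ [] → All (λ e → label e ≡ nothing) es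
  word-[]⇒ε []                       _  = []
  word-[]⇒ε ((_ —[ nothing ]→ _) ∷ es) eq = refl ∷ word-[]⇒ε es eq

  -- Soundness of the second search

  module _ (flag : Fin m → Bool) where

    private
      tg : Node → Node
      tg = tgt₂ flag

    -- A moved left run carries a way back to its origin. On the diagonal both runs are at one
    -- state, so this way back closes both of them into cycles.
    data Left (j : Fin m) : Node → List (Edge A) → Set where
      pending : Left j (com j) []
      moved   : ∀ {i σ} → IsPath A (source (edge j)) (edge j ∷ σ) (source (edge i)) →
                Connected (source (edge i)) (source (edge j)) → Left j (cur i) (edge j ∷ σ)

    -- Lists run through decreasing indices, so a right run that starts behind `j` can only begin
    -- with a transition of smaller index. This is what makes the first transitions differ.
    data Right (j : Fin m) : Node → List (Edge A) → Set where
      waiting : ∀ {i} → source (edge i) ≡ source (edge j) → toℕ i < toℕ j → Right j (cur i) []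
      moved   : ∀ {i i′ σ} → toℕ i′ < toℕ j → IsPath A (source (edge j)) (edge i′ ∷ σ) (source (edge i)) →
                Right j (cur i) (edge i′ ∷ σ)

    -- A pair that the second search visits is either dead or records two runs from a common state
    -- that spell the same word, the left one starting with an edge that the right one skipped.
    Runs : Pair → Set
    Runs (x , y) = x ≡ nil ⊎ y ≡ nil ⊎ ∃ λ j → ∃ λ es → ∃ λ es′ → Left j x es × Right j y es′ × word es ≡ word es′

    next-Left : ∀ {j x es} → Left j x es → next x ≡ nil ⊎ Left j (next x) es
    next-Left pending = inj₁ refl
    next-Left (moved {i} path back) with hd-view (toℕ i) (source (edge i))
    ... | inj₁ eq = inj₁ eq
    ... | inj₂ (i′ , eq , src , _) rewrite eq =
          inj₂ (moved (subst (IsPath A _ _) (sym src) path) (subst (λ q → Connected q _) (sym src) back))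

    next-Right : ∀ {j y es} → Right j y es → next y ≡ nil ⊎ Right j (next y) es
    next-Right (waiting {i} eq i<j) with hd-view (toℕ i) (source (edge i))
    ... | inj₁ eq′ = inj₁ eq′
    ... | inj₂ (i′ , eq′ , src , i′<i) rewrite eq′ = inj₂ (waiting (trans src eq) (<-trans i′<i i<j))
    next-Right (moved {i} i′<j path) with hd-view (toℕ i) (source (edge i))
    ... | inj₁ eq = inj₁ eq
    ... | inj₂ (i″ , eq , src , _) rewrite eq = inj₂ (moved i′<j (subst (IsPath A _ _) (sym src) path))

    module _ (flagged : ∀ j → flag j ≡ true → Cyclic (edge j)) where

      take-Left : ∀ {j x es} → Left j x es → tg x ≡ nil ⊎ ∃ λ e → letter (label e) ≡ lab x × Left j (tg x) (es ++ e ∷ [])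
      take-Left {j} pending with flag j in fl
      ... | false = inj₁ refl
      ... | true with hd-view m (target (edge j))
      ...   | inj₁ eq = inj₁ eq
      ...   | inj₂ (i , eq , src , _) rewrite eq = inj₂ (edge j , refl ,
              moved (subst (IsPath A _ _) (sym src) (single j)) (subst (λ q → Connected q _) (sym src) (flagged j fl)))
      take-Left (moved {i} path (back , backs)) with flag i in fl
      ... | false = inj₁ refl
      ... | true with hd-view m (target (edge i)) | flagged i fl
      ...   | inj₁ eq | _ = inj₁ eq
      -- Transition `i` lies on a cycle, so the new way back goes from its target round to its
      -- source and then along the old one.
      ...   | inj₂ (i′ , eq , src , _) | around , arounds rewrite eq = inj₂ (edge i , refl ,
              moved (subst (IsPath A _ _) (sym src) (path ++ᵖ single i))
                    (subst (λ q → Connected q _) (sym src) (around ++ back , arounds ++ᵖ backs)))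

      take-Right : ∀ {j y es} → Right j y es → tg y ≡ nil ⊎ ∃ λ e → letter (label e) ≡ lab y × Right j (tg y) (es ++ e ∷ [])
      take-Right (waiting {i} eq i<j) with flag i
      ... | false = inj₁ refl
      ... | true with hd-view m (target (edge i))
      ...   | inj₁ eq′ = inj₁ eq′
      ...   | inj₂ (i′ , eq′ , src , _) rewrite eq′ = inj₂ (edge i , refl ,
              moved i<j (subst₂ (λ p q → IsPath A p (edge i ∷ []) q) eq (sym src) (single i)))
      take-Right (moved {i} i′<j path) with flag i
      ... | false = inj₁ refl
      ... | true with hd-view m (target (edge i))
      ...   | inj₁ eq′ = inj₁ eq′
      ...   | inj₂ (i″ , eq′ , src , _) rewrite eq′ = inj₂ (edge i , refl ,
              moved i′<j (subst (IsPath A _ _) (sym src) (path ++ᵖ single i)))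

      private
        word-ε : ∀ {e : Edge A} es → letter (label e) ≡ 0 → word (es ++ e ∷ []) ≡ word es
        word-ε {_ —[ nothing ]→ _} es _ = trans (word-++ es _) (++-identityʳ (word es))

        word-snoc : ∀ {e e′ : Edge A} es es′ → letter (label e) ≡ letter (label e′) → word es ≡ word es′ →
          word (es ++ e ∷ []) ≡ word (es′ ++ e′ ∷ [])
        word-snoc {_ —[ a ]→ _} {_ —[ b ]→ _} es es′ eq weq with letter-injective {a} {b} eq
        ... | refl = trans (word-++ es _) (trans (cong (_++ catMaybes (a ∷ [])) weq) (sym (word-++ es′ _)))

        case-succ₂ : ∀ {x y v} → v ∈ succ₂ tg (x , y) →
          v ≡ (next x , y) ⊎ v ≡ (x , next y) ⊎ (lab x ≡ 0 × v ≡ (tg x , y)) ⊎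
          (lab y ≡ 0 × v ≡ (x , tg y)) ⊎ (lab x ≡ lab y × v ≡ (tg x , tg y))
        case-succ₂ (here refl) = inj₁ refl
        case-succ₂ (there (here refl)) = inj₂ (inj₁ refl)
        case-succ₂ {x} {y} (there (there v∈)) with ∈-++⁻ (guard (lab x ≡ᵇ 0) (tg x , y)) v∈
        ... | inj₁ v∈′ = let t , eq = guard∈ (lab x ≡ᵇ 0) v∈′ in inj₂ (inj₂ (inj₁ (≡ᵇ⇒≡ _ _ t , eq)))
        ... | inj₂ v∈′ with ∈-++⁻ (guard (lab y ≡ᵇ 0) (x , tg y)) v∈′
        ...   | inj₁ v∈″ = let t , eq = guard∈ (lab y ≡ᵇ 0) v∈″ in inj₂ (inj₂ (inj₂ (inj₁ (≡ᵇ⇒≡ _ _ t , eq))))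
        ...   | inj₂ v∈″ = let t , eq = guard∈ (lab x ≡ᵇ lab y) v∈″ in inj₂ (inj₂ (inj₂ (inj₂ (≡ᵇ⇒≡ _ _ t , eq))))

        step-Runs : ∀ {x y v} → Runs (x , y) → v ∈ succ₂ tg (x , y) → Runs v
        step-Runs (inj₁ x≡nil) v∈ with case-succ₂ v∈
        ... | inj₁ refl                              = inj₁ (cong next x≡nil)
        ... | inj₂ (inj₁ refl)                       = inj₁ x≡nil
        ... | inj₂ (inj₂ (inj₁ (_ , refl)))          = inj₁ (cong tg x≡nil)
        ... | inj₂ (inj₂ (inj₂ (inj₁ (_ , refl))))   = inj₁ x≡nil
        ... | inj₂ (inj₂ (inj₂ (inj₂ (_ , refl))))   = inj₁ (cong tg x≡nil)
        step-Runs (inj₂ (inj₁ y≡nil)) v∈ with case-succ₂ v∈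
        ... | inj₁ refl                              = inj₂ (inj₁ y≡nil)
        ... | inj₂ (inj₁ refl)                       = inj₂ (inj₁ (cong next y≡nil))
        ... | inj₂ (inj₂ (inj₁ (_ , refl)))          = inj₂ (inj₁ y≡nil)
        ... | inj₂ (inj₂ (inj₂ (inj₁ (_ , refl))))   = inj₂ (inj₁ (cong tg y≡nil))
        ... | inj₂ (inj₂ (inj₂ (inj₂ (_ , refl))))   = inj₂ (inj₁ (cong tg y≡nil))
        step-Runs (inj₂ (inj₂ (j , es , es′ , l , r , weq))) v∈ with case-succ₂ v∈
        ... | inj₁ refl with next-Left l
        ...   | inj₁ eq = inj₁ eq
        ...   | inj₂ l′ = inj₂ (inj₂ (j , es , es′ , l′ , r , weq))
        step-Runs (inj₂ (inj₂ (j , es , es′ , l , r , weq))) v∈ | inj₂ (inj₁ refl) with next-Right r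
        ...   | inj₁ eq = inj₂ (inj₁ eq)
        ...   | inj₂ r′ = inj₂ (inj₂ (j , es , es′ , l , r′ , weq))
        step-Runs (inj₂ (inj₂ (j , es , es′ , l , r , weq))) v∈ | inj₂ (inj₂ (inj₁ (ε , refl))) with take-Left l
        ...   | inj₁ eq = inj₁ eq
        ...   | inj₂ (e , leq , l′) = inj₂ (inj₂ (j , es ++ e ∷ [] , es′ , l′ , r , trans (word-ε es (trans leq ε)) weq))
        step-Runs (inj₂ (inj₂ (j , es , es′ , l , r , weq))) v∈ | inj₂ (inj₂ (inj₂ (inj₁ (ε , refl)))) with take-Right r
        ...   | inj₁ eq = inj₂ (inj₁ eq)
        ...   | inj₂ (e , leq , r′) = inj₂ (inj₂ (j , es , es′ ++ e ∷ [] , l , r′ , trans weq (sym (word-ε es′ (trans leq ε)))))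
        step-Runs (inj₂ (inj₂ (j , es , es′ , l , r , weq))) v∈ | inj₂ (inj₂ (inj₂ (inj₂ (same , refl)))) with take-Left l | take-Right r
        ...   | inj₁ eq | _ = inj₁ eq
        ...   | inj₂ _  | inj₁ eq = inj₂ (inj₁ eq)
        ...   | inj₂ (e , leq , l′) | inj₂ (e′ , leq′ , r′) =
                inj₂ (inj₂ (j , es ++ e ∷ [] , es′ ++ e′ ∷ [] , l′ , r′ , word-snoc es es′ (trans leq (trans same (sym leq′))) weq))

      Reach₂⇒Runs : ∀ {u} → Reach₂ flag u → Runs u
      Reach₂⇒Runs (seeded j) with hd-view (toℕ j) (source (edge j))
      ... | inj₁ eq = inj₂ (inj₁ eq)
      ... | inj₂ (i , eq , src , i<j) rewrite eq = inj₂ (inj₂ (j , [] , [] , pending , waiting src i<j , refl))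
      Reach₂⇒Runs (move r v∈) = step-Runs (Reach₂⇒Runs r) v∈

      diagonal⇒cycles : εCycleFree A → ∀ {i} → Reach₂ flag (cur i , cur i) → DistinctCycles
      diagonal⇒cycles εfree r with Reach₂⇒Runs r
      ... | inj₁ ()
      ... | inj₂ (inj₁ ())
      -- The right run has not moved and is still at the origin, so the left run has returned there
      -- with the empty word: an ε-cycle.
      ... | inj₂ (inj₂ (j , _ , _ , moved {σ = σ} path _ , waiting src _ , weq)) =
            ⊥-elim (εfree (source (edge j)) (edge j ∷ σ) (λ ()) (subst (IsPath A _ _) src path) (word-[]⇒ε (edge j ∷ σ) weq))
      ... | inj₂ (inj₂ (j , _ , _ , moved {σ = σ} path (back , backs) , moved {i′ = i′} {σ = σ′} i′<j path′ , weq)) = record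
            { differ = λ eq → <⇒≢ i′<j (cong toℕ (sym (edge-injective {j} {i′} eq)))
            ; cycle  = path ++ᵖ backs
            ; cycle′ = path′ ++ᵖ backs
            ; same   = trans (word-++ (edge j ∷ σ) back) (trans (cong (_++ word back) weq) (sym (word-++ (edge i′ ∷ σ′) back)))
            }

    -- Completeness of the second search

    module _ (flagged⁻ : ∀ j → Cyclic (edge j) → flag j ≡ true) where

      -- The rest of a run: each transition in turn is reached by skipping and then taken, until the
      -- head of the list of `r`. Stated for nodes instead of states, it also covers the committed
      -- node `com j`.
      data Ahead (r : State A) : Node → List (Edge A) → Set where
        arrived : Ahead r (hd m r) []
        ahead   : ∀ {x x′ e es} → x ⇝ x′ → tg x′ ≡ hd m (target e) → lab x′ ≡ letter (label e) →
                  Ahead r (hd m (target e)) es → Ahead r x (e ∷ es)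

      tg-cur : ∀ j → Cyclic (edge j) → tg (cur j) ≡ hd m (target (edge j))
      tg-cur j c rewrite flagged⁻ j c = refl

      tg-com : ∀ j → Cyclic (edge j) → tg (com j) ≡ hd m (target (edge j))
      tg-com j c rewrite flagged⁻ j c = refl

      path-Ahead : ∀ {p es r} → IsPath A p es r → All Cyclic es → Ahead r (hd m p) es
      path-Ahead [] [] = arrived
      path-Ahead (e∈ ∷ path) (c ∷ cs) with edge-index e∈
      ... | j , refl = ahead (hd⇝ m j (toℕ<n j)) (tg-cur j c) refl (path-Ahead path cs)

      skipˡ : ∀ {x x′ y} → Reach₂ flag (x , y) → x ⇝ x′ → Reach₂ flag (x′ , y)
      skipˡ r stay     = r
      skipˡ r (skip s) = skipˡ (move r (here refl)) s

      skipʳ : ∀ {x y y′} → Reach₂ flag (x , y) → y ⇝ y′ → Reach₂ flag (x , y′)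
      skipʳ r stay     = r
      skipʳ r (skip s) = skipʳ (move r (there (here refl))) s

      takeˡ : ∀ {x y} → Reach₂ flag (x , y) → lab x ≡ 0 → Reach₂ flag (tg x , y)
      takeˡ {x} {y} r ε = move r (there (there (∈-++⁺ˡ (∈guard (lab x ≡ᵇ 0) (≡⇒≡ᵇ (lab x) 0 ε)))))

      takeʳ : ∀ {x y} → Reach₂ flag (x , y) → lab y ≡ 0 → Reach₂ flag (x , tg y)
      takeʳ {x} {y} r ε = move r (there (there (∈-++⁺ʳ (guard (lab x ≡ᵇ 0) _) (∈-++⁺ˡ (∈guard (lab y ≡ᵇ 0) (≡⇒≡ᵇ (lab y) 0 ε))))))

      take-both : ∀ {x y} → Reach₂ flag (x , y) → lab x ≡ lab y → Reach₂ flag (tg x , tg y)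
      take-both {x} {y} r same = move r (there (there (∈-++⁺ʳ (guard (lab x ≡ᵇ 0) _) (∈-++⁺ʳ (guard (lab y ≡ᵇ 0) _)
        (∈guard (lab x ≡ᵇ lab y) (≡⇒≡ᵇ (lab x) (lab y) same))))))

      -- ε-transitions are taken singly, left ones before right ones, until both runs face a letter;
      -- the letters agree because the words do.
      meet : ∀ {r x y es es′} → Ahead r x es → Ahead r y es′ → word es ≡ word es′ → Reach₂ flag (x , y) → Reach₂ flag (hd m r , hd m r)
      meet arrived arrived _ reach = reach
      meet {r} {x} (ahead {e = _ —[ nothing ]→ _} s tgeq labeq a) b weq reach =
        meet a b weq (subst (λ z → Reach₂ flag (z , _)) tgeq (takeˡ (skipˡ reach s) labeq))
      meet arrived (ahead {e = _ —[ nothing ]→ _} s tgeq labeq b) weq reach =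
        meet arrived b weq (subst (λ z → Reach₂ flag (_ , z)) tgeq (takeʳ (skipʳ reach s) labeq))
      meet a@(ahead {e = _ —[ just _ ]→ _} _ _ _ _) (ahead {e = _ —[ nothing ]→ _} s tgeq labeq b) weq reach =
        meet a b weq (subst (λ z → Reach₂ flag (_ , z)) tgeq (takeʳ (skipʳ reach s) labeq))
      meet (ahead {e = _ —[ just c ]→ _} s tgeq labeq a) (ahead {e = _ —[ just d ]→ _} s′ tgeq′ labeq′ b) weq reach =
        meet a b (∷-injectiveʳ weq) (subst₂ (λ z z′ → Reach₂ flag (z , z′)) tgeq tgeq′
          (take-both (skipʳ (skipˡ reach s) s′) (trans labeq (trans (cong (suc ∘ toℕ) (∷-injectiveˡ weq)) (sym labeq′)))))

      -- Every transition has a way back from its target to its source; joined in reverse order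
      -- these lead back along the whole path.
      reverse-Cyclic : ∀ {p es r} → IsPath A p es r → All Cyclic es → Connected r p
      reverse-Cyclic [] [] = [] , []
      reverse-Cyclic (e∈ ∷ path) ((back , backs) ∷ cs) with reverse-Cyclic path cs
      ... | rest , rests = rest ++ back , rests ++ᵖ backs

      -- The verdict inspects pairs `(cur k , cur k)` and not `(nil , nil)`, so the meeting state
      -- must have a nonempty list. The way back from it starts with a suitable transition, or is
      -- empty, and then the path itself leaves that state.
      leaving-edge : ∀ {p e es r} → IsPath A p (e ∷ es) r → All Cyclic (e ∷ es) → ∃ λ i → source (edge i) ≡ r
      leaving-edge path@(e∈ ∷ _) cs with reverse-Cyclic path cs
      ... | _ , [] = let i , eq = edge-index e∈ in i , cong source eq
      ... | _ , (e′∈ ∷ _) = let i , eq = edge-index e′∈ in i , cong source eq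

      diverge : ∀ {p r e e′ σ σ′} j i → edge j ≡ e → edge i ≡ e′ →
        IsPath A p (e ∷ σ) r → All Cyclic (e ∷ σ) → IsPath A p (e′ ∷ σ′) r → All Cyclic (e′ ∷ σ′) →
        toℕ i < toℕ j → word (e ∷ σ) ≡ word (e′ ∷ σ′) → ∃ λ k → Reach₂ flag (cur k , cur k)
      diverge {r = r} j i refl refl P cs@(c ∷ cs₁) P′ (c′ ∷ cs₁′) i<j weq = result
        where
        same-source : source (edge i) ≡ source (edge j)
        same-source = trans (proj₁ (uncons P′)) (sym (proj₁ (uncons P)))
        met : Reach₂ flag (hd m r , hd m r)
        met = meet (ahead {e = edge j} stay (tg-com j c) refl (path-Ahead (proj₂ (uncons P)) cs₁))
                   (ahead {e = edge i} stay (tg-cur i c′) refl (path-Ahead (proj₂ (uncons P′)) cs₁′)) weq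
                   -- The seed puts the right run on the part of the list behind `j`, where `i`
                   -- still lies ahead because `i < j`.
                   (skipʳ (seeded j) (subst (λ p → hd (toℕ j) p ⇝ cur i) same-source (hd⇝ (toℕ j) i i<j)))
        result : ∃ λ k → Reach₂ flag (cur k , cur k)
        result with leaving-edge P cs
        ... | k , refl with hd-nonempty k
        ...   | k′ , eq = k′ , subst (λ x → Reach₂ flag (x , x)) eq met

      -- Where two such paths first separate, the transition of larger index is the one to commit
      -- to, whichever path it belongs to. An empty path beside a nonempty one would make the latter
      -- an ε-cycle.
      cyclic-path-unique : εCycleFree A → (∀ k → ¬ Reach₂ flag (cur k , cur k)) →
        ∀ {p r es es′} → IsPath A p es r → All Cyclic es → IsPath A p es′ r → All Cyclic es′ → word es ≡ word es′ → es ≡ es′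
      cyclic-path-unique εfree none [] _ [] _ _ = refl
      cyclic-path-unique εfree none {es′ = es′} [] _ path@(_ ∷ _) _ weq = ⊥-elim (εfree _ es′ (λ ()) path (word-[]⇒ε es′ (sym weq)))
      cyclic-path-unique εfree none {es = es} path@(_ ∷ _) _ [] _ weq = ⊥-elim (εfree _ es (λ ()) path (word-[]⇒ε es weq))
      cyclic-path-unique εfree none {es = (_ —[ a ]→ _) ∷ σ} {_ ∷ σ′} P@(e∈ ∷ path) cs@(_ ∷ cs₁) P′@(e′∈ ∷ path′) cs′@(_ ∷ cs₁′) weq
        with edge-index e∈ | edge-index e′∈
      ... | j , eqj | i , eqi with <-cmp (toℕ i) (toℕ j)
      ...   | tri< i<j _ _ = ⊥-elim (none _ (proj₂ (diverge j i eqj eqi P cs P′ cs′ i<j weq)))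
      ...   | tri> _ _ j<i = ⊥-elim (none _ (proj₂ (diverge i j eqi eqj P′ cs′ P cs j<i (sym weq))))
      ...   | tri≈ _ i≡j _ with trans (sym eqj) (trans (cong edge (sym (toℕ-injective i≡j))) eqi)
      ...     | refl = cong (_ ∷_) (cyclic-path-unique εfree none path cs₁ path′ cs₁′ (cancel a (map label σ) (map label σ′) weq))
        where
        cancel : ∀ a (u v : List (Maybe (Letter A))) → catMaybes (a ∷ u) ≡ catMaybes (a ∷ v) → catMaybes u ≡ catMaybes v
        cancel (just _) u v eq = ∷-injectiveʳ eq
        cancel nothing  u v eq = eq

  -- Counting successful paths

  _≟ᵉ_ : DecidableEquality (Edge A)
  (p —[ a ]→ q) ≟ᵉ (p′ —[ a′ ]→ q′) = map′ (λ { (refl , refl , refl) → refl }) (λ { refl → refl , refl , refl })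
    (p Fin.≟ p′ ×-dec Maybeₚ.≡-dec Fin._≟_ a a′ ×-dec q Fin.≟ q′)

  _≟ᵖ_ : DecidableEquality (List (Edge A))
  _≟ᵖ_ = ≡-dec _≟ᵉ_

  _∈ᵉ?_ : (e : Edge A) (es : List (Edge A)) → Dec (e ∈ es)
  _∈ᵉ?_ = DecMembership._∈?_ _≟ᵉ_

  isPath? : ∀ p es q → Dec (IsPath A p es q)
  isPath? p [] q = map′ (λ { refl → [] }) (λ { [] → refl }) (p Fin.≟ q)
  isPath? p (e ∷ es) q = map′ (λ { (refl , e∈ , path) → e∈ ∷ path }) (λ { (e∈ ∷ path) → refl , e∈ , path })
    (source e Fin.≟ p ×-dec e ∈ᵉ? transitions A ×-dec isPath? (target e) es q)

  successful? : ∀ x π → Dec (Successful A x π)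
  successful? x (i , es) = Subsetₚ._∈?_ i (initial A) ×-dec
    Finₚ.any? (λ f → Subsetₚ._∈?_ f (final A) ×-dec isPath? i es f) ×-dec ≡-dec Fin._≟_ (word es) x

  path-edges : ∀ {p es q} → IsPath A p es q → All (_∈ transitions A) es
  path-edges []          = []
  path-edges (e∈ ∷ path) = e∈ ∷ path-edges path

  path-split : ∀ {p es q e} → IsPath A p es q → e ∈ es →
    ∃ λ es₁ → ∃ λ es₂ → es ≡ es₁ ++ e ∷ es₂ × IsPath A p es₁ (source e)
  path-split {es = _ ∷ es} (_ ∷ path) (here refl) = [] , es , refl , []
  path-split {es = e′ ∷ _} (e′∈ ∷ path) (there e∈) with path-split path e∈
  ... | es₁ , es₂ , refl , path₁ = e′ ∷ es₁ , es₂ , refl , e′∈ ∷ path₁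

  module _ (εfree : εCycleFree A) where

    -- A repeated source would close an ε-cycle. Hence a block of consecutive ε-transitions has at
    -- most one transition per state.
    ε-sources-unique : ∀ {p es q} → IsPath A p es q → All (λ e → label e ≡ nothing) es → Unique (map source es)
    ε-sources-unique [] [] = []
    ε-sources-unique {es = e ∷ es} (e∈ ∷ path) (ε ∷ εs) = All.tabulate fresh ∷ ε-sources-unique path εs
      where
      fresh : ∀ {s} → s ∈ map source es → source e ≢ s
      fresh s∈ refl with ∈-map⁻ source s∈
      ... | e′ , e′∈ , src≡ with path-split path e′∈
      ...   | es₁ , es₂ , refl , path₁ = εfree (source e) (e ∷ es₁) (λ ())
              (subst (IsPath A (source e) (e ∷ es₁)) (sym src≡) (e∈ ∷ path₁)) (ε ∷ Allₚ.++⁻ˡ es₁ εs)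

    -- The form of the length bound that admits induction: the leading ε-block is kept apart, so
    -- that each letter pays `1 + n` for itself and the block behind it.
    ε-prefix : ∀ {p es q} → IsPath A p es q → ∃ λ es₁ → ∃ λ es₂ → ∃ λ r → es ≡ es₁ ++ es₂ ×
      IsPath A p es₁ r × All (λ e → label e ≡ nothing) es₁ × length es₂ ≤ length (word es) * (1 + n)
    path-length : ∀ {p es q} → IsPath A p es q → length es ≤ (1 + length (word es)) * (1 + n)

    ε-prefix [] = [] , [] , _ , refl , [] , [] , z≤n
    ε-prefix {es = (_ —[ nothing ]→ _) ∷ _} (e∈ ∷ path) with ε-prefix path
    ... | es₁ , es₂ , r , refl , path₁ , ε , le = _ ∷ es₁ , es₂ , r , refl , e∈ ∷ path₁ , refl ∷ ε , le
    ε-prefix {es = (_ —[ just _ ]→ _) ∷ es} (e∈ ∷ path) with ε-prefix path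
    ... | es₁ , es₂ , r , refl , path₁ , ε , le = [] , _ , _ , refl , [] , [] , s≤s (begin
      length (es₁ ++ es₂)              ≡⟨ length-++ es₁ ⟩
      length es₁ + length es₂          ≡⟨ cong (_+ length es₂) (length-map source es₁) ⟨
      length (map source es₁) + length es₂ ≤⟨ +-mono-≤ (unique-Fin⇒length≤ (ε-sources-unique path₁ ε)) le ⟩
      n + length (word es) * (1 + n)   ∎)
      where open ≤-Reasoning

    path-length {es = es} path with ε-prefix path
    ... | es₁ , es₂ , r , refl , path₁ , ε , le = begin
      length (es₁ ++ es₂)              ≡⟨ length-++ es₁ ⟩
      length es₁ + length es₂          ≡⟨ cong (_+ length es₂) (length-map source es₁) ⟨
      length (map source es₁) + length es₂ ≤⟨ +-mono-≤ (m≤n⇒m≤1+n (unique-Fin⇒length≤ (ε-sources-unique path₁ ε))) le ⟩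
      1 + n + length (word es) * (1 + n)   ∎
      where open ≤-Reasoning

  edgeLists : ℕ → List (List (Edge A))
  edgeLists zero    = [] ∷ []
  edgeLists (suc b) = [] ∷ cartesianProductWith _∷_ (transitions A) (edgeLists b)

  ∈-edgeLists : ∀ {es} b → All (_∈ transitions A) es → length es ≤ b → es ∈ edgeLists b
  ∈-edgeLists zero    []        _        = here refl
  ∈-edgeLists (suc b) []        _        = here refl
  ∈-edgeLists (suc b) (e∈ ∷ es) (s≤s le) = there (∈-cartesianProductWith⁺ _∷_ e∈ (∈-edgeLists b es le))

  -- Polynomially many paths from unique segments

  module _ (εfree : εCycleFree A) (cyclic? : ∀ {e} → e ∈ transitions A → Dec (Cyclic e))
    (path-unique : ∀ {p r es es′} → IsPath A p es r → All Cyclic es → IsPath A p es′ r → All Cyclic es′ →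
      word es ≡ word es′ → es ≡ es′) where

    Segment : State A → State A → List (Letter A) → List (Edge A) → Set
    Segment p q u es = IsPath A p es q × All Cyclic es × word es ≡ u

    segment? : ∀ p q u es → Dec (Segment p q u es)
    segment? p q u es with isPath? p es q
    ... | no ¬path = no (¬path ∘ proj₁)
    ... | yes path = map′ (path ,_) proj₂ (all-cyclic? (path-edges path) ×-dec ≡-dec Fin._≟_ (word es) u)
      where
      all-cyclic? : ∀ {es} → All (_∈ transitions A) es → Dec (All Cyclic es)
      all-cyclic? []        = yes []
      all-cyclic? (e∈ ∷ es) = map′ (λ { (c , cs) → c ∷ cs }) (λ { (c ∷ cs) → c , cs }) (cyclic? e∈ ×-dec all-cyclic? es)

    short : List (Letter A) → List (List (Edge A))
    short u = deduplicate _≟ᵖ_ (edgeLists ((1 + length u) * (1 + n)))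

    -- The list that is filtered can be exponentially long and only makes the set of segments
    -- explicit; its size is bounded through `path-unique`.
    segments : State A → State A → List (Letter A) → List (List (Edge A))
    segments p q u = filter (segment? p q u) (short u)

    ∈-segments : ∀ {p q es} → IsPath A p es q → All Cyclic es → es ∈ segments p q (word es)
    ∈-segments {p} {q} {es} path cs = ∈-filter⁺ (segment? p q (word es)) {xs = short (word es)}
      (∈-deduplicate⁺ _≟ᵖ_ (∈-edgeLists _ (path-edges path) (path-length εfree path))) (path , cs , refl)

    segments-sound : ∀ p q u {es} → es ∈ segments p q u → Segment p q u es
    segments-sound p q u es∈ = proj₂ (∈-filter⁻ (segment? p q u) {xs = short u} es∈)

    length-segments : ∀ p q u → length (segments p q u) ≤ 1
    length-segments p q u = unique-singleton {xs = segments p q u}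
      (Uniqueₚ.filter⁺ (segment? p q u) (DecUniqueₚ.deduplicate-! _≟ᵖ_ (edgeLists ((1 + length u) * (1 + n))))) same
      where
      same : ∀ {es es′} → es ∈ segments p q u → es′ ∈ segments p q u → es ≡ es′
      same es∈ es′∈ =
        let path , cs , eq = segments-sound p q u es∈ ; path′ , cs′ , eq′ = segments-sound p q u es′∈
        in path-unique path cs path′ cs′ (trans eq (sym eq′))

    -- A path cut at its `d` transitions that lie on no cycle. The path behind each cut is stored in
    -- order to exclude repetitions.
    data Crossing : ℕ → State A → List (Edge A) → State A → Set where
      uncrossed : ∀ {p es q} → IsPath A p es q → All Cyclic es → Crossing 0 p es q
      crossed   : ∀ {d p es e rest q} → IsPath A p es (source e) → All Cyclic es → e ∈ transitions A → ¬ Cyclic e →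
              IsPath A (target e) rest q → Crossing d (target e) rest q → Crossing (suc d) p (es ++ e ∷ rest) q

    crossings : ∀ {p es q} → IsPath A p es q → ∃ λ d → Crossing d p es q
    crossings [] = 0 , uncrossed [] []
    crossings (e∈ ∷ path) with cyclic? e∈ | crossings path
    ... | no ¬c | d , c                                     = suc d , crossed [] [] e∈ ¬c path c
    ... | yes c | _ , uncrossed _ cs                             = _ , uncrossed (e∈ ∷ path) (c ∷ cs)
    ... | yes c | _ , crossed path₁ cs e′∈ ¬c path₂ crossing  = _ , crossed (e∈ ∷ path₁) (c ∷ cs) e′∈ ¬c path₂ crossing

    crossing-edges : ∀ {d p es q} → Crossing d p es q → ∃ λ N → length N ≡ d × Unique N × All (_∈ es) N × All (_∈ transitions A) N
    crossing-edges (uncrossed _ _) = [] , refl , [] , [] , []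
    crossing-edges (crossed {es = es} {e} _ _ e∈ ¬c path c) with crossing-edges c
    ... | N , len , u , N⊆ , N∈ = e ∷ N , cong suc len , All.map fresh N⊆ ∷ u ,
          ∈-++⁺ʳ es (here refl) ∷ All.map (∈-++⁺ʳ es ∘ there) N⊆ , e∈ ∷ N∈
      where
      fresh : ∀ {e′} → e′ ∈ _ → e ≢ e′
      fresh e′∈ refl with path-split path e′∈
      -- A second occurrence of `e` behind the cut yields a path from its target to its source.
      ... | es₁ , _ , _ , path₁ = ¬c (es₁ , path₁)

    crossing≤m : ∀ {d p es q} → Crossing d p es q → d ≤ m
    crossing≤m c with crossing-edges c
    ... | N , refl , u , _ , N∈ = unique-⊆⇒length≤ u (All.lookup N∈)

    -- The two numbers are the lengths of the label before a crossed transition and up to its end.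
    -- They differ by at most 1, but letting them vary independently keeps the count polynomial.
    positions : ℕ → List (ℕ × ℕ × Edge A)
    positions k = cartesianProduct (upTo (1 + k)) (cartesianProduct (upTo (1 + k)) (transitions A))

    paths : ℕ → State A → List (Letter A) → List (List (Edge A))
    extend : ℕ → State A → List (Letter A) → ℕ × ℕ × Edge A → List (List (Edge A))
    paths zero    p x = concatMap (λ q → segments p q x) (allFin n)
    paths (suc d) p x = concatMap (λ q → segments p q x) (allFin n) ++ concatMap (extend d p x) (positions (length x))
    extend d p x (i , k , e) =
      concatMap (λ es → map (λ rest → es ++ e ∷ rest) (paths d (target e) (drop k x))) (segments p (source e) (take i x))

    -- A polynomial in `k` of degree at most `2 * d`. The factors `n` count the possible ends of the
    -- last segment, the factors `1` the segments between given ends with a given label.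
    pathBound : ℕ → ℕ → ℕ
    pathBound zero    k = n * 1
    pathBound (suc d) k = n * 1 + (1 + k) * ((1 + k) * m) * (1 * pathBound d k)

    pathBound-mono : ∀ d {k l} → k ≤ l → pathBound d k ≤ pathBound d l
    pathBound-mono zero    _   = ≤-refl
    pathBound-mono (suc d) k≤l = +-monoʳ-≤ (n * 1) (*-mono-≤ (*-mono-≤ (s≤s k≤l) (*-monoˡ-≤ m (s≤s k≤l))) (*-monoʳ-≤ 1 (pathBound-mono d k≤l)))

    length-paths : ∀ d p x → length (paths d p x) ≤ pathBound d (length x)
    length-extend : ∀ d p x pos → length (extend d p x pos) ≤ 1 * pathBound d (length x)

    length-flat : ∀ p x → length (concatMap (λ q → segments p q x) (allFin n)) ≤ n * 1
    length-flat p x = ≤-trans (length-concatMap≤ (λ q → segments p q x) (λ q → length-segments p q x) (allFin n))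
      (*-monoˡ-≤ 1 (≤-reflexive (length-tabulate {n = n} id)))

    length-positions : ∀ k → length (positions k) ≡ (1 + k) * ((1 + k) * m)
    length-positions k = trans (length-cartesianProduct (upTo (1 + k)) (cartesianProduct (upTo (1 + k)) (transitions A)))
      (cong₂ _*_ (length-upTo (1 + k)) (trans (length-cartesianProduct (upTo (1 + k)) (transitions A)) (cong (_* m) (length-upTo (1 + k)))))

    length-paths zero    p x = length-flat p x
    length-paths (suc d) p x = begin
      length (paths (suc d) p x)                       ≡⟨ length-++ (concatMap (λ q → segments p q x) (allFin n)) ⟩
      _
        ≤⟨ +-mono-≤ (length-flat p x) (length-concatMap≤ (extend d p x) (length-extend d p x) (positions (length x))) ⟩
      n * 1 + length (positions (length x)) * (1 * pathBound d (length x))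
        ≡⟨ cong (λ l → n * 1 + l * (1 * pathBound d (length x))) (length-positions (length x)) ⟩
      pathBound (suc d) (length x)                          ∎
      where open ≤-Reasoning

    length-extend d p x (i , k , e) = ≤-trans
      (length-concatMap≤ _ (λ es → ≤-trans (≤-reflexive (length-map _ (paths d (target e) (drop k x))))
        (≤-trans (length-paths d (target e) (drop k x)) (pathBound-mono d (≤-trans (≤-reflexive (length-drop k x)) (m∸n≤m (length x) k)))))
        (segments p (source e) (take i x)))
      (*-monoˡ-≤ (pathBound d (length x)) (length-segments p (source e) (take i x)))

    flat⊆paths : ∀ d {p x es} → es ∈ concatMap (λ q → segments p q x) (allFin n) → es ∈ paths d p x
    flat⊆paths zero    es∈ = es∈
    flat⊆paths (suc d) es∈ = ∈-++⁺ˡ es∈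

    -- `D` may exceed the number of crossings because every level of `paths` also lists the
    -- uncrossed paths; so `D = m` serves all paths at once.
    ∈-paths : ∀ {d D p es q} → Crossing d p es q → d ≤ D → es ∈ paths D p (word es)
    ∈-paths {D = D} {p} {es} {q} (uncrossed path cs) _ =
      flat⊆paths D (∈-concatMap (λ q → segments p q (word es)) (∈-allFin q) (∈-segments path cs))
    ∈-paths {D = suc D} {p} (crossed {es = es} {e} {rest} path cs e∈ _ _ crossing) (s≤s d≤D) =
      ∈-++⁺ʳ (concatMap (λ q → segments p q x) (allFin n)) (∈-concatMap (extend D p x) pos∈ extended)
      where
      x u : List (Letter A)
      x = word (es ++ e ∷ rest)
      u = word (es ++ e ∷ [])
      i k : ℕ
      i = length (word es)
      k = length u
      x≡₁ : x ≡ word es ++ word (e ∷ rest)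
      x≡₁ = word-++ es (e ∷ rest)
      x≡₂ : x ≡ u ++ word rest
      x≡₂ = trans (cong word (sym (++-assoc es (e ∷ []) rest))) (word-++ (es ++ e ∷ []) rest)
      pos∈ : (i , k , e) ∈ positions (length x)
      pos∈ = ∈-cartesianProduct⁺ (∈-upTo⁺ (s≤s (≤-trans (length-++-≤ˡ (word es)) (≤-reflexive (cong length (sym x≡₁))))))
        (∈-cartesianProduct⁺ (∈-upTo⁺ (s≤s (≤-trans (length-++-≤ˡ u) (≤-reflexive (cong length (sym x≡₂)))))) e∈)
      take≡ : take i x ≡ word es
      take≡ = trans (cong (take i) x≡₁) (take-++ (word es) _)
      drop≡ : drop k x ≡ word rest
      drop≡ = trans (cong (drop k) x≡₂) (drop-++ u (word rest))
      extended : es ++ e ∷ rest ∈ extend D p x (i , k , e)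
      extended = ∈-concatMap (λ es → map (λ rest → es ++ e ∷ rest) (paths D (target e) (drop k x)))
        (subst (λ y → es ∈ segments p (source e) y) (sym take≡) (∈-segments path cs))
        (∈-map⁺ (λ rest → es ++ e ∷ rest) (subst (λ y → rest ∈ paths D (target e) y) (sym drop≡) (∈-paths crossing d≤D)))

    candidates : List (Letter A) → List (State A × List (Edge A))
    candidates x = concatMap (λ i → map (i ,_) (paths m i x)) (allFin n)

    length-candidates : ∀ x → length (candidates x) ≤ n * pathBound m (length x)
    length-candidates x = ≤-trans (length-concatMap≤ _ (λ i → ≤-trans (≤-reflexive (length-map (i ,_) (paths m i x))) (length-paths m i x))
        (allFin n))
      (*-monoˡ-≤ (pathBound m (length x)) (≤-reflexive (length-tabulate {n = n} id)))

    ∈-candidates : ∀ {x π} → Successful A x π → π ∈ candidates x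
    ∈-candidates {π = i , es} (_ , (_ , _ , path) , refl) =
      ∈-concatMap (λ i → map (i ,_) (paths m i (word es))) (∈-allFin i)
        (∈-map⁺ (i ,_) (let _ , c = crossings path in ∈-paths c (crossing≤m c)))

    poly : ℕ → List ℕ
    poly zero    = n * 1 ∷ []
    -- The factor `(1 + X)²` multiplied out: `0 ∷ map (2 *_) h` is `2X` times `h`, and `0 ∷ 0 ∷ h`
    -- is `X²` times `h`.
    poly (suc d) = (n * 1 ∷ []) ⊞ map (m *_) (poly d ⊞ (0 ∷ map (2 *_) (poly d)) ⊞ (0 ∷ 0 ∷ poly d))

    eval-poly : ∀ d k → eval (poly d) k ≡ pathBound d k
    eval-poly zero    k = trans (cong (n * 1 +_) (*-zeroʳ k)) (+-identityʳ _)
    eval-poly (suc d) k = begin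
      eval (poly (suc d)) k  ≡⟨ eval-⊞ (n * 1 ∷ []) (map (m *_) (h ⊞ h₁ ⊞ h₂)) k ⟩
      (n * 1 + k * 0) + eval (map (m *_) (h ⊞ h₁ ⊞ h₂)) k  ≡⟨ cong ((n * 1 + k * 0) +_) (eval-scale m (h ⊞ h₁ ⊞ h₂) k) ⟩
      (n * 1 + k * 0) + m * eval (h ⊞ h₁ ⊞ h₂) k
        ≡⟨ cong (λ v → (n * 1 + k * 0) + m * v) (trans (eval-⊞ (h ⊞ h₁) h₂ k) (cong (_+ eval h₂ k) (eval-⊞ h h₁ k))) ⟩
      (n * 1 + k * 0) + m * (eval h k + (0 + k * eval (map (2 *_) h) k) + (0 + k * (0 + k * eval h k)))
        ≡⟨ cong (λ v → (n * 1 + k * 0) + m * (eval h k + (0 + k * v) + (0 + k * (0 + k * eval h k)))) (eval-scale 2 h k) ⟩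
      (n * 1 + k * 0) + m * (eval h k + (0 + k * (2 * eval h k)) + (0 + k * (0 + k * eval h k)))
        ≡⟨ cong (λ v → (n * 1 + k * 0) + m * (v + (0 + k * (2 * v)) + (0 + k * (0 + k * v)))) (eval-poly d k) ⟩
      (n * 1 + k * 0) + m * (pathBound d k + (0 + k * (2 * pathBound d k)) + (0 + k * (0 + k * pathBound d k)))
        ≡⟨ collect n m k (pathBound d k) ⟩
      pathBound (suc d) k  ∎
      where
      open ≡-Reasoning
      h h₁ h₂ : List ℕ
      h = poly d
      h₁ = 0 ∷ map (2 *_) h
      h₂ = 0 ∷ 0 ∷ h
      collect : ∀ n m k s → (n * 1 + k * 0) + m * (s + (0 + k * (2 * s)) + (0 + k * (0 + k * s))) ≡ n * 1 + (1 + k) * ((1 + k) * m) * (1 * s)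
      collect = solve-∀

    polynomially-ambiguous : PolynomiallyAmbiguous A
    polynomially-ambiguous = map (n *_) (poly m) , λ x → length (elements x) , record
      { elements = elements x
      ; unique   = Uniqueₚ.filter⁺ (successful? x) (DecUniqueₚ.deduplicate-! _≟ˢ_ (candidates x))
      ; exact    = λ π → mk⇔ (λ π∈ → proj₂ (∈-filter⁻ (successful? x) {xs = deduplicate _≟ˢ_ (candidates x)} π∈))
                             (λ s → ∈-filter⁺ (successful? x) (∈-deduplicate⁺ _≟ˢ_ (∈-candidates s)) s)
      ; size     = refl
      } , (begin
        length (elements x)                             ≤⟨ length-filter (successful? x) (deduplicate _≟ˢ_ (candidates x)) ⟩
        length (deduplicate _≟ˢ_ (candidates x))        ≤⟨ length-deduplicate _≟ˢ_ (candidates x) ⟩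
        length (candidates x)                           ≤⟨ length-candidates x ⟩
        n * pathBound m (length x)                           ≡⟨ cong (n *_) (eval-poly m (length x)) ⟨
        n * eval (poly m) (length x)                    ≡⟨ eval-scale n (poly m) (length x) ⟨
        eval (map (n *_) (poly m)) (length x)           ∎)
      where
      open ≤-Reasoning
      _≟ˢ_ : DecidableEquality (State A × List (Edge A))
      _≟ˢ_ = Productₚ.≡-dec Fin._≟_ _≟ᵖ_
      elements : List (Letter A) → List (State A × List (Edge A))
      elements x = filter (successful? x) (deduplicate _≟ˢ_ (candidates x))

  -- Exponentially many paths from two cycles

  module _ (dc : DistinctCycles) where

    open DistinctCycles dc

    blocks : ℕ → List (List (Edge A))
    blocks zero    = [] ∷ []
    blocks (suc k) = map ((e ∷ σ) ++_) (blocks k) ++ map ((e′ ∷ σ′) ++_) (blocks k)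

    label-of-blocks : ℕ → List (Letter A)
    label-of-blocks zero    = []
    label-of-blocks (suc k) = word (e ∷ σ) ++ label-of-blocks k

    length-blocks : ∀ k → length (blocks k) ≡ 2 ^ k
    length-blocks zero    = refl
    length-blocks (suc k) = trans (length-++ (map ((e ∷ σ) ++_) (blocks k))) (trans
      (cong₂ _+_ (trans (length-map _ (blocks k)) (length-blocks k)) (trans (length-map _ (blocks k)) (length-blocks k)))
      (cong (2 ^ k +_) (sym (+-identityʳ (2 ^ k)))))

    -- The two cycles form a prefix code, since their first transitions differ.
    blocks-unique : ∀ k → Unique (blocks k)
    blocks-unique zero    = [] ∷ []
    blocks-unique (suc k) = Uniqueₚ.++⁺ (Uniqueₚ.map⁺ (++-cancelˡ (e ∷ σ) _ _) (blocks-unique k))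
      (Uniqueₚ.map⁺ (++-cancelˡ (e′ ∷ σ′) _ _) (blocks-unique k)) disjoint
      where
      disjoint : ∀ {b} → b ∈ map ((e ∷ σ) ++_) (blocks k) × b ∈ map ((e′ ∷ σ′) ++_) (blocks k) → ⊥
      disjoint (b∈ , b∈′) with ∈-map⁻ ((e ∷ σ) ++_) b∈ | ∈-map⁻ ((e′ ∷ σ′) ++_) b∈′
      ... | _ , _ , eq | _ , _ , eq′ = differ (∷-injectiveˡ (trans (sym eq) eq′))

    blocks-sound : ∀ k {b} → b ∈ blocks k → IsPath A base b base × word b ≡ label-of-blocks k
    blocks-sound zero    (here refl) = [] , refl
    blocks-sound (suc k) b∈ with ∈-++⁻ (map ((e ∷ σ) ++_) (blocks k)) b∈
    ... | inj₁ b∈′ with ∈-map⁻ ((e ∷ σ) ++_) b∈′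
    ...   | b , b∈″ , refl with blocks-sound k b∈″
    ...     | path , eq = cycle ++ᵖ path , trans (word-++ (e ∷ σ) b) (cong (word (e ∷ σ) ++_) eq)
    blocks-sound (suc k) b∈ | inj₂ b∈′ with ∈-map⁻ ((e′ ∷ σ′) ++_) b∈′
    ...   | b , b∈″ , refl with blocks-sound k b∈″
    ...     | path , eq = cycle′ ++ᵖ path , trans (word-++ (e′ ∷ σ′) b) (cong₂ _++_ (sym same) eq)

    length-label : ∀ k → length (label-of-blocks k) ≡ k * length (word (e ∷ σ))
    length-label zero    = refl
    length-label (suc k) = trans (length-++ (word (e ∷ σ))) (cong (length (word (e ∷ σ)) +_) (length-label k))

    module _ {i f pre post} (i∈I : i ∈ₛ initial A) (f∈F : f ∈ₛ final A)
      (path₁ : IsPath A i pre base) (path₂ : IsPath A base post f) (k : ℕ) where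

      wrap : List (Edge A) → State A × List (Edge A)
      wrap b = i , pre ++ b ++ post

      wrap-injective : ∀ {b b′} → wrap b ≡ wrap b′ → b ≡ b′
      wrap-injective eq = ++-cancelʳ post _ _ (++-cancelˡ pre _ _ (Productₚ.,-injectiveʳ eq))

      wrapped-word : List (Letter A)
      wrapped-word = word pre ++ label-of-blocks k ++ word post

      length-wrapped-word : length wrapped-word ≡ length (word pre) + length (word post) + k * length (word (e ∷ σ))
      length-wrapped-word = trans (length-++ (word pre)) (trans (cong (length (word pre) +_)
        (trans (length-++ (label-of-blocks k)) (cong (_+ length (word post)) (length-label k))))
        (rearrange (length (word pre)) (k * length (word (e ∷ σ))) (length (word post))))
        where
        rearrange : ∀ a b c → a + (b + c) ≡ a + c + b
        rearrange = solve-∀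

      wrap-successful : ∀ {b} → b ∈ blocks k → Successful A wrapped-word (wrap b)
      wrap-successful {b} b∈ = i∈I , (f , f∈F , path₁ ++ᵖ proj₁ (blocks-sound k b∈) ++ᵖ path₂) ,
        trans (word-++ pre (b ++ post)) (cong (word pre ++_)
          (trans (word-++ b post) (cong (_++ word post) (proj₂ (blocks-sound k b∈)))))

      2^≤da : ∀ {N} → da[ A , wrapped-word ]≤ N → 2 ^ k ≤ N
      2^≤da {N} (a , count , a≤N) = begin
        2 ^ k                        ≡⟨ length-blocks k ⟨
        length (blocks k)            ≡⟨ length-map wrap (blocks k) ⟨
        length (map wrap (blocks k)) ≤⟨ unique-⊆⇒length≤ (Uniqueₚ.map⁺ wrap-injective (blocks-unique k)) counted ⟩
        length (elements count)      ≡⟨ size count ⟩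
        a                            ≤⟨ a≤N ⟩
        N                            ∎
        where
        open ≤-Reasoning
        open Count using (elements; exact; size)
        counted : ∀ {π} → π ∈ map wrap (blocks k) → π ∈ elements count
        counted {π} π∈ with ∈-map⁻ wrap π∈
        ... | b , b∈ , refl = Equivalence.from (exact count (wrap b)) (wrap-successful b∈)

    -- Trimness leads from an initial state to `base` and on to a final state. This turns the
    -- `2 ^ k` closed paths into successful ones with a common label of length linear in `k`.
    not-polynomially-ambiguous : Trim A → ¬ PolynomiallyAmbiguous A
    not-polynomially-ambiguous trim (h , bound) = absurd (trim base)
      where
      absurd : (∃ λ i → ∃ λ es → ∃ λ es′ → ∃ λ f → i ∈ₛ initial A × f ∈ₛ final A × IsPath A i es base × IsPath A base es′ f) → ⊥
      absurd (i , pre , post , f , i∈I , f∈F , path₁ , path₂) =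
        outgrown (eval<2^ h (length (word pre) + length (word post)) (length (word (e ∷ σ))))
        where
        outgrown : (∃ λ k → eval h (length (word pre) + length (word post) + k * length (word (e ∷ σ))) < 2 ^ k) → ⊥
        outgrown (k , small) = <⇒≱ small (subst (λ l → 2 ^ k ≤ eval h l) (length-wrapped-word i∈I f∈F path₁ path₂ k)
          (2^≤da i∈I f∈F path₁ path₂ k (bound (wrapped-word i∈I f∈F path₁ path₂ k))))

  -- From the verdict to exponential ambiguity

  finitely⇒polynomially : FinitelyAmbiguous A → PolynomiallyAmbiguous A
  finitely⇒polynomially (N , bound) = N ∷ [] , λ x → let a , count , a≤N = bound x in
    a , count , ≤-trans a≤N (≤-reflexive (sym (trans (cong (N +_) (*-zeroʳ (length x))) (+-identityʳ N))))

  -- For the verdict `true` it suffices to refute polynomial ambiguity: a constant bound is a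
  -- polynomial, so infinite ambiguity follows.
  decided : Trim A → εCycleFree A → ∀ b → Decided b → Reflects (ExponentiallyAmbiguous A) b
  decided trim εfree true d = ofʸ ((λ fin → ¬poly (finitely⇒polynomially fin)) , ¬poly)
    where
    open Decided d
    ¬poly : ¬ PolynomiallyAmbiguous A
    ¬poly = not-polynomially-ambiguous
      (diagonal⇒cycles flag (λ j f → Reach₁⇒Cyclic j (flagged j f)) εfree (proj₂ (found refl))) trim
  decided trim εfree false d = ofⁿ (λ { (_ , ¬poly) → ¬poly (polynomially-ambiguous εfree cyclic?
      (cyclic-path-unique flag (λ j c → flagged⁻ j (Cyclic⇒Reach₁ j c)) εfree (none refl))) })
    where
    open Decided d
    cyclic-edge? : ∀ j → Dec (Cyclic (edge j))
    cyclic-edge? j = map′ (λ f → Reach₁⇒Cyclic j (flagged j f)) (λ c → flagged⁻ j (Cyclic⇒Reach₁ j c))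
      (flag j Bool.≟ true)
    cyclic? : ∀ {e} → e ∈ transitions A → Dec (Cyclic e)
    cyclic? e∈ = let j , eq = edge-index e∈ in subst (λ e → Dec (Cyclic e)) eq (cyclic-edge? j)

theorem4 : ∃ λ (P : Program) → ∃ λ (c : ℕ) → ∀ (A : Automaton) → Trim A → εCycleFree A →
    ∃ λ b → run P (c * (1 + ∣ A ∣ᴱ ^ 2)) (start (encode A)) ≡ just b
    × Reflects (ExponentiallyAmbiguous A) b
theorem4 = decider main rL , timeFactor , λ A trim εfree → conclude A trim εfree (run-main A)
  where
  conclude : ∀ A → Trim A → εCycleFree A →
    (∃ λ b → run (decider main rL) (timeFactor * (1 + ∣ A ∣ᴱ ^ 2)) (start (encode A)) ≡ just b × Decided A b) →
    ∃ λ b → run (decider main rL) (timeFactor * (1 + ∣ A ∣ᴱ ^ 2)) (start (encode A)) ≡ just b × Reflects (ExponentiallyAmbiguous A) b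
  conclude A trim εfree (b , ran , d) = b , ran , decided A trim εfree b d
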